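{- For every integer $h\ge 2$ the following hold. (1) There exists an integer $N_h>0$ such that $a_h(n)\ge b_h(n)$ for all $n>N_h$. (2) There exists a constant $\gamma_h>1$ such that $a_h(n)/b_h(n)\to\gamma_h$ as $n\to\infty$.
   Context: A partition $\lambda=(\lambda_1\ge\lambda_2\ge\dots\ge\lambda_\ell>0)$ of $n$ is drawn as its Ferrers diagram: left-adjusted rows of boxes, with $\lambda_i$ boxes in row $i$. The hook number of the box in row $i$ and column $j$ is the number of boxes in the L-shape consisting of that box, all boxes to its right in the same row, and all boxes below it in the same column. $\mathcal H(\lambda)$ denotes the multiset of all hook numbers of $\lambda$. Let $\mathcal O(n)$ be the set of partitions of $n$ all of whose parts are odd and $\mathcal D(n)$ the set of partitions of $n$ whose parts are pairwise distinct. For integers $h\ge1$ and $n\ge0$, define $$a_h(n)=\sum_{\lambda\in\mathcal O(n)}\#\{x\in\mathcal H(\lambda):x=h\},\qquad b_h(n)=\sum_{\lambda\in\mathcal D(n)}\#\{x\in\mathcal H(\lambda):x=h\},$$ counted with multiplicity. -}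

module Defs where

open import Data.Fin using (toℕ)
import Data.Integer as ℤ
open import Data.List using (List; []; _∷_; [_]; map; concatMap; filter; length; lookup; upTo; allFin)
open import Data.List.Membership.Propositional using (_∈_; find; lose)
open import Data.List.Membership.Propositional.Properties
  using (∈-map⁺; ∈-map⁻; ∈-concatMap⁺; ∈-concatMap⁻; ∈-upTo⁺; ∈-upTo⁻)
open import Data.List.Properties using (∷-injective; ∷-injectiveʳ)
open import Data.List.Relation.Binary.Disjoint.Propositional using (Disjoint)
open import Data.List.Relation.Unary.All as All using (All; []; _∷_)
import Data.List.Relation.Unary.All.Properties as All
open import Data.List.Relation.Unary.AllPairs as AllPairs using (AllPairs; []; _∷_)
import Data.List.Relation.Unary.AllPairs.Properties as AllPairs
open import Data.List.Relation.Unary.Any using (here)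
open import Data.List.Relation.Unary.Linked using (Linked; []; [-]; _∷_)
open import Data.List.Relation.Unary.Unique.DecPropositional using (unique?)
open import Data.List.Relation.Unary.Unique.Propositional using (Unique)
import Data.List.Relation.Unary.Unique.Propositional.Properties as Unique
open import Data.Nat
open import Data.Nat.Divisibility using (_∣_; _∣?_)
open import Data.Nat.ListAction using (sum)
open import Data.Nat.Properties
open import Data.Product using (Σ; ∃-syntax; _×_; _,_; proj₁; proj₂)
open import Data.Rational as ℚ using (ℚ; 0ℚ; 1ℚ; ½)
import Data.Rational.Properties as ℚ
open import Data.Sum using (_⊎_; inj₁; inj₂)
open import Function using (_∘_)
open import Relation.Binary.PropositionalEquality hiding ([_])
open import Relation.Nullary using (¬_; Dec; yes; no; ¬?; _×-dec_; _⊎-dec_)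

------------------------------------------------------------------------
-- Partitions

record IsPartition (n : ℕ) (λs : List ℕ) : Set where
  constructor isPartition
  field
    decreasing : Linked _≥_ λs
    positive   : All (0 <_) λs
    total      : sum λs ≡ n

-- partitionsUpTo f m n lists the partitions of n with all parts at most m and
-- at most f parts.  The argument f makes the recursion structural.
partitionsUpTo : (f m n : ℕ) → List (List ℕ)
partitionsUpTo _       m zero    = [ [] ]
partitionsUpTo zero    m (suc n) = []
partitionsUpTo (suc f) m (suc n) =
  concatMap (λ i → map (suc i ∷_) (partitionsUpTo f (suc i) (n ∸ i)))
            (upTo (m ⊓ suc n))

-- By partitions-sound, partitions-complete and partitions-unique below, each
-- partition of n occurs in this list exactly once.
partitions : ℕ → List (List ℕ)
partitions n = partitionsUpTo n n n

OddParts : List ℕ → Set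
OddParts = All (λ p → ¬ (2 ∣ p))

oddParts? : ∀ λs → Dec (OddParts λs)
oddParts? = All.all? (λ p → ¬? (2 ∣? p))

𝒪 : ℕ → List (List ℕ)
𝒪 n = filter oddParts? (partitions n)

𝒟 : ℕ → List (List ℕ)
𝒟 n = filter (unique? _≟_) (partitions n)

------------------------------------------------------------------------
-- Hook numbers

-- A box is a pair (row , column); both coordinates are counted from 0.
Box : Set
Box = ℕ × ℕ

boxes : List ℕ → List Box
boxes λs =
  concatMap (λ i → map (λ j → toℕ i , j) (upTo (lookup λs i))) (allFin (length λs))

InHook : Box → Box → Set
InHook (i , j) (i′ , j′) = (i′ ≡ i × j ≤ j′) ⊎ (i < i′ × j′ ≡ j)

inHook? : ∀ x y → Dec (InHook x y)
inHook? (i , j) (i′ , j′) = ((i′ ≟ i) ×-dec (j ≤? j′)) ⊎-dec ((i <? i′) ×-dec (j′ ≟ j))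

hookNumber : List ℕ → Box → ℕ
hookNumber λs x = length (filter (inHook? x) (boxes λs))

-- The multiset ℋ(λ), as a list.
ℋ : List ℕ → List ℕ
ℋ λs = map (hookNumber λs) (boxes λs)

multiplicity : ℕ → List ℕ → ℕ
multiplicity h xs = length (filter (_≟ h) xs)

a : ℕ → ℕ → ℕ
a h n = sum (map (multiplicity h ∘ ℋ) (𝒪 n))

b : ℕ → ℕ → ℕ
b h n = sum (map (multiplicity h ∘ ℋ) (𝒟 n))

------------------------------------------------------------------------
-- Real numbers, as Cauchy sequences of rationals with a modulus

IsCauchy : (ℕ → ℚ) → Set
IsCauchy x = ∀ ε → 0ℚ ℚ.< ε →
  ∃[ N ] (∀ m n → m ≥ N → n ≥ N → ℚ.∣ x m ℚ.- x n ∣ ℚ.< ε)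

record ℝ : Set where
  constructor mkℝ
  field
    approx : ℕ → ℚ
    cauchy : IsCauchy approx

open ℝ public

infix 4 _<ᴿ_

_<ᴿ_ : ℝ → ℝ → Set
x <ᴿ y = ∃[ δ ] (0ℚ ℚ.< δ × ∃[ N ] (∀ n → n ≥ N → approx x n ℚ.+ δ ℚ.≤ approx y n))

private
  double-½ : ∀ ε → ½ ℚ.* ε ℚ.+ ½ ℚ.* ε ≡ ε
  double-½ ε = trans (sym (ℚ.*-distribʳ-+ ε ½ ½)) (ℚ.*-identityˡ ε)

  half-pos : ∀ {ε} → 0ℚ ℚ.< ε → 0ℚ ℚ.< ½ ℚ.* ε
  half-pos {ε} 0<ε = subst (ℚ._< ½ ℚ.* ε) (ℚ.*-zeroʳ ½) (ℚ.*-monoʳ-<-pos ½ 0<ε)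

  open import Data.Rational.Solver using (module +-*-Solver)
  open +-*-Solver using (solve; _:+_; _:-_; :-_; _:=_)

  swap-sub : ∀ p q r s → (p ℚ.- q) ℚ.- (r ℚ.- s) ≡ (p ℚ.- r) ℚ.- (q ℚ.- s)
  swap-sub = solve 4 (λ p q r s → (p :- q) :- (r :- s) := (p :- r) :- (q :- s)) refl

  ∣p∣-∣q∣≤∣p-q∣ : ∀ p q → ℚ.∣ p ∣ ℚ.- ℚ.∣ q ∣ ℚ.≤ ℚ.∣ p ℚ.- q ∣
  ∣p∣-∣q∣≤∣p-q∣ p q = begin
    ℚ.∣ p ∣ ℚ.- ℚ.∣ q ∣                          ≡⟨ cong (λ r → ℚ.∣ r ∣ ℚ.- ℚ.∣ q ∣) (split p q) ⟩
    ℚ.∣ (p ℚ.- q) ℚ.+ q ∣ ℚ.- ℚ.∣ q ∣            ≤⟨ ℚ.+-monoˡ-≤ (ℚ.- ℚ.∣ q ∣) (ℚ.∣p+q∣≤∣p∣+∣q∣ (p ℚ.- q) q) ⟩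
    (ℚ.∣ p ℚ.- q ∣ ℚ.+ ℚ.∣ q ∣) ℚ.- ℚ.∣ q ∣      ≡⟨ cancel ℚ.∣ p ℚ.- q ∣ ℚ.∣ q ∣ ⟩
    ℚ.∣ p ℚ.- q ∣                                ∎
    where
    open ℚ.≤-Reasoning
    split : ∀ p q → p ≡ (p ℚ.- q) ℚ.+ q
    split = solve 2 (λ p q → p := (p :- q) :+ q) refl
    cancel : ∀ p q → (p ℚ.+ q) ℚ.- q ≡ p
    cancel = solve 2 (λ p q → (p :+ q) :- q := p) refl

  neg-sub : ∀ p q → ℚ.- (p ℚ.- q) ≡ q ℚ.- p
  neg-sub = solve 2 (λ p q → :- (p :- q) := q :- p) refl

  ∣p-q∣≡∣q-p∣ : ∀ p q → ℚ.∣ p ℚ.- q ∣ ≡ ℚ.∣ q ℚ.- p ∣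
  ∣p-q∣≡∣q-p∣ p q = trans (sym (ℚ.∣-p∣≡∣p∣ (p ℚ.- q))) (cong ℚ.∣_∣ (neg-sub p q))

  ∣∣p∣-∣q∣∣≤∣p-q∣ : ∀ p q → ℚ.∣ ℚ.∣ p ∣ ℚ.- ℚ.∣ q ∣ ∣ ℚ.≤ ℚ.∣ p ℚ.- q ∣
  ∣∣p∣-∣q∣∣≤∣p-q∣ p q with ℚ.∣p∣≡p∨∣p∣≡-p (ℚ.∣ p ∣ ℚ.- ℚ.∣ q ∣)
  ... | inj₁ eq = subst (ℚ._≤ ℚ.∣ p ℚ.- q ∣) (sym eq) (∣p∣-∣q∣≤∣p-q∣ p q)
  ... | inj₂ eq = subst₂ ℚ._≤_
    (sym (trans eq (neg-sub ℚ.∣ p ∣ ℚ.∣ q ∣))) (∣p-q∣≡∣q-p∣ q p) (∣p∣-∣q∣≤∣p-q∣ q p)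

fromℚ : ℚ → ℝ
fromℚ q = mkℝ (λ _ → q) λ ε 0<ε → 0 , λ _ _ _ _ →
  subst (ℚ._< ε) (sym (cong ℚ.∣_∣ (ℚ.+-inverseʳ q))) 0<ε

0ᴿ 1ᴿ : ℝ
0ᴿ = fromℚ 0ℚ
1ᴿ = fromℚ 1ℚ

infixl 6 _-ᴿ_

_-ᴿ_ : ℝ → ℝ → ℝ
x -ᴿ y = mkℝ (λ n → approx x n ℚ.- approx y n) isCauchy
  where
  isCauchy : IsCauchy (λ n → approx x n ℚ.- approx y n)
  isCauchy ε 0<ε with cauchy x (½ ℚ.* ε) (half-pos 0<ε) | cauchy y (½ ℚ.* ε) (half-pos 0<ε)
  ... | M , p | N , q = M ⊔ N , λ m n m≥ n≥ →
    let xm = approx x m ; xn = approx x n ; ym = approx y m ; yn = approx y n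
        open ℚ.≤-Reasoning
    in begin-strict
      ℚ.∣ (xm ℚ.- ym) ℚ.- (xn ℚ.- yn) ∣       ≡⟨ cong ℚ.∣_∣ (swap-sub xm ym xn yn) ⟩
      ℚ.∣ (xm ℚ.- xn) ℚ.- (ym ℚ.- yn) ∣       ≤⟨ ℚ.∣p-q∣≤∣p∣+∣q∣ (xm ℚ.- xn) (ym ℚ.- yn) ⟩
      ℚ.∣ xm ℚ.- xn ∣ ℚ.+ ℚ.∣ ym ℚ.- yn ∣     <⟨ ℚ.+-mono-<
        (p m n (m⊔n≤o⇒m≤o M N m≥) (m⊔n≤o⇒m≤o M N n≥))
        (q m n (m⊔n≤o⇒n≤o M N m≥) (m⊔n≤o⇒n≤o M N n≥)) ⟩
      ½ ℚ.* ε ℚ.+ ½ ℚ.* ε                     ≡⟨ double-½ ε ⟩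
      ε                                       ∎

∣_∣ᴿ : ℝ → ℝ
∣ x ∣ᴿ = mkℝ (λ n → ℚ.∣ approx x n ∣) isCauchy
  where
  isCauchy : IsCauchy (λ n → ℚ.∣ approx x n ∣)
  isCauchy ε 0<ε with cauchy x ε 0<ε
  ... | N , p = N , λ m n m≥ n≥ →
    ℚ.≤-<-trans (∣∣p∣-∣q∣∣≤∣p-q∣ (approx x m) (approx x n)) (p m n m≥ n≥)

-- u n / v n → L as n → ∞.  The quotient need only be defined (v n ≠ 0) for all
-- sufficiently large n, which is part of what is asserted.
RatioTendsTo : (u v : ℕ → ℕ) → ℝ → Set
RatioTendsTo u v L =
  ∀ (ε : ℝ) → 0ᴿ <ᴿ ε → ∃[ N ] (∀ n → n ≥ N →
    Σ (NonZero (v n)) λ v≢0 →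
      ∣ fromℚ (ℚ._/_ (ℤ.+ u n) (v n) {{v≢0}}) -ᴿ L ∣ᴿ <ᴿ ε)

------------------------------------------------------------------------
-- Correctness of the enumeration of partitions

private
  linked-∷ : ∀ {k λs} → All (_≤ k) λs → Linked _≥_ λs → Linked _≥_ (k ∷ λs)
  linked-∷ []       []  = [-]
  linked-∷ (p ∷ _)  l   = p ∷ l

  linked-tail : ∀ {k λs} → Linked _≥_ (k ∷ λs) → Linked _≥_ λs
  linked-tail [-]     = []
  linked-tail (_ ∷ l) = l

  linked-bound : ∀ {k λs} → Linked _≥_ (k ∷ λs) → All (_≤ k) λs
  linked-bound [-]     = []
  linked-bound (p ∷ l) = p ∷ All.map (λ q → ≤-trans q p) (linked-bound l)

  sound : ∀ f m n {λs} → λs ∈ partitionsUpTo f m n →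
          IsPartition n λs × All (_≤ m) λs
  sound zero    m zero    (here refl) = isPartition [] [] refl , []
  sound (suc f) m zero    (here refl) = isPartition [] [] refl , []
  sound (suc f) m (suc n) λs∈
    with i , i∈ , λs∈′ ← find (∈-concatMap⁻ _ {xs = upTo (m ⊓ suc n)} λs∈)
    with μs , μs∈ , refl ← ∈-map⁻ (suc i ∷_) λs∈′
    with isPartition dec pos tot , bd ← sound f (suc i) (n ∸ i) μs∈
    = isPartition (linked-∷ bd dec) (z<s ∷ pos)
        (cong suc (trans (cong (i +_) tot) (m+[n∸m]≡n (s≤s⁻¹ (m≤n⊓o⇒m≤o m (suc n) i<)))))
    , i<m ∷ All.map (λ p → ≤-trans p i<m) bd
    where
    i<  = ∈-upTo⁻ i∈
    i<m = m≤n⊓o⇒m≤n m (suc n) i<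

  complete : ∀ f m n {λs} → n ≤ f → IsPartition n λs → All (_≤ m) λs →
             λs ∈ partitionsUpTo f m n
  complete f       m zero {[]}    _ _ _ = here-[] f
    where
    here-[] : ∀ f → [] ∈ partitionsUpTo f m zero
    here-[] zero    = here refl
    here-[] (suc _) = here refl
  complete f       m zero {zero ∷ _} _ (isPartition _ (() ∷ _) _) _
  complete f       m zero {suc _ ∷ _} _ (isPartition _ _ ()) _
  complete (suc f) m (suc n) {[]} _ (isPartition _ _ ()) _
  complete (suc f) m (suc n) {zero ∷ _} _ (isPartition _ (() ∷ _) _) _
  complete (suc f) m (suc n) {suc i ∷ μs} (s≤s n≤f) (isPartition dec (_ ∷ pos) tot) (i<m ∷ _) =
    ∈-concatMap⁺ _ (lose (∈-upTo⁺ (⊓-glb i<m i<n)) (∈-map⁺ (suc i ∷_)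
      (complete f (suc i) (n ∸ i) (≤-trans (m∸n≤m n i) n≤f)
        (isPartition (linked-tail dec) pos rest) (linked-bound dec))))
    where
    i+Σ≡n : i + sum μs ≡ n
    i+Σ≡n = suc-injective tot
    i<n : i < suc n
    i<n = s≤s (subst (i ≤_) i+Σ≡n (m≤m+n i (sum μs)))
    rest : sum μs ≡ n ∸ i
    rest = trans (sym (m+n∸m≡n i (sum μs))) (cong (_∸ i) i+Σ≡n)

  unique : ∀ f m n → Unique (partitionsUpTo f m n)
  unique zero    m zero    = [] ∷ []
  unique (suc f) m zero    = [] ∷ []
  unique zero    m (suc n) = []
  unique (suc f) m (suc n) = Unique.concat⁺
    (All.map⁺ (All.universal (λ i → Unique.map⁺ ∷-injectiveʳ (unique f (suc i) (n ∸ i))) _))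
    (AllPairs.map⁺ (AllPairs.map disjoint (Unique.upTo⁺ (m ⊓ suc n))))
    where
    disjoint : ∀ {i j} → i ≢ j →
      Disjoint (map (suc i ∷_) (partitionsUpTo f (suc i) (n ∸ i)))
               (map (suc j ∷_) (partitionsUpTo f (suc j) (n ∸ j)))
    disjoint {i} {j} i≢j (p , q)
      with _ , _ , e  ← ∈-map⁻ (suc i ∷_) p
      with _ , _ , e′ ← ∈-map⁻ (suc j ∷_) q
      = i≢j (suc-injective (proj₁ (∷-injective (trans (sym e) e′))))

  bounded : ∀ λs → All (_≤ sum λs) λs
  bounded []       = []
  bounded (k ∷ λs) =
    m≤m+n k _ ∷ All.map (λ p → ≤-trans p (m≤n+m _ k)) (bounded λs)

partitions-sound : ∀ n {λs} → λs ∈ partitions n → IsPartition n λs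
partitions-sound n = proj₁ ∘ sound n n n

partitions-complete : ∀ n {λs} → IsPartition n λs → λs ∈ partitions n
partitions-complete n {λs} p = complete n n n ≤-refl p
  (subst (λ t → All (_≤ t) λs) (IsPartition.total p) (bounded λs))

partitions-unique : ∀ n → Unique (partitions n)
partitions-unique n = unique n n n

{-# OPTIONS --safe #-}
module Submission where

-- Write q(n) for the number of partitions of n into odd parts, equivalently (Euler) into distinct
-- parts, and S(n) = q(0) + … + q(n).  As q is monotone and q = o(S), the sum over r of q(n − kr − s)
-- is asymptotic to S(n)/k for fixed k ≥ 1 and s.  In a partition, the boxes of hook length h in the
-- row of a part p depend only on the parts in a window of bounded length below p, so the number of
-- such boxes over all partitions is a finite sum over the possible windows; splitting off the parts
-- of the window one at a time shows that each summand, divided by S, is a Cauchy sequence.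
--
-- In the limit a window with A distinct parts excluded and k parts copied contributes the integral
-- over [0, 1] of x^(k−1) / (1 + x)^A, respectively of x^(k−1) (1 − x)^A / 2 for odd parts.  The sums
-- E_h over the windows of hook length h satisfy E_{h+1} + x/(1+x) E_h = 1/(1+x), respectively
-- E_{h+1} + (1 − x) E_h = 1.  For h ≥ 2 they give limits b_h/S ≤ 39/60 < 2/3 ≤ lim a_h/S.

open import Defs
open import Data.Empty using (⊥; ⊥-elim)
open import Data.Fin as Fin using (toℕ)
import Data.Integer as ℤ
import Data.Integer.Properties as ℤ
open import Data.List
  using (List; []; _∷_; [_]; map; _++_; concatMap; filter; length; lookup; upTo; allFin; tabulate)
open import Data.List.Membership.Propositional using (_∈_; find)
open import Data.List.Membership.Propositional.Properties using (∈-map⁻; ∈-concatMap⁻; ∈-upTo⁻)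
open import Data.List.Properties
  using (filter-++; filter-accept; filter-reject; length-++; map-++; map-∘; map-cong; map-concatMap;
         concatMap-map; concatMap-++; concatMap-cong; map-upTo; map-tabulate; upTo-∷ʳ; ++-identityʳ)
open import Data.List.Relation.Binary.Prefix.Heterogeneous using (Prefix; []; _∷_)
open import Data.List.Relation.Binary.Prefix.Heterogeneous.Properties using (prefix?)
open import Data.List.Relation.Unary.All as All using (All; []; _∷_)
import Data.List.Relation.Unary.All.Properties as All
open import Data.List.Relation.Unary.AllPairs using ([]; _∷_)
open import Data.List.Relation.Unary.Any using (here)
open import Data.List.Relation.Unary.Unique.DecPropositional using (unique?)
open import Data.Nat
open import Data.Nat.Divisibility using (_∣_; ∣m+n∣m⇒∣n; ∣1⇒≡1; m∣m*n)
open import Data.Nat.ListAction using (sum)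
open import Data.Nat.ListAction.Properties using (sum-++)
open import Data.Nat.Properties
open import Data.Nat.Tactic.RingSolver using (solve-∀)
open import Data.Product using (∃-syntax; _×_; _,_; proj₁; proj₂)
open import Data.Rational as ℚ using (ℚ; 0ℚ; 1ℚ; mkℚ)
import Data.Rational.Properties as ℚ
open import Data.Rational.Solver using (module +-*-Solver)
import Data.Rational.Unnormalised as ℚᵘ
import Data.Rational.Unnormalised.Properties as ℚᵘ
open import Data.Sum using (inj₁; inj₂)
open import Data.Unit using (tt)
open import Function using (_∘_; id)
open import Relation.Binary.PropositionalEquality hiding ([_])
open import Relation.Nullary using (¬_; yes; no)
open import Relation.Nullary.Decidable using (True; toWitness)
open import Relation.Unary using (Decidable)

-- Sequences as power series

-- The integrals serve only as a guide, since log 2 occurs among them. Limits are compared through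
-- `_⪯_`, which bounds one quotient by S at a large argument by another at an independent large
-- argument, and the limit of a_h/b_h is represented by the sequence of quotients itself. The two
-- cases differ in one point. For odd parts, a window with A + 1 missing parts is a difference of
-- two windows with A missing parts, so induction on A suffices. For distinct parts the subtracted
-- window again misses A + 1 parts and has one more copy; the resulting alternating expansion does
-- not end, and it converges because a window with k copies is O(S/k). That q = o(S) needs no
-- asymptotic formula: for fixed K the partitions with fewer than K parts are negligible, and the
-- numbers of parts of all partitions of n into distinct parts add up to at most S(n). The margin is
-- small. The bound 1/(1 + x) for E_h would give only log 2 = 0.693..., above 2/3; one more use of
-- the recurrence subtracts x/(1 + x)^3, whose integral is 1/8.

Seq : Set
Seq = ℕ → ℕ

infixl 6 _⊕_

_⊕_ : Seq → Seq → Seq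
(u ⊕ v) n = u n + v n

𝟎 δ : Seq
𝟎 _ = 0
δ zero    = 1
δ (suc _) = 0

∑ : ℕ → Seq → ℕ
∑ zero    φ = 0
∑ (suc n) φ = ∑ n φ + φ n

-- shift x u is the sequence u multiplied by q^x: (shift x u) n is u (n − x), and 0 if n < x.
shift : ℕ → Seq → Seq
shift zero    u n       = u n
shift (suc x) u zero    = 0
shift (suc x) u (suc n) = shift x u n

+-exchange : ∀ a b c d → (a + b) + (c + d) ≡ (a + c) + (b + d)
+-exchange = solve-∀

∑-cong : ∀ n {φ ψ} → (∀ i → i < n → φ i ≡ ψ i) → ∑ n φ ≡ ∑ n ψ
∑-cong zero    h = refl
∑-cong (suc n) h = cong₂ _+_ (∑-cong n (λ i p → h i (m<n⇒m<1+n p))) (h n ≤-refl)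

∑-zero : ∀ n {φ} → (∀ i → i < n → φ i ≡ 0) → ∑ n φ ≡ 0
∑-zero zero    h = refl
∑-zero (suc n) h = cong₂ _+_ (∑-zero n (λ i p → h i (m<n⇒m<1+n p))) (h n ≤-refl)

∑-⊕ : ∀ n φ ψ → ∑ n (φ ⊕ ψ) ≡ ∑ n φ + ∑ n ψ
∑-⊕ zero    φ ψ = refl
∑-⊕ (suc n) φ ψ = trans (cong (_+ (φ n + ψ n)) (∑-⊕ n φ ψ)) (+-exchange (∑ n φ) (∑ n ψ) (φ n) (ψ n))

∑-head : ∀ n φ → ∑ (suc n) φ ≡ φ 0 + ∑ n (φ ∘ suc)
∑-head zero    φ = +-comm 0 (φ 0)
∑-head (suc n) φ = trans (cong (_+ φ (suc n)) (∑-head n φ)) (+-assoc (φ 0) _ _)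

module _ (R : ℕ → ℕ → Set) (R₀ : R 0 0) where
  -- One induction serves for both `_≡_` and `_≤_`; `R₀` covers the zeros that `shift` pads with.
  -- Restricting the hypothesis to arguments that are reached is what makes it usable inside strong
  -- inductions on `n`.
  shift-rel : ∀ x {u v} n → (∀ m → m + x ≤ n → R (u m) (v m)) → R (shift x u n) (shift x v n)
  shift-rel zero    n       h = h n (≤-reflexive (+-identityʳ n))
  shift-rel (suc x) zero    h = R₀
  shift-rel (suc x) (suc n) h =
    shift-rel x n (λ m p → h m (subst (_≤ suc n) (sym (+-suc m x)) (s≤s p)))

shift-local : ∀ x {u v} n → (∀ m → m + x ≤ n → u m ≡ v m) → shift x u n ≡ shift x v n
shift-local = shift-rel _≡_ refl

shift-cong : ∀ x {u v} → u ≗ v → shift x u ≗ shift x v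
shift-cong x h n = shift-local x n (λ m _ → h m)

shift-mono : ∀ x {u v} → (∀ n → u n ≤ v n) → ∀ n → shift x u n ≤ shift x v n
shift-mono x h n = shift-rel _≤_ z≤n x n (λ m _ → h m)

shift-vanish : ∀ {x} u {n} → n < x → shift x u n ≡ 0
shift-vanish {suc x} u {zero}  p       = refl
shift-vanish {suc x} u {suc n} (s≤s p) = shift-vanish u p

shift-shift : ∀ x y u n → shift x (shift y u) n ≡ shift (x + y) u n
shift-shift zero    y u n       = refl
shift-shift (suc x) y u zero    = refl
shift-shift (suc x) y u (suc n) = shift-shift x y u n

shift-⊕ : ∀ x u v n → shift x (u ⊕ v) n ≡ shift x u n + shift x v n
shift-⊕ zero    u v n       = refl
shift-⊕ (suc x) u v zero    = refl
shift-⊕ (suc x) u v (suc n) = shift-⊕ x u v n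

shift-𝟎 : ∀ x n → shift x 𝟎 n ≡ 0
shift-𝟎 zero    n       = refl
shift-𝟎 (suc x) zero    = refl
shift-𝟎 (suc x) (suc n) = shift-𝟎 x n

shift-* : ∀ x k u n → shift x (λ m → k * u m) n ≡ k * shift x u n
shift-* zero    k u n       = refl
shift-* (suc x) k u zero    = sym (*-zeroʳ k)
shift-* (suc x) k u (suc n) = shift-* x k u n

shift-swap : ∀ x y u n → shift x (shift y u) n ≡ shift y (shift x u) n
shift-swap x y u n = trans (shift-shift x y u n)
  (trans (cong (λ z → shift z u n) (+-comm x y)) (sym (shift-shift y x u n)))

Monotone : Seq → Set
Monotone u = ∀ n → u n ≤ u (suc n)

shift-monotone : ∀ x {u} → Monotone u → Monotone (shift x u)
shift-monotone zero    h n       = h n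
shift-monotone (suc x) h zero    = z≤n
shift-monotone (suc x) h (suc n) = shift-monotone x h n

shift-suc-≤ : ∀ x {u} → Monotone u → ∀ n → shift (suc x) u n ≤ shift x u n
shift-suc-≤ x       h zero    = z≤n
shift-suc-≤ zero    h (suc n) = h n
shift-suc-≤ (suc x) h (suc n) = shift-suc-≤ x h n

shift-≤ : ∀ x {u} → Monotone u → ∀ n → shift x u n ≤ u n
shift-≤ zero    h n = ≤-refl
shift-≤ (suc x) h n = ≤-trans (shift-suc-≤ x h n) (shift-≤ x h n)

bounded-induction : (P : ℕ → Set) → (∀ n → (∀ m → m < n → P m) → P n) → ∀ N n → n < N → P n
bounded-induction P step (suc N) n (s≤s p) =
  step n (λ m q → bounded-induction P step N m (<-≤-trans q p))

strong-induction : (P : ℕ → Set) → (∀ n → (∀ m → m < n → P m) → P n) → ∀ n → P n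
strong-induction P step n = bounded-induction P step (suc n) n ≤-refl

m+1+w≤n⇒m<n : ∀ {m w n} → m + suc w ≤ n → m < n
m+1+w≤n⇒m<n {m} {w} p = ≤-trans (s≤s (m≤m+n m w)) (≤-trans (≤-reflexive (sym (+-suc m w))) p)

-- mul w and geo w are multiplication by 1 + q^(w+1) and by 1 / (1 − q^(w+1)).
mul : ℕ → Seq → Seq
mul w u n = u n + shift (suc w) u n

geoFuel : ℕ → ℕ → Seq → Seq
geoFuel zero    w u n = u n
geoFuel (suc f) w u n = u n + shift (suc w) (geoFuel f w u) n

geo : ℕ → Seq → Seq
geo w u n = geoFuel n w u n

-- Each layer lowers the argument by at least one, so fuel `n` already reaches every nonzero term at
-- `n`.
geoFuel-irrelevant : ∀ f g w u n → n ≤ f → n ≤ g → geoFuel f w u n ≡ geoFuel g w u n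
geoFuel-irrelevant zero    zero    w u n    p q = refl
geoFuel-irrelevant zero    (suc g) w u zero p q = sym (+-identityʳ (u 0))
geoFuel-irrelevant (suc f) zero    w u zero p q = +-identityʳ (u 0)
geoFuel-irrelevant (suc f) (suc g) w u n    p q = cong (u n +_)
  (shift-local (suc w) n (λ m r → geoFuel-irrelevant f g w u m
    (s≤s⁻¹ (≤-trans (m+1+w≤n⇒m<n r) p)) (s≤s⁻¹ (≤-trans (m+1+w≤n⇒m<n r) q))))

geo-fix : ∀ w u n → geo w u n ≡ u n + shift (suc w) (geo w u) n
geo-fix w u zero    = sym (+-identityʳ (u 0))
geo-fix w u (suc n) = cong (u (suc n) +_)
  (shift-local w n (λ m p → geoFuel-irrelevant n m w u m (≤-trans (m≤m+n m w) p) ≤-refl))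

-- The equation (1 - q^(w+1)) v = u determines v degree by degree. The algebra of `geo` below rests
-- on this: both sides of an identity solve the same equation.
geo-unique : ∀ w u v → (∀ n → v n ≡ u n + shift (suc w) v n) → v ≗ geo w u
geo-unique w u v h = strong-induction _ λ n ih →
  trans (h n) (trans (cong (u n +_) (shift-local (suc w) n (λ m p → ih m (m+1+w≤n⇒m<n p))))
    (sym (geo-fix w u n)))

geo-local : ∀ w {u v} n → (∀ m → m ≤ n → u m ≡ v m) → geo w u n ≡ geo w v n
geo-local w {u} {v} = strong-induction _ λ n ih h →
  trans (geo-fix w u n) (trans
    (cong₂ _+_ (h n ≤-refl) (shift-local (suc w) n (λ m p → let q = m+1+w≤n⇒m<n p in
       ih m q (λ i r → h i (≤-trans r (<⇒≤ q))))))
    (sym (geo-fix w v n)))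

geo-cong : ∀ w {u v} → u ≗ v → geo w u ≗ geo w v
geo-cong w h n = geo-local w n (λ m _ → h m)

-- The factor has constant term 1, so it can be cancelled from series known only up to degree `N`.
-- Euler's theorem for finite products needs this truncated form.
geo-injective : ∀ w {u v} N → (∀ n → n ≤ N → geo w u n ≡ geo w v n) → ∀ n → n ≤ N → u n ≡ v n
geo-injective w {u} {v} N h n p = +-cancelʳ-≡ (shift (suc w) (geo w u) n) (u n) (v n)
  (trans (sym (geo-fix w u n)) (trans (h n p) (trans (geo-fix w v n) (cong (v n +_)
    (shift-local (suc w) n (λ m q → sym (h m (≤-trans (<⇒≤ (m+1+w≤n⇒m<n q)) p))))))))

geo-shift : ∀ w x u → geo w (shift x u) ≗ shift x (geo w u)
geo-shift w x u n = sym (geo-unique w (shift x u) (shift x (geo w u)) (λ n →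
  trans (shift-cong x (geo-fix w u) n) (trans (shift-⊕ x u (shift (suc w) (geo w u)) n)
    (cong (shift x u n +_) (shift-swap x (suc w) (geo w u) n)))) n)

geo-⊕ : ∀ w u v n → geo w (u ⊕ v) n ≡ geo w u n + geo w v n
geo-⊕ w u v n = sym (geo-unique w (u ⊕ v) (geo w u ⊕ geo w v) (λ n →
  trans (cong₂ _+_ (geo-fix w u n) (geo-fix w v n))
    (trans (+-exchange (u n) (shift (suc w) (geo w u) n) (v n) (shift (suc w) (geo w v) n))
      (cong (u n + v n +_) (sym (shift-⊕ (suc w) (geo w u) (geo w v) n))))) n)

geo-𝟎 : ∀ w n → geo w 𝟎 n ≡ 0
geo-𝟎 w n = sym (geo-unique w 𝟎 𝟎 (λ n → sym (shift-𝟎 (suc w) n)) n)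

geo-comm : ∀ w x u → geo w (geo x u) ≗ geo x (geo w u)
geo-comm w x u n = sym (geo-unique w (geo x u) (geo x (geo w u)) (λ n →
  trans (geo-cong x (geo-fix w u) n) (trans (geo-⊕ x u (shift (suc w) (geo w u)) n)
    (cong (geo x u n +_) (geo-shift x (suc w) (geo w u) n)))) n)

geo-monotone : ∀ w {u} → Monotone u → Monotone (geo w u)
geo-monotone w {u} h = strong-induction _ λ n ih →
  subst₂ _≤_ (sym (geo-fix w u n)) (sym (geo-fix w u (suc n))) (+-mono-≤ (h n) (step n ih))
  where
  -- The right side is `shift (suc w) (geo w u) (suc n)` by definition, so this compares the
  -- recursive terms at `n` and at `suc n`.
  step : ∀ n → (∀ m → m < n → geo w u m ≤ geo w u (suc m)) →
         shift (suc w) (geo w u) n ≤ shift w (geo w u) n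
  step n ih = go w n (λ m p → ih m (m+1+w≤n⇒m<n p))
    where
    go : ∀ x n → (∀ m → m + suc x ≤ n → geo w u m ≤ geo w u (suc m)) →
         shift (suc x) (geo w u) n ≤ shift x (geo w u) n
    go x       zero    k = z≤n
    go zero    (suc n) k = k n (≤-reflexive (+-comm n 1))
    go (suc x) (suc n) k = go x n (λ m p → k m (subst (_≤ suc n) (sym (+-suc m (suc x))) (s≤s p)))

mul-local : ∀ w {u v} n → (∀ m → m ≤ n → u m ≡ v m) → mul w u n ≡ mul w v n
mul-local w n h = cong₂ _+_ (h n ≤-refl)
  (shift-local (suc w) n (λ m p → h m (<⇒≤ (m+1+w≤n⇒m<n p))))

mul-⊕ : ∀ w u v n → mul w (u ⊕ v) n ≡ mul w u n + mul w v n
mul-⊕ w u v n = trans (cong (u n + v n +_) (shift-⊕ (suc w) u v n))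
  (+-exchange (u n) (v n) (shift (suc w) u n) (shift (suc w) v n))

mul-shift : ∀ w x u → mul w (shift x u) ≗ shift x (mul w u)
mul-shift w x u n = sym (trans (shift-⊕ x u (shift (suc w) u) n)
  (cong (shift x u n +_) (shift-swap x (suc w) u n)))

geo-mul : ∀ w x u → geo w (mul x u) ≗ mul x (geo w u)
geo-mul w x u n = trans (geo-⊕ w u (shift (suc x) u) n) (cong (geo w u n +_) (geo-shift w (suc x) u n))

-- (1 + q^w) / (1 − q^(2w)) = 1 / (1 − q^w)
mul-geo-double : ∀ w u → mul w (geo (w + suc w) u) ≗ geo w u
mul-geo-double w u = geo-unique w u _ λ n → let g = geo (w + suc w) u in
  trans (cong (_+ shift (suc w) g n) (geo-fix (w + suc w) u n))
    (trans (trans (+-assoc (u n) _ _) (cong (u n +_) (+-comm _ (shift (suc w) g n))))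
      (cong (u n +_) (trans (cong (shift (suc w) g n +_) (sym (shift-shift (suc w) (suc w) g n)))
        (sym (shift-⊕ (suc w) g (shift (suc w) g) n)))))

-- Partitions with a window of omitted parts

∑-shift : ∀ c N φ → ∑ N (shift c φ) ≡ ∑ (N ∸ c) φ
∑-shift zero    N       φ = refl
∑-shift (suc c) zero    φ = refl
∑-shift (suc c) (suc N) φ = trans (∑-head N (shift (suc c) φ)) (∑-shift c N φ)

shift-at : ∀ x {φ ψ : Seq} m → (∀ l → l + x ≡ m → φ l ≡ ψ l) → shift x φ m ≡ shift x ψ m
shift-at zero    m       h = h m (+-identityʳ m)
shift-at (suc x) zero    h = refl
shift-at (suc x) (suc m) h = shift-at x m (λ l e → h l (trans (+-suc l x) (cong suc e)))

shift-∑ : ∀ x R (φ : ℕ → Seq) n → shift x (λ m → ∑ R (λ l → φ l m)) n ≡ ∑ R (λ l → shift x (φ l) n)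
shift-∑ x zero    φ n = shift-𝟎 x n
shift-∑ x (suc R) φ n = trans (shift-⊕ x _ (φ R) n) (cong (_+ shift x (φ R) n) (shift-∑ x R φ n))

geo-∑ : ∀ w u R n → n < R → geo w u n ≡ ∑ R (λ l → shift (suc w * l) u n)
geo-∑ w u (suc R) n p = trans (geo-fix w u n) (sym (trans (∑-head R _)
  (cong₂ _+_ (cong (λ z → shift z u n) (*-zeroʳ (suc w)))
    (trans (∑-cong R (λ l _ → trans (cong (λ z → shift z u n) (*-suc (suc w) l))
                                    (sym (shift-shift (suc w) (suc w * l) u n))))
    (trans (sym (shift-∑ (suc w) R (λ l → shift (suc w * l) u) n))
      (shift-local (suc w) n (λ m q → sym (geo-∑ w u R m (<-≤-trans (m+1+w≤n⇒m<n q) (s≤s⁻¹ p))))))))))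

-- Fixing an index l ≥ floor and leaving out the parts with the indices l, …, l + missing − 1,
-- a symbol stands for the partitions with the other parts, of n minus
-- d · copies · (l − floor) + offset; it is summed over all l ≥ floor.
record Symbol : Set where
  constructor symbol
  field missing copies offset floor : ℕ

-- In Valid symbols the summands with l too large for n vanish.
record Valid (σ : Symbol) : Set where
  constructor valid
  open Symbol σ
  field
    copies-positive : 1 ≤ copies
    offset-large    : missing + floor ≤ offset

widen : Symbol → Symbol
widen (symbol A k s c) = symbol (suc A) k s c

-- Both kinds of partitions at once: the part with index i is d·i + 1, and `op i` multiplies by its
-- factor, 1 + q^(i+1) for d = 1 and 1/(1 - q^(2i+1)) for d = 2. The last law says that a part
-- larger than n does not affect degree n.
module Windows (d-1 : ℕ) (op : ℕ → Seq → Seq)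
  (op-local : ∀ i {u v} n → (∀ m → m ≤ n → u m ≡ v m) → op i u n ≡ op i v n)
  (op-⊕ : ∀ i u v n → op i (u ⊕ v) n ≡ op i u n + op i v n)
  (op-𝟎 : ∀ i n → op i 𝟎 n ≡ 0)
  (op-shift : ∀ i x u n → op i (shift x u) n ≡ shift x (op i u) n)
  (op-below : ∀ i u n → n ≤ suc d-1 * i → op i u n ≡ u n)
  where

  d : ℕ
  d = suc d-1

  part : ℕ → ℕ
  part i = suc (d * i)

  -- The part just above the window has index l + missing, hence size d·(l - floor) +
  -- `part (missing + floor)`. The first summand is recorded as a copy, the second in the offset.
  insert : Symbol → Symbol
  insert (symbol A k s c) = symbol A (suc k) (s + part (A + c)) c

  op-cong : ∀ i {u v} → u ≗ v → op i u ≗ op i v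
  op-cong i h n = op-local i n (λ m _ → h m)

  up : ℕ → ℕ → Seq → Seq
  up c zero    u = u
  up c (suc j) u = up (suc c) j (op c u)

  prefix : ℕ → Seq
  prefix zero    = δ
  prefix (suc i) = op i (prefix i)

  total : Seq
  total n = prefix n n

  -- Here m is the first index above the window, so l - floor is m - (missing + floor), and the
  -- outer `shift` makes the term 0 when this is negative. Only the parts below the window are
  -- present yet.
  leaf : Symbol → ℕ → Seq
  leaf (symbol A k s c) m n = shift (A + c) (λ l → shift (d * k * l + s) (prefix (l + c)) n) m

  -- `up` supplies the parts with indices m, ..., n; later ones exceed n. The range m ≤ n + 1 is
  -- chosen so that widening, which turns m into m + 1, leaves exactly the terms m ≤ n.
  T : Symbol → Seq
  T σ n = ∑ (suc (suc n)) (λ m → up m (suc n ∸ m) (leaf σ m) n)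

  up-cong : ∀ c j {u v} → u ≗ v → up c j u ≗ up c j v
  up-cong c zero    h = h
  up-cong c (suc j) h = up-cong (suc c) j (op-cong c h)

  up-⊕ : ∀ c j u v n → up c j (u ⊕ v) n ≡ up c j u n + up c j v n
  up-⊕ c zero    u v n = refl
  up-⊕ c (suc j) u v n = trans (up-cong (suc c) j (op-⊕ c u v) n) (up-⊕ (suc c) j (op c u) (op c v) n)

  up-𝟎 : ∀ c j n → up c j 𝟎 n ≡ 0
  up-𝟎 c zero    n = refl
  up-𝟎 c (suc j) n = trans (up-cong (suc c) j (op-𝟎 c) n) (up-𝟎 (suc c) j n)

  up-shift : ∀ c j x u n → up c j (shift x u) n ≡ shift x (up c j u) n
  up-shift c zero    x u n = refl
  up-shift c (suc j) x u n =
    trans (up-cong (suc c) j (op-shift c x u) n) (up-shift (suc c) j x (op c u) n)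

  up-prefix : ∀ c j n → up c j (prefix c) n ≡ prefix (c + j) n
  up-prefix c zero    n = cong (λ z → prefix z n) (sym (+-identityʳ c))
  up-prefix c (suc j) n = trans (up-prefix (suc c) j n) (cong (λ z → prefix z n) (sym (+-suc c j)))

  up-top : ∀ c j u n → up c (suc j) u n ≡ op (c + j) (up c j u) n
  up-top c zero    u n = cong (λ z → op z u n) (sym (+-identityʳ c))
  up-top c (suc j) u n =
    trans (up-top (suc c) j (op c u) n) (cong (λ z → op z (up (suc c) j (op c u)) n) (sym (+-suc c j)))

  op-shift-index : ∀ i x (φ : ℕ → Seq) m n →
    op i (λ n → shift x (λ l → φ l n) m) n ≡ shift x (λ l → op i (φ l) n) m
  op-shift-index i zero    φ m       n = refl
  op-shift-index i (suc x) φ zero    n = op-𝟎 i n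
  op-shift-index i (suc x) φ (suc m) n = op-shift-index i x φ m n

  up-shift-index : ∀ c j x (φ : ℕ → Seq) m n →
    up c j (λ n → shift x (λ l → φ l n) m) n ≡ shift x (λ l → up c j (φ l) n) m
  up-shift-index c j zero    φ m       n = refl
  up-shift-index c j (suc x) φ zero    n = up-𝟎 c j n
  up-shift-index c j (suc x) φ (suc m) n = up-shift-index c j x φ m n

  shift-shift-index : ∀ y x (φ : ℕ → Seq) m n →
    shift y (λ n → shift x (λ l → φ l n) m) n ≡ shift x (λ l → shift y (φ l) n) m
  shift-shift-index y zero    φ m       n = refl
  shift-shift-index y (suc x) φ zero    n = shift-𝟎 y n
  shift-shift-index y (suc x) φ (suc m) n = shift-shift-index y x φ m n

  leaf-insert : ∀ σ m n → shift (part m) (leaf σ m) n ≡ leaf (insert σ) m n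
  leaf-insert (symbol A k s c) m n =
    trans (shift-shift-index (part m) (A + c) (λ l → shift (d * k * l + s) (prefix (l + c))) m n)
      (shift-at (A + c) m λ l e →
        trans (shift-shift (part m) (d * k * l + s) (prefix (l + c)) n)
          (cong (λ z → shift z (prefix (l + c)) n)
            (trans (cong (λ z → part z + (d * k * l + s)) (sym e)) (offsets d l (A + c) k s))))
    where
    offsets : ∀ d l a k s →
      suc (d * (l + a)) + (d * k * l + s) ≡ d * suc k * l + (s + suc (d * a))
    offsets = solve-∀

  leaf-vanish : ∀ σ → Valid σ → ∀ m n → n < m → leaf σ m n ≡ 0
  leaf-vanish (symbol A (suc k) s c) (valid _ v) m n n<m =
    trans (shift-at (A + c) {ψ = 𝟎} m λ l e → shift-vanish (prefix (l + c)) (<-≤-trans n<m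
      (≤-trans (≤-reflexive (sym e)) (+-mono-≤ (m≤n*m l (d * suc k)) v))))
    (shift-𝟎 (A + c) m)

  T-widen : ∀ σ n → T (widen σ) n ≡ ∑ (suc n) (λ m → up (suc m) (n ∸ m) (leaf σ m) n)
  T-widen σ n = trans (∑-head (suc n) _) (cong₂ _+_ (up-𝟎 0 (suc n) n) refl)

  -- Isolates the factor of the part just above the window, on which the two splitting rules act.
  -- The extra term m = n + 1 vanishes by validity.
  T-op : ∀ σ → Valid σ → ∀ n → T σ n ≡ ∑ (suc n) (λ m → up (suc m) (n ∸ m) (op m (leaf σ m)) n)
  T-op σ v n = trans
    (cong₂ _+_
      (∑-cong (suc n) {λ m → up m (suc n ∸ m) (leaf σ m) n}
         (λ m p → cong (λ z → up m z (leaf σ m) n) (+-∸-assoc 1 (s≤s⁻¹ p))))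
      (trans (cong (λ z → up (suc n) z (leaf σ (suc n)) n) (n∸n≡0 n)) (leaf-vanish σ v (suc n) n ≤-refl)))
    (+-identityʳ _)

  op-∑ : ∀ i R (φ : ℕ → Seq) n → op i (λ n → ∑ R (λ l → φ l n)) n ≡ ∑ R (λ l → op i (φ l) n)
  op-∑ i zero    φ n = op-𝟎 i n
  op-∑ i (suc R) φ n = trans (op-⊕ i _ (φ R) n) (cong (_+ op i (φ R) n) (op-∑ i R φ n))

  -- Variation of constants: the source `Y m` enters at stage m and then meets only the operators
  -- with larger indices.
  unfold-recurrence : (X Y : ℕ → Seq) → X 0 ≗ 𝟎 → (∀ m → X (suc m) ≗ op m (X m) ⊕ Y m) →
    ∀ M n → X M n ≡ ∑ M (λ m → up (suc m) (M ∸ suc m) (Y m) n)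
  unfold-recurrence X Y X₀ X₊ zero    n = X₀ n
  unfold-recurrence X Y X₀ X₊ (suc M) n = trans (X₊ M n) (cong₂ _+_
    (trans (op-cong M (unfold-recurrence X Y X₀ X₊ M) n)
      (trans (op-∑ M M (λ m → up (suc m) (M ∸ suc m) (Y m)) n)
        (∑-cong M (λ m p → trans
          (cong (λ z → op z (up (suc m) (M ∸ suc m) (Y m)) n) (sym (m+[n∸m]≡n p)))
          (trans (sym (up-top (suc m) (M ∸ suc m) (Y m) n))
            (cong (λ z → up (suc m) z (Y m) n) (sym (+-∸-assoc 1 p))))))))
    (cong (λ z → up (suc M) z (Y M) n) (sym (n∸n≡0 M))))

  prefix-stable : ∀ {m j} → m ≤ j → prefix j m ≡ total m
  prefix-stable {m} p = go (≤⇒≤′ p)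
    where
    go : ∀ {j} → m ≤′ j → prefix j m ≡ total m
    go ≤′-refl = refl
    go (≤′-step {j} p) = trans (op-below j (prefix j) m (≤-trans (≤′⇒≤ p) (m≤n*m j d))) (go p)

  -- With nothing missing, the factors below and above the window join to the full product. What
  -- remains is the sum of `total` along the progression n - s - d(k+1)l.
  T₀ : ∀ k s c → c ≤ s → ∀ n → T (symbol 0 (suc k) s c) n ≡ shift s (geo (k + d-1 * suc k) total) n
  T₀ k s c c≤s n = begin
    T (symbol 0 (suc k) s c) n
      ≡⟨ ∑-cong (suc (suc n)) (λ m p → term m (s≤s⁻¹ p)) ⟩
    ∑ (suc (suc n)) (shift c (λ l → shift (d * suc k * l + s) total n))
      ≡⟨ ∑-shift c (suc (suc n)) _ ⟩
    ∑ R (λ l → shift (d * suc k * l + s) total n)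
      ≡⟨ ∑-cong R (λ l _ → trans (cong (λ z → shift z total n) (+-comm (d * suc k * l) s))
                                 (sym (shift-shift s (d * suc k * l) total n))) ⟩
    ∑ R (λ l → shift s (shift (d * suc k * l) total) n)
      ≡⟨ sym (shift-∑ s R (λ l → shift (d * suc k * l) total) n) ⟩
    shift s (λ m → ∑ R (λ l → shift (d * suc k * l) total m)) n
      ≡⟨ shift-local s n (λ m p → sym (geo-∑ (k + d-1 * suc k) total R m (m<R m p))) ⟩
    shift s (geo (k + d-1 * suc k) total) n ∎
    where
    open ≡-Reasoning
    R = suc (suc n) ∸ c
    m<R : ∀ m → m + s ≤ n → m < R
    m<R m p = subst (_≤ R) (m+n∸n≡m (suc m) c)
      (∸-monoˡ-≤ c (s≤s (≤-trans (+-monoʳ-≤ m c≤s) (m≤n⇒m≤1+n p))))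
    term : ∀ m → m ≤ suc n → up m (suc n ∸ m) (leaf (symbol 0 (suc k) s c) m) n ≡
                             shift c (λ l → shift (d * suc k * l + s) total n) m
    term m p = trans (up-shift-index m (suc n ∸ m) c (λ l → shift (d * suc k * l + s) (prefix (l + c))) m n)
      (shift-at c m λ l e → trans
        (up-shift m (suc n ∸ m) (d * suc k * l + s) (prefix (l + c)) n)
        (shift-local (d * suc k * l + s) n λ i q → trans
          (trans (cong (λ z → up m (suc n ∸ m) (prefix z) i) e) (up-prefix m (suc n ∸ m) i))
          (trans (cong (λ z → prefix z i) (m+[n∸m]≡n p))
            (prefix-stable (≤-trans (m≤m+n i _) (m≤n⇒m≤1+n q))))))

module Distinct = Windows 0 (λ i → mul (1 * i)) (λ i → mul-local (1 * i)) (λ i → mul-⊕ (1 * i))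
  (λ i → shift-𝟎 (suc (1 * i))) (λ i → mul-shift (1 * i))
  (λ i u n p → trans (cong (u n +_) (shift-vanish u (s≤s p))) (+-identityʳ (u n)))

module Odd = Windows 1 (λ i → geo (2 * i)) (λ i → geo-local (2 * i)) (λ i → geo-⊕ (2 * i))
  (λ i → geo-𝟎 (2 * i)) (λ i → geo-shift (2 * i))
  (λ i u n p → trans (geo-fix (2 * i) u n)
    (trans (cong (u n +_) (shift-vanish (geo (2 * i) u) (s≤s p))) (+-identityʳ (u n))))

-- The part just above the window is absent or occurs exactly once. In either case its index is
-- settled, so the window widens in both terms.
Distinct-split : ∀ σ → Valid σ → ∀ n →
  Distinct.T σ n ≡ Distinct.T (widen σ) n + Distinct.T (widen (Distinct.insert σ)) n
Distinct-split σ v n = begin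
  T σ n
    ≡⟨ T-op σ v n ⟩
  ∑ (suc n) (λ m → up (suc m) (n ∸ m) (mul (1 * m) (leaf σ m)) n)
    ≡⟨ ∑-cong (suc n) (λ m _ → trans
         (up-cong (suc m) (n ∸ m) (λ n → cong (leaf σ m n +_) (leaf-insert σ m n)) n)
         (up-⊕ (suc m) (n ∸ m) (leaf σ m) (leaf (insert σ) m) n)) ⟩
  ∑ (suc n) (λ m → up (suc m) (n ∸ m) (leaf σ m) n + up (suc m) (n ∸ m) (leaf (insert σ) m) n)
    ≡⟨ ∑-⊕ (suc n) _ _ ⟩
  _ ≡⟨ sym (cong₂ _+_ (T-widen σ n) (T-widen (insert σ) n)) ⟩
  T (widen σ) n + T (widen (insert σ)) n ∎
  where
  open ≡-Reasoning
  open Distinct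

Odd-valid : ∀ A k s c → Valid (Odd.insert (symbol A k s c))
Odd-valid A k s c = valid (s≤s z≤n) (≤-trans (m≤n*m (A + c) 2) (≤-trans (n≤1+n _) (m≤n+m _ s)))

Distinct-valid : ∀ A k s c → Valid (widen (Distinct.insert (symbol A k s c)))
Distinct-valid A k s c = valid (s≤s z≤n) (≤-trans (s≤s (m≤n*m (A + c) 1)) (m≤n+m _ s))

-- The part just above the window is absent, or one copy can be taken out. Further copies may
-- remain, so the second window does not widen.
Odd-split : ∀ σ → Valid σ → ∀ n →
  Odd.T σ n ≡ Odd.T (widen σ) n + Odd.T (Odd.insert σ) n
Odd-split σ v n = begin
  T σ n
    ≡⟨ T-op σ v n ⟩
  ∑ (suc n) (λ m → up (suc m) (n ∸ m) (geo (2 * m) (leaf σ m)) n)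
    ≡⟨ ∑-cong (suc n) (λ m _ → trans
         (up-cong (suc m) (n ∸ m) (λ n → trans (geo-fix (2 * m) (leaf σ m) n) (cong (leaf σ m n +_)
           (trans (sym (geo-shift (2 * m) (part m) (leaf σ m) n))
             (geo-cong (2 * m) (leaf-insert σ m) n)))) n)
         (up-⊕ (suc m) (n ∸ m) (leaf σ m) (geo (2 * m) (leaf (insert σ) m)) n)) ⟩
  ∑ (suc n) (λ m → up (suc m) (n ∸ m) (leaf σ m) n
                 + up (suc m) (n ∸ m) (geo (2 * m) (leaf (insert σ) m)) n)
    ≡⟨ ∑-⊕ (suc n) _ _ ⟩
  _ ≡⟨ sym (cong₂ _+_ (T-widen σ n)
         (T-op (insert σ) (Odd-valid (Symbol.missing σ) (Symbol.copies σ) (Symbol.offset σ) (Symbol.floor σ)) n)) ⟩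
  T (widen σ) n + T (insert σ) n ∎
  where
  open ≡-Reasoning
  open Odd

-- Euler's theorem and the growth of q

distinct : ℕ → Seq
distinct zero    = δ
distinct (suc M) = mul M (distinct M)

Distinct-prefix : ∀ M → Distinct.prefix M ≗ distinct M
Distinct-prefix zero    n = refl
Distinct-prefix (suc M) n = trans (cong (λ z → mul z (Distinct.prefix M) n) (*-identityˡ M))
  (mul-local M n (λ m _ → Distinct-prefix M m))

geo-evens : ℕ → Seq → Seq
geo-evens zero    u = u
geo-evens (suc i) u = geo (i + suc i) (geo-evens i u)

geo-evens-mul : ∀ M w u → geo-evens M (mul w u) ≗ mul w (geo-evens M u)
geo-evens-mul zero    w u n = refl
geo-evens-mul (suc M) w u n =
  trans (geo-cong (M + suc M) (geo-evens-mul M w u) n) (geo-mul (M + suc M) w (geo-evens M u) n)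

geo-evens-geo : ∀ M w u → geo-evens M (geo w u) ≗ geo w (geo-evens M u)
geo-evens-geo zero    w u n = refl
geo-evens-geo (suc M) w u n =
  trans (geo-cong (M + suc M) (geo-evens-geo M w u) n) (geo-comm (M + suc M) w (geo-evens M u) n)

geo-evens-injective : ∀ M {u v} N → (∀ n → n ≤ N → geo-evens M u n ≡ geo-evens M v n) →
  ∀ n → n ≤ N → u n ≡ v n
geo-evens-injective zero    N h = h
geo-evens-injective (suc M) N h = geo-evens-injective M N (geo-injective (M + suc M) N h)

all-parts : ℕ → Seq
all-parts zero    = δ
all-parts (suc i) = geo i (all-parts i)

all-parts-stable : ∀ {m j} → m ≤ j → all-parts j m ≡ all-parts m m
all-parts-stable {m} p = go (≤⇒≤′ p)
  where
  go : ∀ {j} → m ≤′ j → all-parts j m ≡ all-parts m m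
  go ≤′-refl = refl
  go (≤′-step {j} p) = trans (trans (geo-fix j (all-parts j) m)
    (trans (cong (all-parts j m +_) (shift-vanish (geo j (all-parts j)) (s≤s (≤′⇒≤ p)))) (+-identityʳ _))) (go p)

geo-evens-distinct : ∀ M → geo-evens M (distinct M) ≗ all-parts M
geo-evens-distinct zero    n = refl
geo-evens-distinct (suc M) n = begin
  geo (M + suc M) (geo-evens M (mul M (distinct M))) n
    ≡⟨ geo-cong (M + suc M) (λ m → trans (geo-evens-mul M M (distinct M) m)
         (mul-local M m (λ i _ → geo-evens-distinct M i))) n ⟩
  geo (M + suc M) (mul M (all-parts M)) n  ≡⟨ geo-mul (M + suc M) M (all-parts M) n ⟩
  mul M (geo (M + suc M) (all-parts M)) n  ≡⟨ mul-geo-double M (all-parts M) n ⟩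
  geo M (all-parts M) n                    ∎
  where open ≡-Reasoning

geo-evens-odd : ∀ M → geo-evens M (Odd.prefix M) ≗ all-parts (M + M)
geo-evens-odd zero    n = refl
geo-evens-odd (suc M) n = begin
  geo (M + suc M) (geo-evens M (geo (2 * M) (Odd.prefix M))) n
    ≡⟨ geo-cong (M + suc M) (λ m → trans (geo-evens-geo M (2 * M) (Odd.prefix M) m)
         (trans (geo-cong (2 * M) (geo-evens-odd M) m)
           (cong (λ z → geo (M + z) (all-parts (M + M)) m) (+-identityʳ M)))) n ⟩
  geo (M + suc M) (all-parts (suc (M + M))) n
    ≡⟨ cong (λ z → geo (M + suc M) (all-parts z) n) (sym (+-suc M M)) ⟩
  geo (M + suc M) (all-parts (M + suc M)) n ∎
  where open ≡-Reasoning

opaque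
  -- By euler, also the number of partitions into distinct parts.
  q : Seq
  q = Odd.total

  Odd-total : ∀ n → Odd.total n ≡ q n
  Odd-total n = refl

-- Multiply both products by 1/(1 - q^(2i)) for i ≤ M. This turns each 1 + q^i into 1/(1 - q^i), and
-- it supplies the even parts missing from the odd product. The results involve all parts up to M
-- and up to 2M, so they agree up to degree M, where the common factor cancels.
euler : ∀ {M n} → n ≤ M → distinct M n ≡ q n
euler {M} {n} n≤M = trans
  (geo-evens-injective M M (λ m p → trans (geo-evens-distinct M m) (trans (all-parts-stable p)
    (trans (sym (all-parts-stable (≤-trans p (m≤m+n M M)))) (sym (geo-evens-odd M m))))) n n≤M)
  (trans (Odd.prefix-stable n≤M) (Odd-total n))

Distinct-total : ∀ n → Distinct.total n ≡ q n
Distinct-total n = trans (Distinct-prefix n n) (euler {n} ≤-refl)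

-- The part 1 alone gives the constant sequence 1, and every further factor 1/(1 - q^w) preserves
-- monotonicity.
q-monotone : Monotone q
q-monotone n = subst₂ _≤_ (trans (Odd.prefix-stable (n≤1+n n)) (Odd-total n)) (Odd-total (suc n)) (go n n)
  where
  go : ∀ U → Monotone (Odd.prefix (suc U))
  go zero    n = ≤-reflexive (sym (geo-fix 0 δ (suc n)))
  go (suc U) = geo-monotone (2 * suc U) (go U)

-- Partial sums of q and sums along progressions

opaque
  S : Seq
  S n = ∑ (suc n) q

  S-fix : ∀ n → S n ≡ q n + shift 1 S n
  S-fix zero    = +-comm 0 (q 0)
  S-fix (suc n) = +-comm (S n) (q (suc n))

  S-monotone : Monotone S
  S-monotone n = m≤m+n (S n) (q (suc n))

S-positive : ∀ n → 1 ≤ S n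
S-positive zero    = ≤-trans (≤-reflexive (Odd-total 0)) (≤-trans (m≤m+n (q 0) _) (≤-reflexive (sym (S-fix 0))))
S-positive (suc n) = ≤-trans (S-positive n) (S-monotone n)

S-expand : ∀ w n → shift w S n ≡ shift w q n + shift (suc w) S n
S-expand w n = trans (shift-cong w S-fix n) (trans (shift-⊕ w q (shift 1 S) n)
  (cong (shift w q n +_) (trans (shift-shift w 1 S n) (cong (λ z → shift z S n) (+-comm w 1)))))

S-upper : ∀ w n → S n ≤ w * q n + shift w S n
S-upper zero    n = ≤-refl
S-upper (suc w) n = begin
  S n                                            ≤⟨ S-upper w n ⟩
  w * q n + shift w S n                          ≡⟨ cong (w * q n +_) (S-expand w n) ⟩
  w * q n + (shift w q n + shift (suc w) S n)    ≤⟨ +-monoʳ-≤ (w * q n) (+-monoˡ-≤ _ (shift-≤ w q-monotone n)) ⟩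
  w * q n + (q n + shift (suc w) S n)            ≡⟨ arith (w * q n) (q n) _ ⟩
  (q n + w * q n) + shift (suc w) S n            ∎
  where
  open ≤-Reasoning
  arith : ∀ a b c → a + (b + c) ≡ (b + a) + c
  arith = solve-∀

S-lower : ∀ w n → shift w S n + w * shift w q n ≤ S n
S-lower zero    n = ≤-reflexive (+-identityʳ (S n))
S-lower (suc w) n = begin
  shift (suc w) S n + suc w * shift (suc w) q n
    ≤⟨ +-monoʳ-≤ (shift (suc w) S n) (*-monoʳ-≤ (suc w) (shift-suc-≤ w q-monotone n)) ⟩
  shift (suc w) S n + (shift w q n + w * shift w q n)
    ≡⟨ arith (shift (suc w) S n) (shift w q n) _ ⟩
  (shift w q n + shift (suc w) S n) + w * shift w q n
    ≡⟨ cong (_+ w * shift w q n) (sym (S-expand w n)) ⟩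
  shift w S n + w * shift w q n
    ≤⟨ S-lower w n ⟩
  S n ∎
  where
  open ≤-Reasoning
  arith : ∀ a b c → a + (b + c) ≡ (b + a) + c
  arith = solve-∀

-- As q is monotone, w + 1 times a term of the progression is at most the sum of the block of w + 1
-- consecutive values starting there, and at least that of the block ending there. The blocks tile
-- S(n); above, only the first term q(n) has no block.
geo-q-upper : ∀ w n → suc w * geo w q n ≤ S n + suc w * q n
geo-q-upper w = strong-induction _ λ n ih → begin
  suc w * geo w q n
    ≡⟨ cong (suc w *_) (geo-fix w q n) ⟩
  suc w * (q n + shift (suc w) (geo w q) n)
    ≡⟨ *-distribˡ-+ (suc w) (q n) _ ⟩
  suc w * q n + suc w * shift (suc w) (geo w q) n
    ≡⟨ cong (suc w * q n +_) (sym (shift-* (suc w) (suc w) (geo w q) n)) ⟩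
  suc w * q n + shift (suc w) (λ m → suc w * geo w q m) n
    ≤⟨ +-monoʳ-≤ (suc w * q n) (shift-rel _≤_ z≤n (suc w) n (λ m p → ih m (m+1+w≤n⇒m<n p))) ⟩
  suc w * q n + shift (suc w) (S ⊕ (λ m → suc w * q m)) n
    ≡⟨ cong (suc w * q n +_) (trans (shift-⊕ (suc w) S _ n)
         (cong (shift (suc w) S n +_) (shift-* (suc w) (suc w) q n))) ⟩
  suc w * q n + (shift (suc w) S n + suc w * shift (suc w) q n)
    ≤⟨ +-monoʳ-≤ (suc w * q n) (S-lower (suc w) n) ⟩
  suc w * q n + S n
    ≡⟨ +-comm (suc w * q n) (S n) ⟩
  S n + suc w * q n ∎
  where open ≤-Reasoning

geo-q-lower : ∀ w n → S n ≤ suc w * geo w q n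
geo-q-lower w = strong-induction _ λ n ih → begin
  S n
    ≤⟨ S-upper (suc w) n ⟩
  suc w * q n + shift (suc w) S n
    ≤⟨ +-monoʳ-≤ (suc w * q n) (shift-rel _≤_ z≤n (suc w) n (λ m p → ih m (m+1+w≤n⇒m<n p))) ⟩
  suc w * q n + shift (suc w) (λ m → suc w * geo w q m) n
    ≡⟨ cong (suc w * q n +_) (shift-* (suc w) (suc w) (geo w q) n) ⟩
  suc w * q n + suc w * shift (suc w) (geo w q) n
    ≡⟨ sym (*-distribˡ-+ (suc w) (q n) _) ⟩
  suc w * (q n + shift (suc w) (geo w q) n)
    ≡⟨ cong (suc w *_) (sym (geo-fix w q n)) ⟩
  suc w * geo w q n ∎
  where open ≤-Reasoning

progression-upper : ∀ w s n → suc w * shift s (geo w q) n ≤ S n + suc w * q n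
progression-upper w s n = ≤-trans (*-monoʳ-≤ (suc w) (shift-≤ s (geo-monotone w q-monotone) n)) (geo-q-upper w n)

progression-lower : ∀ w s n → S n ≤ suc w * shift s (geo w q) n + s * q n
progression-lower w s n = begin
  S n                                             ≤⟨ S-upper s n ⟩
  s * q n + shift s S n                           ≤⟨ +-monoʳ-≤ (s * q n) (shift-mono s (geo-q-lower w) n) ⟩
  s * q n + shift s (λ m → suc w * geo w q m) n   ≡⟨ cong (s * q n +_) (shift-* s (suc w) (geo w q) n) ⟩
  s * q n + suc w * shift s (geo w q) n           ≡⟨ +-comm (s * q n) _ ⟩
  suc w * shift s (geo w q) n + s * q n           ∎
  where open ≤-Reasoning

-- The estimate q = o(S)

Negligible : Seq → Set
Negligible u = ∀ K → ∃[ N ] (∀ n → N ≤ n → K * u n ≤ S n)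

halve : ∀ {a b} → 2 * a ≤ 2 * b → a ≤ b
halve {a} {b} = *-cancelˡ-≤ {a} {b} 2

negligible-⊕ : ∀ {u v} → Negligible u → Negligible v → Negligible (u ⊕ v)
negligible-⊕ {u} {v} hu hv K with hu (2 * K) | hv (2 * K)
... | M , p | N , r = M ⊔ N , λ n le → halve (begin
  2 * (K * (u n + v n))          ≡⟨ arith K (u n) (v n) ⟩
  2 * K * u n + 2 * K * v n      ≤⟨ +-mono-≤ (p n (m⊔n≤o⇒m≤o M N le)) (r n (m⊔n≤o⇒n≤o M N le)) ⟩
  S n + S n                      ≡⟨ cong (S n +_) (sym (+-identityʳ (S n))) ⟩
  2 * S n                        ∎)
  where
  open ≤-Reasoning
  arith : ∀ K a b → 2 * (K * (a + b)) ≡ 2 * K * a + 2 * K * b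
  arith = solve-∀

negligible-shift : ∀ x {u} → Negligible u → Negligible (shift x u)
negligible-shift x {u} hu K with hu K
... | N , p = N + x , λ n le → begin
  K * shift x u n             ≡⟨ sym (shift-* x K u n) ⟩
  shift x (λ m → K * u m) n   ≤⟨ go x n le ⟩
  shift x S n                 ≤⟨ shift-≤ x S-monotone n ⟩
  S n                         ∎
  where
  open ≤-Reasoning
  go : ∀ x n → N + x ≤ n → shift x (λ m → K * u m) n ≤ shift x S n
  go zero    n       le = p n (≤-trans (m≤m+n N 0) le)
  go (suc x) zero    le = z≤n
  go (suc x) (suc n) le = go x n (s≤s⁻¹ (subst (_≤ suc n) (+-suc N x) le))

negligible-𝟎 : Negligible 𝟎
negligible-𝟎 K = 0 , λ n _ → ≤-trans (≤-reflexive (*-zeroʳ K)) z≤n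

negligible-∑ : ∀ R (φ : ℕ → Seq) → (∀ i → Negligible (φ i)) → Negligible (λ n → ∑ R (λ i → φ i n))
negligible-∑ zero    φ h = negligible-𝟎
negligible-∑ (suc R) φ h = negligible-⊕ (negligible-∑ R φ h) (h R)

-- parts M ℓ n counts the partitions of n into exactly ℓ distinct parts, all at most M, and
-- lengths M n is the sum of the numbers of parts over all partitions of n into such parts.
parts : ℕ → ℕ → Seq
parts M       zero    = δ
parts zero    (suc ℓ) = 𝟎
parts (suc M) (suc ℓ) = parts M (suc ℓ) ⊕ shift (suc M) (parts M ℓ)

lengths : ℕ → Seq
lengths zero    = 𝟎
lengths (suc M) = lengths M ⊕ shift (suc M) (lengths M ⊕ distinct M)

-- A partition with at least K parts contributes at least K to `lengths`; any other is counted in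
-- one of the K sequences `parts M ℓ` with ℓ < K.
few-or-many : ∀ M K n → K * distinct M n ≤ lengths M n + K * ∑ K (λ ℓ → parts M ℓ n)
few-or-many M       zero    n = z≤n
few-or-many zero    (suc K) n = *-monoʳ-≤ (suc K) (≤-trans (m≤m+n (δ n) _)
  (≤-reflexive (sym (∑-head K (λ ℓ → parts zero ℓ n)))))
few-or-many (suc M) (suc K) n = begin
  suc K * (distinct M n + sh (distinct M))
    ≡⟨ *-distribˡ-+ (suc K) (distinct M n) _ ⟩
  suc K * distinct M n + (sh (distinct M) + K * sh (distinct M))
    ≤⟨ +-mono-≤ (few-or-many M (suc K) n) (+-monoʳ-≤ (sh (distinct M)) ih) ⟩
  (lengths M n + suc K * ∑ (suc K) (λ ℓ → parts M ℓ n))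
    + (sh (distinct M) + (sh (lengths M) + K * ∑ K (λ ℓ → sh (parts M ℓ))))
    ≤⟨ +-monoʳ-≤ (lengths M n + suc K * ∑ (suc K) (λ ℓ → parts M ℓ n))
         (+-monoʳ-≤ (sh (distinct M)) (+-monoʳ-≤ (sh (lengths M)) (m≤n+m _ (∑ K (λ ℓ → sh (parts M ℓ)))))) ⟩
  (lengths M n + suc K * ∑ (suc K) (λ ℓ → parts M ℓ n))
    + (sh (distinct M) + (sh (lengths M) + suc K * ∑ K (λ ℓ → sh (parts M ℓ))))
    ≡⟨ arith (suc K) (lengths M n) (∑ (suc K) (λ ℓ → parts M ℓ n)) (sh (distinct M)) (sh (lengths M)) _ ⟩
  (lengths M n + (sh (lengths M) + sh (distinct M)))
    + suc K * (∑ (suc K) (λ ℓ → parts M ℓ n) + ∑ K (λ ℓ → sh (parts M ℓ)))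
    ≡⟨ cong₂ (λ y z → (lengths M n + y) + suc K * z)
         (sym (shift-⊕ (suc M) (lengths M) (distinct M) n)) (sym split) ⟩
  lengths (suc M) n + suc K * ∑ (suc K) (λ ℓ → parts (suc M) ℓ n) ∎
  where
  open ≤-Reasoning
  sh : Seq → ℕ
  sh u = shift (suc M) u n
  arith : ∀ k a b c d e → (a + k * b) + (c + (d + k * e)) ≡ (a + (d + c)) + k * (b + e)
  arith = solve-∀
  ih : K * sh (distinct M) ≤ sh (lengths M) + K * ∑ K (λ ℓ → sh (parts M ℓ))
  ih = begin
    K * sh (distinct M)
      ≡⟨ sym (shift-* (suc M) K (distinct M) n) ⟩
    sh (λ m → K * distinct M m)
      ≤⟨ shift-mono (suc M) (few-or-many M K) n ⟩
    sh (lengths M ⊕ (λ m → K * ∑ K (λ ℓ → parts M ℓ m)))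
      ≡⟨ trans (shift-⊕ (suc M) (lengths M) _ n) (cong (sh (lengths M) +_)
           (trans (shift-* (suc M) K _ n) (cong (K *_) (shift-∑ (suc M) K (parts M) n)))) ⟩
    sh (lengths M) + K * ∑ K (λ ℓ → sh (parts M ℓ)) ∎
  split : ∑ (suc K) (λ ℓ → parts (suc M) ℓ n) ≡ ∑ (suc K) (λ ℓ → parts M ℓ n) + ∑ K (λ ℓ → sh (parts M ℓ))
  split = trans (∑-head K _) (trans (cong (δ n +_) (∑-⊕ K (λ ℓ → parts M (suc ℓ) n) (λ ℓ → sh (parts M ℓ))))
    (trans (sym (+-assoc (δ n) _ _)) (cong (_+ ∑ K (λ ℓ → sh (parts M ℓ))) (sym (∑-head K (λ ℓ → parts M ℓ n))))))

-- Removing a part w from a partition of n leaves a partition of n − w.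
lengths-≤ : ∀ M n → lengths M n ≤ ∑ M (λ w → shift (suc w) (distinct M) n)
lengths-≤ zero    n = z≤n
lengths-≤ (suc M) n = begin
  lengths M n + shift (suc M) (lengths M ⊕ distinct M) n
    ≡⟨ cong (lengths M n +_) (shift-⊕ (suc M) (lengths M) (distinct M) n) ⟩
  lengths M n + (shift (suc M) (lengths M) n + shift (suc M) (distinct M) n)
    ≤⟨ +-mono-≤ (lengths-≤ M n) (+-mono-≤ (shift-mono (suc M) (lengths-≤ M) n) (m≤m+n _ _)) ⟩
  ∑ M (λ w → shift (suc w) (distinct M) n)
    + (shift (suc M) (λ m → ∑ M (λ w → shift (suc w) (distinct M) m)) n
       + (shift (suc M) (distinct M) n + shift (suc M) (shift (suc M) (distinct M)) n))
    ≡⟨ sym (+-assoc (∑ M (λ w → shift (suc w) (distinct M) n)) _ _) ⟩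
  (∑ M (λ w → shift (suc w) (distinct M) n)
    + shift (suc M) (λ m → ∑ M (λ w → shift (suc w) (distinct M) m)) n)
       + (shift (suc M) (distinct M) n + shift (suc M) (shift (suc M) (distinct M)) n)
    ≡⟨ cong₂ _+_ exchange (sym (shift-⊕ (suc M) (distinct M) (shift (suc M) (distinct M)) n)) ⟩
  ∑ M (λ w → shift (suc w) (distinct (suc M)) n) + shift (suc M) (distinct (suc M)) n ∎
  where
  open ≤-Reasoning
  exchange : ∑ M (λ w → shift (suc w) (distinct M) n)
    + shift (suc M) (λ m → ∑ M (λ w → shift (suc w) (distinct M) m)) n
    ≡ ∑ M (λ w → shift (suc w) (distinct (suc M)) n)
  exchange = trans (cong (∑ M (λ w → shift (suc w) (distinct M) n) +_)
      (trans (shift-∑ (suc M) M (λ w → shift (suc w) (distinct M)) n)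
        (∑-cong M (λ w _ → shift-swap (suc M) (suc w) (distinct M) n))))
    (trans (sym (∑-⊕ M _ _))
      (∑-cong M (λ w _ → sym (shift-⊕ (suc w) (distinct M) (shift (suc M) (distinct M)) n))))

∑-shift-q : ∀ R n → ∑ R (λ w → shift w q n) + shift R S n ≡ S n
∑-shift-q zero    n = refl
∑-shift-q (suc R) n = trans (+-assoc (∑ R (λ w → shift w q n)) _ _)
  (trans (cong (∑ R (λ w → shift w q n) +_) (sym (S-expand R n))) (∑-shift-q R n))

lengths-≤-S : ∀ n → lengths n n ≤ S n
lengths-≤-S n = begin
  lengths n n                                  ≤⟨ lengths-≤ n n ⟩
  ∑ n (λ w → shift (suc w) (distinct n) n)     ≡⟨ ∑-cong n (λ w _ → shift-local (suc w) n
                                                    (λ m p → euler (≤-trans (m≤m+n m (suc w)) p))) ⟩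
  ∑ n (λ w → shift (suc w) q n)                ≤⟨ m≤n+m _ (q n) ⟩
  q n + ∑ n (λ w → shift (suc w) q n)          ≡⟨ sym (∑-head n (λ w → shift w q n)) ⟩
  ∑ (suc n) (λ w → shift w q n)                ≤⟨ m≤m+n _ (shift (suc n) S n) ⟩
  _                                            ≡⟨ ∑-shift-q (suc n) n ⟩
  S n                                          ∎
  where open ≤-Reasoning

-- Subtract 1 from each of the ℓ + 1 parts.
parts-lower : ∀ M ℓ n → parts (suc M) (suc ℓ) n ≡ shift (suc ℓ) (parts M (suc ℓ) ⊕ parts M ℓ) n
parts-lower zero    zero    n = refl
parts-lower zero    (suc ℓ) n = trans (shift-𝟎 1 n) (sym (shift-𝟎 (suc (suc ℓ)) n))
parts-lower (suc M) zero    n = begin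
  parts (suc M) 1 n + shift (suc (suc M)) δ n
    ≡⟨ cong₂ _+_ (parts-lower M zero n) (sym (shift-shift 1 (suc M) δ n)) ⟩
  shift 1 (parts M 1 ⊕ δ) n + shift 1 (shift (suc M) δ) n
    ≡⟨ sym (shift-⊕ 1 (parts M 1 ⊕ δ) (shift (suc M) δ) n) ⟩
  shift 1 ((parts M 1 ⊕ δ) ⊕ shift (suc M) δ) n
    ≡⟨ shift-cong 1 (λ m → arith (parts M 1 m) (δ m) _) n ⟩
  shift 1 (parts (suc M) 1 ⊕ δ) n ∎
  where
  open ≡-Reasoning
  arith : ∀ a b c → (a + b) + c ≡ (a + c) + b
  arith = solve-∀
parts-lower (suc M) (suc ℓ) n = begin
  parts (suc M) (suc (suc ℓ)) n + shift (suc (suc M)) (parts (suc M) (suc ℓ)) n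
    ≡⟨ cong₂ _+_ (parts-lower M (suc ℓ) n) (trans (shift-cong (suc (suc M)) (parts-lower M ℓ) n)
         (trans (shift-shift (suc (suc M)) (suc ℓ) _ n)
           (trans (cong (λ z → shift z (parts M (suc ℓ) ⊕ parts M ℓ) n) (comm M ℓ))
             (sym (shift-shift (suc (suc ℓ)) (suc M) _ n))))) ⟩
  shift (suc (suc ℓ)) (parts M (suc (suc ℓ)) ⊕ parts M (suc ℓ)) n
    + shift (suc (suc ℓ)) (shift (suc M) (parts M (suc ℓ) ⊕ parts M ℓ)) n
    ≡⟨ sym (shift-⊕ (suc (suc ℓ)) (parts M (suc (suc ℓ)) ⊕ parts M (suc ℓ)) _ n) ⟩
  shift (suc (suc ℓ)) ((parts M (suc (suc ℓ)) ⊕ parts M (suc ℓ)) ⊕ shift (suc M) (parts M (suc ℓ) ⊕ parts M ℓ)) n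
    ≡⟨ shift-cong (suc (suc ℓ)) (λ m → trans
         (cong (parts M (suc (suc ℓ)) m + parts M (suc ℓ) m +_) (shift-⊕ (suc M) (parts M (suc ℓ)) (parts M ℓ) m))
         (+-exchange (parts M (suc (suc ℓ)) m) (parts M (suc ℓ) m) _ _)) n ⟩
  shift (suc (suc ℓ)) (parts (suc M) (suc (suc ℓ)) ⊕ parts (suc M) (suc ℓ)) n ∎
  where
  open ≡-Reasoning
  comm : ∀ M ℓ → suc (suc M) + suc ℓ ≡ suc (suc ℓ) + suc M
  comm = solve-∀

exactly : ℕ → Seq
exactly ℓ n = parts n ℓ n

parts-stable : ∀ ℓ {m M} → m ≤ M → parts M ℓ m ≡ exactly ℓ m
parts-stable zero    p = refl
parts-stable (suc ℓ) {m} p = go (≤⇒≤′ p)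
  where
  go : ∀ {M} → m ≤′ M → parts M (suc ℓ) m ≡ exactly (suc ℓ) m
  go ≤′-refl = refl
  go (≤′-step {M} p) = trans (trans
    (cong (parts M (suc ℓ) m +_) (shift-vanish (parts M ℓ) (s≤s (≤′⇒≤ p)))) (+-identityʳ _)) (go p)

exactly-lower : ∀ ℓ n → exactly (suc ℓ) n ≡ shift (suc ℓ) (exactly (suc ℓ)) n + shift (suc ℓ) (exactly ℓ) n
exactly-lower ℓ zero    = refl
exactly-lower ℓ (suc n) = trans (parts-lower n ℓ (suc n)) (trans
  (shift-local (suc ℓ) (suc n) (λ m p → let m≤n = s≤s⁻¹ (m+1+w≤n⇒m<n p) in
    cong₂ _+_ (parts-stable (suc ℓ) m≤n) (parts-stable ℓ m≤n)))
  (shift-⊕ (suc ℓ) (exactly (suc ℓ)) (exactly ℓ) (suc n)))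

parts≤distinct : ∀ M ℓ n → parts M ℓ n ≤ distinct M n
parts≤distinct zero    zero    n = ≤-refl
parts≤distinct zero    (suc ℓ) n = z≤n
parts≤distinct (suc M) zero    n = ≤-trans (parts≤distinct M zero n) (m≤m+n _ _)
parts≤distinct (suc M) (suc ℓ) n = +-mono-≤ (parts≤distinct M (suc ℓ) n) (shift-mono (suc M) (parts≤distinct M ℓ) n)

exactly≤q : ∀ ℓ n → exactly ℓ n ≤ q n
exactly≤q ℓ n = ≤-trans (parts≤distinct n ℓ n) (≤-reflexive (euler {n} ≤-refl))

-- Lowering all parts by 1 replaces u(n) by u(n - L) plus a term with one part fewer, negligible by
-- induction. After 2K such steps the remaining u(n - 2KL) is at most S(n)/2K, and the accumulated
-- error is eventually below that as well.
exactly-negligible : ∀ ℓ → Negligible (exactly ℓ)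
exactly-negligible zero    K = 1 , λ { (suc n) _ → ≤-trans (≤-reflexive (*-zeroʳ K)) z≤n }
exactly-negligible (suc ℓ) K with peel (2 * K)
  where
  u = exactly (suc ℓ)
  L = suc ℓ
  peel : ∀ G → ∃[ e ] (Negligible e × ∀ n → u n ≤ shift (G * L) u n + e n)
  peel zero    = 𝟎 , negligible-𝟎 , λ n → m≤m+n _ _
  peel (suc G) with peel G
  ... | e , he , p = shift (G * L) (shift L (exactly ℓ)) ⊕ e ,
    negligible-⊕ (negligible-shift (G * L) (negligible-shift L (exactly-negligible ℓ))) he ,
    λ n → ≤-trans (p n) (≤-reflexive (trans (cong (_+ e n) (trans (shift-cong (G * L) (exactly-lower ℓ) n)
      (trans (shift-⊕ (G * L) (shift L u) (shift L (exactly ℓ)) n)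
        (cong (_+ shift (G * L) (shift L (exactly ℓ)) n)
          (trans (shift-swap (G * L) L u n) (shift-shift L (G * L) u n))))))
      (+-assoc (shift (L + G * L) u n) _ (e n))))
... | e , he , p with he (2 * K)
... | N , r = N , λ n le → halve (begin
  2 * (K * u n)
    ≡⟨ sym (*-assoc 2 K (u n)) ⟩
  2 * K * u n
    ≤⟨ *-monoʳ-≤ (2 * K) (p n) ⟩
  2 * K * (shift (2 * K * L) u n + e n)
    ≡⟨ *-distribˡ-+ (2 * K) _ (e n) ⟩
  2 * K * shift (2 * K * L) u n + 2 * K * e n
    ≤⟨ +-mono-≤ (disjoint (2 * K) n) (r n le) ⟩
  S n + S n
    ≡⟨ cong (S n +_) (sym (+-identityʳ (S n))) ⟩
  2 * S n ∎)
  where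
  open ≤-Reasoning
  u = exactly (suc ℓ)
  L = suc ℓ
  decreasing : ∀ G n → shift (G * L) u n ≤ u n
  decreasing zero    n = ≤-refl
  decreasing (suc G) n = begin
    shift (L + G * L) u n        ≡⟨ sym (shift-shift L (G * L) u n) ⟩
    shift L (shift (G * L) u) n  ≤⟨ shift-mono L (decreasing G) n ⟩
    shift L u n                  ≤⟨ m≤m+n _ _ ⟩
    _                            ≡⟨ sym (exactly-lower ℓ n) ⟩
    u n                          ∎
  -- By `decreasing`, u(n - GL) is at most each of u(n), u(n - L), ..., u(n - (G-1)L). These are
  -- bounded by values of q at G different arguments, all of them terms of S(n).
  disjoint : ∀ G n → G * shift (G * L) u n ≤ S n
  disjoint zero    n = z≤n
  disjoint (suc G) n = begin
    shift (L + G * L) u n + G * shift (L + G * L) u n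
      ≤⟨ +-mono-≤ (≤-trans (decreasing (suc G) n) (exactly≤q (suc ℓ) n))
           (≤-reflexive (trans (cong (G *_) (sym (shift-shift L (G * L) u n))) (sym (shift-* L G _ n)))) ⟩
    q n + shift L (λ m → G * shift (G * L) u m) n
      ≤⟨ +-monoʳ-≤ (q n) (shift-mono L (disjoint G) n) ⟩
    q n + shift L S n
      ≡⟨ cong (q n +_) (sym (shift-shift 1 ℓ S n)) ⟩
    q n + shift 1 (shift ℓ S) n
      ≤⟨ +-monoʳ-≤ (q n) (shift-mono 1 (shift-≤ ℓ S-monotone) n) ⟩
    q n + shift 1 S n
      ≡⟨ sym (S-fix n) ⟩
    S n ∎

opaque
  -- Partitions with fewer than 2K parts form finitely many negligible classes. The others number at
  -- most `lengths`/2K, hence at most S(n)/2K.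
  q-negligible : Negligible q
  q-negligible K with negligible-∑ (2 * K) exactly exactly-negligible (2 * K)
  ... | N , p = N , λ n le → halve (begin
    2 * (K * q n)                                         ≡⟨ sym (*-assoc 2 K (q n)) ⟩
    2 * K * q n                                           ≡⟨ cong (2 * K *_) (sym (euler {n} ≤-refl)) ⟩
    2 * K * distinct n n                                  ≤⟨ few-or-many n (2 * K) n ⟩
    lengths n n + 2 * K * ∑ (2 * K) (λ ℓ → exactly ℓ n)   ≤⟨ +-mono-≤ (lengths-≤-S n) (p n le) ⟩
    S n + S n                                             ≡⟨ cong (S n +_) (sym (+-identityʳ (S n))) ⟩
    2 * S n                                               ∎)
    where open ≤-Reasoning

-- Comparison of sequences with S

infix 4 _⪯_
infixr 7 _·_

_·_ : ℕ → Seq → Seq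
(k · u) n = k * u n

-- lim sup u/S ≤ lim inf v/S.  In particular u ⪯ u says that u/S is a Cauchy sequence.
record _⪯_ (u v : Seq) : Set where
  constructor eventually
  field bound : ∀ K → ∃[ N ] (∀ m n → N ≤ m → N ≤ n → K * (u m * S n) ≤ K * (v n * S m) + S m * S n)
open _⪯_

≤⇒⪯ : ∀ {u v v′} → u ⪯ v → (∀ n → v n ≤ v′ n) → u ⪯ v′
≤⇒⪯ p h .bound K with bound p K
... | N , b = N , λ m n M≤ N≤ → ≤-trans (b m n M≤ N≤)
  (+-monoˡ-≤ _ (*-monoʳ-≤ K (*-monoˡ-≤ (S m) (h n))))

≤-⪯ : ∀ {u u′ v} → (∀ n → u n ≤ u′ n) → u′ ⪯ v → u ⪯ v
≤-⪯ h p .bound K with bound p K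
... | N , b = N , λ m n M≤ N≤ → ≤-trans (*-monoʳ-≤ K (*-monoˡ-≤ (S n) (h m))) (b m n M≤ N≤)

≗-⪯ : ∀ {u u′ v v′} → u ≗ u′ → v ≗ v′ → u′ ⪯ v′ → u ⪯ v
≗-⪯ h k p = ≤⇒⪯ (≤-⪯ (λ n → ≤-reflexive (h n)) p) (λ n → ≤-reflexive (sym (k n)))

S⪯S : S ⪯ S
S⪯S .bound K = 0 , λ m n _ _ → ≤-trans (≤-reflexive (cong (K *_) (*-comm (S m) (S n)))) (m≤m+n _ _)

⪯-⊕ : ∀ {u v u′ v′} → u ⪯ v → u′ ⪯ v′ → (u ⊕ u′) ⪯ (v ⊕ v′)
⪯-⊕ {u} {v} {u′} {v′} p p′ .bound K with bound p (2 * K) | bound p′ (2 * K)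
... | M , b | N , b′ = M ⊔ N , λ m n M≤ N≤ → halve (begin
  2 * (K * ((u m + u′ m) * S n))
    ≡⟨ lhs K (u m) (u′ m) (S n) ⟩
  2 * K * (u m * S n) + 2 * K * (u′ m * S n)
    ≤⟨ +-mono-≤ (b m n (m⊔n≤o⇒m≤o M N M≤) (m⊔n≤o⇒m≤o M N N≤)) (b′ m n (m⊔n≤o⇒n≤o M N M≤) (m⊔n≤o⇒n≤o M N N≤)) ⟩
  (2 * K * (v n * S m) + S m * S n) + (2 * K * (v′ n * S m) + S m * S n)
    ≡⟨ rhs K (v n) (v′ n) (S m) (S m * S n) ⟩
  2 * (K * ((v n + v′ n) * S m) + S m * S n) ∎)
  where
  open ≤-Reasoning
  lhs : ∀ K a b s → 2 * (K * ((a + b) * s)) ≡ 2 * K * (a * s) + 2 * K * (b * s)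
  lhs = solve-∀
  rhs : ∀ K a b s z → (2 * K * (a * s) + z) + (2 * K * (b * s) + z) ≡ 2 * (K * ((a + b) * s) + z)
  rhs = solve-∀

-- Subtraction reverses the order, so the second hypothesis runs from `w′` to `w` and is used with
-- the two arguments exchanged. This is the only way differences of sequences enter.
⪯-cancel : ∀ {u v w w′} → (u ⊕ w) ⪯ (v ⊕ w′) → w′ ⪯ w → u ⪯ v
⪯-cancel {u} {v} {w} {w′} p p′ .bound K with bound p (2 * K) | bound p′ (2 * K)
... | M , b | N , b′ = M ⊔ N , λ m n M≤ N≤ → halve (+-cancelʳ-≤ (2 * K * (w m * S n)) _ _ (begin
  2 * (K * (u m * S n)) + 2 * K * (w m * S n)
    ≡⟨ lhs K (u m) (w m) (S n) ⟩
  2 * K * ((u m + w m) * S n)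
    ≤⟨ b m n (m⊔n≤o⇒m≤o M N M≤) (m⊔n≤o⇒m≤o M N N≤) ⟩
  2 * K * ((v n + w′ n) * S m) + S m * S n
    ≡⟨ mid K (v n) (w′ n) (S m) (S n) ⟩
  2 * (K * (v n * S m)) + S m * S n + 2 * K * (w′ n * S m)
    ≤⟨ +-monoʳ-≤ (2 * (K * (v n * S m)) + S m * S n) (b′ n m (m⊔n≤o⇒n≤o M N N≤) (m⊔n≤o⇒n≤o M N M≤)) ⟩
  2 * (K * (v n * S m)) + S m * S n + (2 * K * (w m * S n) + S n * S m)
    ≡⟨ rhs K (v n) (w m) (S m) (S n) ⟩
  2 * (K * (v n * S m) + S m * S n) + 2 * K * (w m * S n) ∎))
  where
  open ≤-Reasoning
  lhs : ∀ K a b s → 2 * (K * (a * s)) + 2 * K * (b * s) ≡ 2 * K * ((a + b) * s)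
  lhs = solve-∀
  mid : ∀ K a b s t → 2 * K * ((a + b) * s) + s * t ≡ 2 * (K * (a * s)) + s * t + 2 * K * (b * s)
  mid = solve-∀
  rhs : ∀ K a b s t → 2 * (K * (a * s)) + s * t + (2 * K * (b * t) + t * s)
                    ≡ 2 * (K * (a * s) + s * t) + 2 * K * (b * t)
  rhs = solve-∀

⪯-trans : ∀ {u v w} → u ⪯ v → v ⪯ w → u ⪯ w
⪯-trans {u} {v} {w} p p′ .bound K with bound p (2 * K) | bound p′ (2 * K)
... | M , b | N , b′ = M ⊔ N , λ m n M≤ N≤ →
  let x = M ⊔ N in
  halve (*-cancelʳ-≤ _ _ (S x) {{>-nonZero (S-positive x)}} (begin
  2 * (K * (u m * S n)) * S x
    ≡⟨ lhs K (u m) (S n) (S x) ⟩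
  (2 * K * (u m * S x)) * S n
    ≤⟨ *-monoˡ-≤ (S n) (b m x (m⊔n≤o⇒m≤o M N M≤) (m≤m⊔n M N)) ⟩
  (2 * K * (v x * S m) + S m * S x) * S n
    ≡⟨ mid K (v x) (S m) (S n) (S x) ⟩
  (2 * K * (v x * S n)) * S m + S m * S n * S x
    ≤⟨ +-monoˡ-≤ (S m * S n * S x) (*-monoˡ-≤ (S m) (b′ x n (m≤n⊔m M N) (m⊔n≤o⇒n≤o M N N≤))) ⟩
  (2 * K * (w n * S x) + S x * S n) * S m + S m * S n * S x
    ≡⟨ rhs K (w n) (S m) (S n) (S x) ⟩
  2 * (K * (w n * S m) + S m * S n) * S x ∎))
  where
  open ≤-Reasoning
  lhs : ∀ K a s t → 2 * (K * (a * s)) * t ≡ (2 * K * (a * t)) * s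
  lhs = solve-∀
  mid : ∀ K a r s t → (2 * K * (a * r) + r * t) * s ≡ (2 * K * (a * s)) * r + r * s * t
  mid = solve-∀
  rhs : ∀ K a r s t → (2 * K * (a * t) + t * s) * r + r * s * t ≡ 2 * (K * (a * r) + r * s) * t
  rhs = solve-∀

⪯-· : ∀ c {u v} → u ⪯ v → (c · u) ⪯ (c · v)
⪯-· c {u} {v} p .bound K with bound p (K * c)
... | N , b = N , λ m n M≤ N≤ → subst₂ _≤_ (arith K c (u m) (S n))
  (cong (_+ S m * S n) (arith K c (v n) (S m))) (b m n M≤ N≤)
  where
  arith : ∀ K c a s → K * c * (a * s) ≡ K * (c * a * s)
  arith = solve-∀

⪯-unscale : ∀ c {u v} → (suc c · u) ⪯ (suc c · v) → u ⪯ v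
⪯-unscale c {u} {v} p .bound K with bound p K
... | N , b = N , λ m n M≤ N≤ → *-cancelˡ-≤ (suc c) (begin
  suc c * (K * (u m * S n))                    ≡⟨ arith (suc c) K (u m) (S n) ⟩
  K * (suc c * u m * S n)                      ≤⟨ b m n M≤ N≤ ⟩
  K * (suc c * v n * S m) + S m * S n          ≡⟨ cong (_+ S m * S n) (sym (arith (suc c) K (v n) (S m))) ⟩
  suc c * (K * (v n * S m)) + S m * S n        ≤⟨ +-monoʳ-≤ (suc c * (K * (v n * S m))) (m≤n*m (S m * S n) (suc c)) ⟩
  suc c * (K * (v n * S m)) + suc c * (S m * S n)  ≡⟨ sym (*-distribˡ-+ (suc c) (K * (v n * S m)) (S m * S n)) ⟩
  suc c * (K * (v n * S m) + S m * S n)        ∎)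
  where
  open ≤-Reasoning
  arith : ∀ c K a s → c * (K * (a * s)) ≡ K * (c * a * s)
  arith = solve-∀

-- Cancellation that passes on an error of one S: the step of the alternating expansion for distinct
-- parts.
⪯-cancel-S : ∀ {u v w w′} → (u ⊕ w) ⪯ (v ⊕ w′) → w′ ⪯ (w ⊕ S) → u ⪯ (v ⊕ S)
⪯-cancel-S {u} {v} {w} {w′} p p′ = ⪯-cancel {w = w ⊕ S}
  (≗-⪯ (λ n → sym (+-assoc (u n) (w n) (S n))) (λ n → arith (v n) (S n) (w′ n)) (⪯-⊕ p S⪯S)) p′
  where
  arith : ∀ a b c → (a + b) + c ≡ (a + c) + b
  arith = solve-∀

archimedean : ∀ {P K x y z} → 2 * K ≤ P → P * x ≤ P * y + 2 * z → K * x ≤ K * y + z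
archimedean {P} {K} {x} {y} {z} 2K≤P h with ≤-total x y
... | inj₁ x≤y = ≤-trans (*-monoʳ-≤ K x≤y) (m≤m+n _ z)
... | inj₂ y≤x = subst (λ t → K * t ≤ K * y + z) (m+[n∸m]≡n y≤x) (begin
  K * (y + e)    ≡⟨ *-distribˡ-+ K y e ⟩
  K * y + K * e  ≤⟨ +-monoʳ-≤ (K * y) (halve (begin
    2 * (K * e)  ≡⟨ sym (*-assoc 2 K e) ⟩
    2 * K * e    ≤⟨ *-monoˡ-≤ e 2K≤P ⟩
    P * e        ≤⟨ +-cancelˡ-≤ (P * y) _ _ (subst (_≤ P * y + 2 * z)
                      (trans (cong (P *_) (sym (m+[n∸m]≡n y≤x))) (*-distribˡ-+ P y e)) h) ⟩
    2 * z        ∎)) ⟩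
  K * y + z      ∎)
  where
  open ≤-Reasoning
  e = x ∸ y

-- An error of S against the multiple k + j means S/(k + j), which is arbitrarily small. Using the
-- hypothesis at precision 1 doubles the error, hence j = 2K for precision K.
⪯-limit : ∀ k {u v} → (∀ j → (k + j) · u ⪯ ((k + j) · v ⊕ S)) → u ⪯ v
⪯-limit k {u} {v} h .bound K with bound (h (2 * K)) 1
... | N , b = N , λ m n M≤ N≤ → archimedean {k + 2 * K} {K} (m≤n+m (2 * K) k) (begin
  (k + 2 * K) * (u m * S n)                                  ≡⟨ lhs (k + 2 * K) (u m) (S n) ⟩
  1 * ((k + 2 * K) * u m * S n)                              ≤⟨ b m n M≤ N≤ ⟩
  1 * (((k + 2 * K) * v n + S n) * S m) + S m * S n          ≡⟨ rhs (k + 2 * K) (v n) (S n) (S m) ⟩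
  (k + 2 * K) * (v n * S m) + 2 * (S m * S n)                ∎)
  where
  open ≤-Reasoning
  lhs : ∀ P a s → P * (a * s) ≡ 1 * (P * a * s)
  lhs = solve-∀
  rhs : ∀ P a s t → 1 * ((P * a + s) * t) + t * s ≡ P * (a * t) + 2 * (t * s)
  rhs = solve-∀

≤S⇒⪯S : ∀ C {u} → (∀ n → u n ≤ S n + C * q n) → u ⪯ S
≤S⇒⪯S C {u} h .bound K with q-negligible (K * C)
... | N , b = N , λ m n M≤ N≤ → begin
  K * (u m * S n)                            ≤⟨ *-monoʳ-≤ K (*-monoˡ-≤ (S n) (h m)) ⟩
  K * ((S m + C * q m) * S n)                ≡⟨ arith K C (S m) (q m) (S n) ⟩
  K * (S n * S m) + K * C * q m * S n        ≤⟨ +-monoʳ-≤ (K * (S n * S m)) (*-monoˡ-≤ (S n) (b m M≤)) ⟩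
  K * (S n * S m) + S m * S n                ∎
  where
  open ≤-Reasoning
  arith : ∀ K C a b s → K * ((a + C * b) * s) ≡ K * (s * a) + K * C * b * s
  arith = solve-∀

S≤⇒S⪯ : ∀ C {u} → (∀ n → S n ≤ u n + C * q n) → S ⪯ u
S≤⇒S⪯ C {u} h .bound K with q-negligible (K * C)
... | N , b = N , λ m n M≤ N≤ → begin
  K * (S m * S n)                            ≡⟨ cong (K *_) (*-comm (S m) (S n)) ⟩
  K * (S n * S m)                            ≤⟨ *-monoʳ-≤ K (*-monoˡ-≤ (S m) (h n)) ⟩
  K * ((u n + C * q n) * S m)                ≡⟨ arith K C (u n) (q n) (S m) ⟩
  K * (u n * S m) + K * C * q n * S m        ≤⟨ +-monoʳ-≤ (K * (u n * S m)) (*-monoˡ-≤ (S m) (b n N≤)) ⟩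
  K * (u n * S m) + S n * S m                ≡⟨ cong (K * (u n * S m) +_) (*-comm (S n) (S m)) ⟩
  K * (u n * S m) + S m * S n                ∎
  where
  open ≤-Reasoning
  arith : ∀ K C a b s → K * ((a + C * b) * s) ≡ K * (a * s) + K * C * b * s
  arith = solve-∀

infix 4 _≍_
_≍_ : Seq → Seq → Set
u ≍ v = (u ⪯ v) × (v ⪯ u)

≍-trans : ∀ {u v w} → u ≍ v → v ≍ w → u ≍ w
≍-trans (p , p′) (r , r′) = ⪯-trans p r , ⪯-trans r′ p′

≍-⊕ : ∀ {u v u′ v′} → u ≍ v → u′ ≍ v′ → (u ⊕ u′) ≍ (v ⊕ v′)
≍-⊕ (p , p′) (r , r′) = ⪯-⊕ p r , ⪯-⊕ p′ r′

≍-refl : ∀ {u v} → u ≍ v → u ≍ u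
≍-refl (p , p′) = ⪯-trans p p′ , ⪯-trans p p′

≗-≍ : ∀ {u u′ v v′} → u ≗ u′ → v ≗ v′ → u′ ≍ v′ → u ≍ v
≗-≍ h k (p , p′) = ≗-⪯ h k p , ≗-⪯ k h p′

𝟎⪯𝟎 : 𝟎 ⪯ 𝟎
𝟎⪯𝟎 .bound K = 0 , λ m n _ _ → ≤-trans (≤-reflexive (*-zeroʳ K)) z≤n

-- Windows belonging to a hook length

∑ᴸ : List Symbol → (Symbol → ℕ) → ℕ
∑ᴸ []      φ = 0
∑ᴸ (σ ∷ L) φ = φ σ + ∑ᴸ L φ

∑ᴸ-++ : ∀ L M φ → ∑ᴸ (L ++ M) φ ≡ ∑ᴸ L φ + ∑ᴸ M φ
∑ᴸ-++ []      M φ = refl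
∑ᴸ-++ (σ ∷ L) M φ = trans (cong (φ σ +_) (∑ᴸ-++ L M φ)) (sym (+-assoc (φ σ) _ _))

∑ᴸ-map : ∀ f L φ → ∑ᴸ (map f L) φ ≡ ∑ᴸ L (φ ∘ f)
∑ᴸ-map f []      φ = refl
∑ᴸ-map f (σ ∷ L) φ = cong (φ (f σ) +_) (∑ᴸ-map f L φ)

∑ᴸ-cong : ∀ L {φ ψ} → φ ≗ ψ → ∑ᴸ L φ ≡ ∑ᴸ L ψ
∑ᴸ-cong []      h = refl
∑ᴸ-cong (σ ∷ L) h = cong₂ _+_ (h σ) (∑ᴸ-cong L h)

∑ᴸ-≍ : ∀ L {φ ψ : Symbol → Seq} → (∀ σ → φ σ ≍ ψ σ) →
  (λ n → ∑ᴸ L (λ σ → φ σ n)) ≍ (λ n → ∑ᴸ L (λ σ → ψ σ n))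
∑ᴸ-≍ []      h = 𝟎⪯𝟎 , 𝟎⪯𝟎
∑ᴸ-≍ (σ ∷ L) h = ≍-⊕ (h σ) (∑ᴸ-≍ L h)

∑ᴸ-⊕ : ∀ L φ ψ → ∑ᴸ L (λ σ → φ σ + ψ σ) ≡ ∑ᴸ L φ + ∑ᴸ L ψ
∑ᴸ-⊕ []      φ ψ = refl
∑ᴸ-⊕ (σ ∷ L) φ ψ = trans (cong (φ σ + ψ σ +_) (∑ᴸ-⊕ L φ ψ)) (+-exchange (φ σ) (ψ σ) _ _)

patterns : (f g : Symbol → Symbol) → List Symbol → List Symbol → ℕ → List Symbol
patterns f g L₀ L₁ zero          = L₀
patterns f g L₀ L₁ (suc zero)    = L₁
patterns f g L₀ L₁ (suc (suc t)) = map f (patterns f g L₀ L₁ (suc t)) ++ map g (patterns f g L₀ L₁ t)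

-- The index is the hook length minus one. For distinct parts, a missing part costs the hook one box
-- (a column), a present part two (a column and a row). For odd parts, a copy costs one box (a row),
-- a missing part two (columns). The floor 1 arises for hook length 2 with no equal row below: the
-- box before the last exists only in rows longer than 1.
distinctPatterns oddPatterns : ℕ → List Symbol
distinctPatterns = patterns widen (widen ∘ Distinct.insert) [ symbol 0 0 0 0 ] [ symbol 1 0 0 0 ]
oddPatterns = patterns Odd.insert widen [ symbol 0 0 0 0 ]
  (symbol 0 0 0 1 ∷ Odd.insert (symbol 0 0 0 0) ∷ [])

distribute : ∀ c u v n → c * (u n + v n) ≡ ((c · u) ⊕ (c · v)) n
distribute c u v n = *-distribˡ-+ c (u n) (v n)

unwiden : ∀ {A k s c} → Valid (symbol (suc A) k s c) → Valid (symbol A k s c)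
unwiden (valid p r) = valid p (≤-trans (n≤1+n _) r)

canonical : ∀ A k → Valid (symbol A (suc k) A 0)
canonical A k = valid (s≤s z≤n) (≤-reflexive (+-identityʳ A))

canonical⁺ : ∀ A k → Valid (symbol A (suc k) (suc A) 0)
canonical⁺ A k = valid (s≤s z≤n) (≤-trans (≤-reflexive (+-identityʳ A)) (n≤1+n A))

module DistinctLimits where
  open Distinct

  T₀-q : ∀ k s c → c ≤ s → ∀ n → T (symbol 0 (suc k) s c) n ≡ shift s (geo k q) n
  T₀-q k s c c≤s n = trans (T₀ k s c c≤s n)
    (shift-cong s (λ m → trans (geo-cong (k + 0) Distinct-total m) (cong (λ z → geo z q m) (+-identityʳ k))) n)

  T₀-upper : ∀ k s c → c ≤ s → suc k · T (symbol 0 (suc k) s c) ⪯ S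
  T₀-upper k s c c≤s = ≤S⇒⪯S (suc k) λ n →
    subst (λ z → suc k * z ≤ S n + suc k * q n) (sym (T₀-q k s c c≤s n)) (progression-upper k s n)

  T₀-lower : ∀ k s c → c ≤ s → S ⪯ suc k · T (symbol 0 (suc k) s c)
  T₀-lower k s c c≤s = S≤⇒S⪯ s λ n →
    subst (λ z → S n ≤ suc k * z + s * q n) (sym (T₀-q k s c c≤s n)) (progression-lower k s n)

  T-bound : ∀ A k s c → Valid (symbol A (suc k) s c) → suc k · T (symbol A (suc k) s c) ⪯ S
  T-bound zero    k s c (valid _ v) = T₀-upper k s c v
  T-bound (suc A) k s c v = ≤-⪯
    (λ n → *-monoʳ-≤ (suc k) (≤-trans (m≤m+n _ _) (≤-reflexive (sym (Distinct-split _ (unwiden v) n)))))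
    (T-bound A k s c (unwiden v))

  -- From W k + W (k+1) = U k with U convergent, and W k = O(S / k), the alternating sum
  -- W k = U k − U (k+1) + … converges too.
  T-limit : ∀ A k s c s′ c′ → Valid (symbol A (suc k) s c) → Valid (symbol A (suc k) s′ c′) →
    T (symbol A (suc k) s c) ⪯ T (symbol A (suc k) s′ c′)
  T-limit zero    k s c s′ c′ (valid _ v) (valid _ v′) =
    ⪯-unscale k (⪯-trans (T₀-upper k s c v) (T₀-lower k s′ c′ v′))
  T-limit (suc A) k s c s′ c′ v v′ = ⪯-limit (suc k) (λ j → go j k s c s′ c′ v v′)
    where
    go : ∀ j k s c s′ c′ → Valid (symbol (suc A) (suc k) s c) → Valid (symbol (suc A) (suc k) s′ c′) →
      (suc k + j) · T (symbol (suc A) (suc k) s c) ⪯ ((suc k + j) · T (symbol (suc A) (suc k) s′ c′) ⊕ S)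
    go zero    k s c s′ c′ v v′ = ≤⇒⪯
      (≤-⪯ (λ n → ≤-reflexive (cong (_* T (symbol (suc A) (suc k) s c) n) (+-identityʳ (suc k))))
           (T-bound (suc A) k s c v))
      (λ n → m≤n+m (S n) _)
    -- `suc k + suc j` equals `suc (suc k) + j`, so the same multiple fits the window with one more
    -- copy and `j` lowered. The subtracted windows are compared in the opposite direction, hence
    -- the exchanged arguments.
    go (suc j) k s c s′ c′ v v′ = ⪯-cancel-S {w = N · T (widen (insert σ))} {w′ = N · T (widen (insert σ′))}
      (≗-⪯ (λ n → sym (distribute N (T (widen σ)) (T (widen (insert σ))) n))
           (λ n → sym (distribute N (T (widen σ′)) (T (widen (insert σ′))) n))
           (⪯-· N (≗-⪯ (λ n → sym (Distinct-split σ (unwiden v) n)) (λ n → sym (Distinct-split σ′ (unwiden v′) n))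
             (T-limit A k s c s′ c′ (unwiden v) (unwiden v′)))))
      (subst (λ P → P · T (widen (insert σ′)) ⪯ (P · T (widen (insert σ)) ⊕ S)) (cong suc (sym (+-suc k j)))
        (go j (suc k) _ c′ _ c (Distinct-valid A (suc k) s′ c′) (Distinct-valid A (suc k) s c)))
      where
      N = suc k + suc j
      σ = symbol A (suc k) s c
      σ′ = symbol A (suc k) s′ c′

  opaque
    V : ℕ → ℕ → Seq
    V A k = T (symbol A (suc k) A 0)

    T≍V : ∀ A k s c → Valid (symbol A (suc k) s c) → T (symbol A (suc k) s c) ≍ V A k
    T≍V A k s c v = T-limit A k s c A 0 v (canonical A k) , T-limit A k A 0 s c (canonical A k) v

    V₀ : ∀ k → suc k · V 0 k ≍ S
    V₀ k = T₀-upper k 0 0 z≤n , T₀-lower k 0 0 z≤n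

  -- Corresponds to 1 = 1/(1 + x) + x/(1 + x). The split is applied at offset `suc A` instead of
  -- `A`, so that the widened window is still valid.
  V-split : ∀ A k → V A k ≍ V (suc A) k ⊕ V (suc A) (suc k)
  V-split A k = ≍-trans (let p , p′ = T≍V A k (suc A) 0 (canonical⁺ A k) in p′ , p)
    (≗-≍ (Distinct-split (symbol A (suc k) (suc A) 0) (canonical⁺ A k)) (λ _ → refl)
      (≍-⊕ (T≍V (suc A) k (suc A) 0 (canonical (suc A) k))
           (T≍V (suc A) (suc k) _ 0 (Distinct-valid A (suc k) (suc A) 0))))

  e : ℕ → ℕ → ℕ → Seq
  e t A k n = ∑ᴸ (distinctPatterns t) (λ σ → V (Symbol.missing σ + A) (Symbol.copies σ + k) n)

  e₀ : ∀ A k → e 0 A k ≗ V A k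
  e₀ A k n = +-identityʳ _

  e₁ : ∀ A k → e 1 A k ≗ V (suc A) k
  e₁ A k n = +-identityʳ _

  e₂ : ∀ t A k → e (suc (suc t)) A k ≗ e (suc t) (suc A) k ⊕ e t (suc A) (suc k)
  e₂ t A k n = trans (∑ᴸ-++ (map widen (distinctPatterns (suc t))) _ _) (cong₂ _+_
    (trans (∑ᴸ-map widen (distinctPatterns (suc t)) _)
      (∑ᴸ-cong (distinctPatterns (suc t)) λ σ →
        cong (λ z → V z (Symbol.copies σ + k) n) (sym (+-suc (Symbol.missing σ) A))))
    (trans (∑ᴸ-map (widen ∘ insert) (distinctPatterns t) _)
      (∑ᴸ-cong (distinctPatterns t) λ σ → cong₂ (λ y z → V y z n)
        (sym (+-suc (Symbol.missing σ) A)) (sym (+-suc (Symbol.copies σ) k)))))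

  e-cauchy : ∀ t A k → e t A k ≍ e t A k
  e-cauchy t A k = ∑ᴸ-≍ (distinctPatterns t) (λ σ → ≍-refl (V-split _ _))

  e-split : ∀ t A k → e t A k ≍ e t (suc A) k ⊕ e t (suc A) (suc k)
  e-split t A k = ≍-trans (∑ᴸ-≍ (distinctPatterns t) (λ σ → V-split (Symbol.missing σ + A) (Symbol.copies σ + k)))
    (≗-≍ (λ n → trans (∑ᴸ-⊕ (distinctPatterns t) _ _) (cong₂ _+_
        (∑ᴸ-cong (distinctPatterns t) λ σ →
          cong (λ z → V z (Symbol.copies σ + k) n) (sym (+-suc (Symbol.missing σ) A)))
        (∑ᴸ-cong (distinctPatterns t) λ σ → cong₂ (λ y z → V y z n)
          (sym (+-suc (Symbol.missing σ) A)) (sym (+-suc (Symbol.copies σ) k)))))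
      (λ _ → refl) (≍-⊕ (e-cauchy t (suc A) k) (e-cauchy t (suc A) (suc k))))

  -- By `e₂` the factors satisfy E_(t+2) = E_(t+1)/(1 + x) + x E_t/(1 + x). Hence E_(t+1) + x E_t/(1
  -- + x) does not depend on t, and at t = 0 it is 1.
  e-sum : ∀ t A k → e (suc t) A k ⊕ e t (suc A) (suc k) ≍ V A k
  e-sum zero    A k = ≍-trans
    (≗-≍ (λ n → cong₂ _+_ (e₁ A k n) (e₀ (suc A) (suc k) n)) (λ _ → refl)
      (let p , p′ = V-split A k in ≍-refl (p′ , p)))
    (let p , p′ = V-split A k in p′ , p)
  e-sum (suc t) A k = ≍-trans
    (≗-≍ (λ n → trans (cong (_+ e (suc t) (suc A) (suc k) n) (e₂ t A k n))
              (arith (e (suc t) (suc A) k n) (e t (suc A) (suc k) n) _)) (λ _ → refl)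
      (≍-⊕ (let p , p′ = e-split (suc t) A k in p′ , p) (e-cauchy t (suc A) (suc k))))
    (e-sum t A k)
    where
    arith : ∀ a b c → (a + b) + c ≡ (a + c) + b
    arith = solve-∀

  e≤V : ∀ t A k → e t A k ⪯ V A k
  e≤V zero    A k = ≗-⪯ (e₀ A k) (λ _ → refl) (proj₁ (≍-refl (V-split A k)))
  e≤V (suc t) A k = ≤-⪯ (λ n → m≤m+n _ (e t (suc A) (suc k) n)) (proj₁ (e-sum t A k))

  -- E_(t+1) = 1 - x E_t/(1 + x) with E_t ≤ 1, so E_(t+1) ≥ 1/(1 + x).
  V≤e : ∀ t A k → V (suc A) k ⪯ e (suc t) A k
  V≤e t A k = ⪯-cancel (⪯-trans (proj₂ (V-split A k)) (proj₂ (e-sum t A k))) (e≤V t (suc A) (suc k))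

  -- Feeds the lower bound 1/(1 + x) for E_t back into the recurrence. For t = 0, where E_0 = 1, the
  -- same bound is the splitting of `V (suc A) (suc k)`.
  e-upper : ∀ t A k → e (suc t) A k ⊕ V (suc (suc A)) (suc k) ⪯ V A k
  e-upper zero    A k = ⪯-trans
    (≤-⪯ (λ n → +-mono-≤ (≤-reflexive (e₁ A k n)) (m≤m+n _ _))
      (⪯-⊕ (proj₁ (≍-refl (V-split (suc A) k))) (proj₂ (V-split (suc A) (suc k)))))
    (proj₂ (V-split A k))
  e-upper (suc t) A k = ⪯-trans (⪯-⊕ (proj₁ (e-cauchy (suc (suc t)) A k)) (V≤e t (suc A) (suc k)))
    (proj₁ (e-sum (suc t) A k))

module OddLimits where
  open Odd

  T₀-q : ∀ k s c → c ≤ s → ∀ n → T (symbol 0 (suc k) s c) n ≡ shift s (geo (k + 1 * suc k) q) n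
  T₀-q k s c c≤s n = trans (T₀ k s c c≤s n) (shift-cong s (geo-cong (k + 1 * suc k) Odd-total) n)

  T₀-upper : ∀ k s c → c ≤ s → (2 * suc k) · T (symbol 0 (suc k) s c) ⪯ S
  T₀-upper k s c c≤s = ≤S⇒⪯S (2 * suc k) λ n →
    subst (λ z → 2 * suc k * z ≤ S n + 2 * suc k * q n) (sym (T₀-q k s c c≤s n))
      (progression-upper (k + 1 * suc k) s n)

  T₀-lower : ∀ k s c → c ≤ s → S ⪯ (2 * suc k) · T (symbol 0 (suc k) s c)
  T₀-lower k s c c≤s = S≤⇒S⪯ s λ n →
    subst (λ z → S n ≤ 2 * suc k * z + s * q n) (sym (T₀-q k s c c≤s n))
      (progression-lower (k + 1 * suc k) s n)

  -- The window with `suc A` missing is the difference of two windows with `A` missing, so induction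
  -- on `A` ends at `T₀`, whatever the number of copies.
  T-limit : ∀ A k s c s′ c′ → Valid (symbol A (suc k) s c) → Valid (symbol A (suc k) s′ c′) →
    T (symbol A (suc k) s c) ⪯ T (symbol A (suc k) s′ c′)
  T-limit zero    k s c s′ c′ (valid _ v) (valid _ v′) =
    ⪯-unscale (k + 1 * suc k) (⪯-trans (T₀-upper k s c v) (T₀-lower k s′ c′ v′))
  T-limit (suc A) k s c s′ c′ v v′ = ⪯-cancel
    (≗-⪯ (λ n → sym (Odd-split σ (unwiden v) n)) (λ n → sym (Odd-split σ′ (unwiden v′) n))
      (T-limit A k s c s′ c′ (unwiden v) (unwiden v′)))
    (T-limit A (suc k) _ c′ _ c (Odd-valid A (suc k) s′ c′) (Odd-valid A (suc k) s c))
    where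
    σ = symbol A (suc k) s c
    σ′ = symbol A (suc k) s′ c′

  opaque
    V : ℕ → ℕ → Seq
    V A k = T (symbol A (suc k) A 0)

    T≍V : ∀ A k s c → Valid (symbol A (suc k) s c) → T (symbol A (suc k) s c) ≍ V A k
    T≍V A k s c v = T-limit A k s c A 0 v (canonical A k) , T-limit A k A 0 s c (canonical A k) v

    V₀ : ∀ k → (2 * suc k) · V 0 k ≍ S
    V₀ k = T₀-upper k 0 0 z≤n , T₀-lower k 0 0 z≤n

  V-split : ∀ A k → V A k ≍ V (suc A) k ⊕ V A (suc k)
  V-split A k = ≍-trans (let p , p′ = T≍V A k (suc A) 0 (canonical⁺ A k) in p′ , p)
    (≗-≍ (Odd-split (symbol A (suc k) (suc A) 0) (canonical⁺ A k)) (λ _ → refl)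
      (≍-⊕ (T≍V (suc A) k (suc A) 0 (canonical (suc A) k))
           (T≍V A (suc k) _ 0 (Odd-valid A (suc k) (suc A) 0))))

  e : ℕ → ℕ → ℕ → Seq
  e t A k n = ∑ᴸ (oddPatterns t) (λ σ → V (Symbol.missing σ + A) (Symbol.copies σ + k) n)

  e₀ : ∀ A k → e 0 A k ≗ V A k
  e₀ A k n = +-identityʳ _

  e₁ : ∀ A k → e 1 A k ≗ V A k ⊕ V A (suc k)
  e₁ A k n = cong (V A k n +_) (+-identityʳ _)

  e₂ : ∀ t A k → e (suc (suc t)) A k ≗ e (suc t) A (suc k) ⊕ e t (suc A) k
  e₂ t A k n = trans (∑ᴸ-++ (map insert (oddPatterns (suc t))) _ _) (cong₂ _+_
    (trans (∑ᴸ-map insert (oddPatterns (suc t)) _)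
      (∑ᴸ-cong (oddPatterns (suc t)) λ σ →
        cong (λ z → V (Symbol.missing σ + A) z n) (sym (+-suc (Symbol.copies σ) k))))
    (trans (∑ᴸ-map widen (oddPatterns t) _)
      (∑ᴸ-cong (oddPatterns t) λ σ →
        cong (λ z → V z (Symbol.copies σ + k) n) (sym (+-suc (Symbol.missing σ) A)))))

  e-cauchy : ∀ t A k → e t A k ≍ e t A k
  e-cauchy t A k = ∑ᴸ-≍ (oddPatterns t) (λ σ → ≍-refl (V-split _ _))

  e-split : ∀ t A k → e t A k ≍ e t (suc A) k ⊕ e t A (suc k)
  e-split t A k = ≍-trans (∑ᴸ-≍ (oddPatterns t) (λ σ → V-split (Symbol.missing σ + A) (Symbol.copies σ + k)))
    (≗-≍ (λ n → trans (∑ᴸ-⊕ (oddPatterns t) _ _) (cong₂ _+_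
        (∑ᴸ-cong (oddPatterns t) λ σ →
          cong (λ z → V z (Symbol.copies σ + k) n) (sym (+-suc (Symbol.missing σ) A)))
        (∑ᴸ-cong (oddPatterns t) λ σ →
          cong (λ z → V (Symbol.missing σ + A) z n) (sym (+-suc (Symbol.copies σ) k)))))
      (λ _ → refl) (≍-⊕ (e-cauchy t (suc A) k) (e-cauchy t A (suc k))))

  V-cauchy : ∀ A k → V A k ≍ V A k
  V-cauchy A k = ≍-refl (V-split A k)

  -- `V A k` now plays the role of x^k (1 - x)^A / 2. From E_(t+2) = x E_(t+1) + (1 - x) E_t it
  -- follows that E_(t+1) + (1 - x) E_t is constant in t, and at t = 0 it is (1 + x) + (1 - x) = 2.
  e-sum : ∀ t A k → e (suc t) A k ⊕ e t (suc A) k ≍ V A k ⊕ V A k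
  e-sum zero    A k = ≗-≍
    (λ n → trans (cong₂ _+_ (e₁ A k n) (e₀ (suc A) k n)) (arith (V A k n) (V A (suc k) n) _)) (λ _ → refl)
    (≍-⊕ (V-cauchy A k) (let p , p′ = V-split A k in p′ , p))
    where
    arith : ∀ a b c → (a + b) + c ≡ a + (c + b)
    arith = solve-∀
  e-sum (suc t) A k = ≍-trans
    (≗-≍ (λ n → trans (cong (_+ e (suc t) (suc A) k n) (e₂ t A k n))
              (arith (e (suc t) A (suc k) n) (e t (suc A) k n) _)) (λ _ → refl)
      (≍-⊕ (let p , p′ = e-split (suc t) A k in p′ , p) (e-cauchy t (suc A) k)))
    (e-sum t A k)
    where
    arith : ∀ a b c → (a + b) + c ≡ (c + a) + b
    arith = solve-∀

  -- The bounds 1 ≤ E_t ≤ 1 + x feed each other through E_(t+1) = 2 - (1 - x) E_t: the upper one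
  -- gives E_(t+1) ≥ 1 + x² ≥ 1, the lower one gives E_(t+1) ≤ 1 + x.
  V≤e : ∀ t A k → V A k ⪯ e t A k
  e≤V : ∀ t A k → e t A k ⪯ V A k ⊕ V A (suc k)

  V≤e zero    A k = ≗-⪯ (λ _ → refl) (e₀ A k) (proj₁ (V-cauchy A k))
  V≤e (suc t) A k = ⪯-cancel (proj₂ (e-sum t A k))
    (⪯-trans (e≤V t (suc A) k) (⪯-trans
      (⪯-⊕ (proj₁ (V-cauchy (suc A) k)) (≤⇒⪯ (proj₁ (V-cauchy (suc A) (suc k))) (λ n → m≤m+n _ _)))
      (⪯-trans (⪯-⊕ (proj₁ (V-cauchy (suc A) k)) (proj₂ (V-split A (suc k)))) (proj₂ (V-split A k)))))

  e≤V zero    A k = ≤⇒⪯ (≗-⪯ (e₀ A k) (λ _ → refl) (proj₁ (V-cauchy A k))) (λ n → m≤m+n _ _)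
  e≤V (suc t) A k = ⪯-cancel {w = e t (suc A) k} {w′ = V (suc A) k}
    (⪯-trans (proj₁ (e-sum t A k)) (≗-⪯ (λ _ → refl)
      (λ n → arith (V A k n) (V A (suc k) n) (V (suc A) k n))
      (⪯-⊕ (proj₁ (V-cauchy A k)) (proj₁ (V-split A k)))))
    (V≤e t (suc A) k)
    where
    arith : ∀ a b c → (a + b) + c ≡ a + (c + b)
    arith = solve-∀

  -- Keeps the sharper bound E_(t+1) ≥ 1 + x²; half its integral is 2/3.
  e-lower : ∀ t → V 0 0 ⊕ V 0 2 ⪯ e (suc t) 0 0
  e-lower t = ⪯-cancel {w = V 1 0 ⊕ V 1 1} {w′ = e t 1 0}
    (⪯-trans (≗-⪯ (λ n → arith (V 0 0 n) (V 0 2 n) (V 1 0 n) (V 1 1 n)) (λ _ → refl)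
        (⪯-⊕ (proj₁ (V-cauchy 0 0))
          (⪯-trans (⪯-⊕ (proj₁ (V-cauchy 1 0)) (proj₂ (V-split 0 1))) (proj₂ (V-split 0 0)))))
      (proj₂ (e-sum t 0 0)))
    (e≤V t 1 0)
    where
    arith : ∀ a b c d → (a + b) + (c + d) ≡ a + (c + (d + b))
    arith = solve-∀

-- Bounds for the limits

≍-· : ∀ c {u v} → u ≍ v → c · u ≍ c · v
≍-· c (p , p′) = ⪯-· c p , ⪯-· c p′

module DistinctBounds where
  open DistinctLimits

  V-cauchy : ∀ A k → V A k ≍ V A k
  V-cauchy A k = ≍-refl (V-split A k)

  -- With V A k in the role of x^(k+1) / (1 + x)^A, this is x^(i+1) p(x) / (1 + x)^A.
  poly : ℕ → ℕ → List ℕ → Seq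
  poly A i []      = 𝟎
  poly A i (c ∷ p) = c · V A i ⊕ poly A (suc i) p

  -- The coefficients of c + (1 + x) p(x).
  raise : ℕ → List ℕ → List ℕ
  raise c []      = c ∷ []
  raise c (a ∷ p) = (c + a) ∷ raise a p

  raises : ℕ → List ℕ → List ℕ
  raises zero    p = p
  raises (suc j) p = raise 0 (raises j p)

  add : List ℕ → List ℕ → List ℕ
  add []      r       = r
  add (a ∷ p) []      = a ∷ p
  add (a ∷ p) (b ∷ r) = (a + b) ∷ add p r

  poly-cauchy : ∀ A i p → poly A i p ≍ poly A i p
  poly-cauchy A i []      = 𝟎⪯𝟎 , 𝟎⪯𝟎
  poly-cauchy A i (c ∷ p) = ≍-⊕ (≍-· c (V-cauchy A i)) (poly-cauchy A (suc i) p)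

  poly-raise : ∀ A i c p → c · V (suc A) i ⊕ poly A i p ≍ poly (suc A) i (raise c p)
  poly-raise A i c []      = ≍-⊕ (≍-· c (V-cauchy (suc A) i)) (𝟎⪯𝟎 , 𝟎⪯𝟎)
  poly-raise A i c (a ∷ p) = ≍-trans
    (≍-⊕ (≍-· c (V-cauchy (suc A) i)) (≍-⊕ (≍-· a (V-split A i)) (poly-cauchy A (suc i) p)))
    (≗-≍ (λ n → arith c a (V (suc A) i n) (V (suc A) (suc i) n) (poly A (suc i) p n)) (λ _ → refl)
      (≍-⊕ (≍-· (c + a) (V-cauchy (suc A) i)) (poly-raise A (suc i) a p)))
    where
    arith : ∀ c a x y z → c * x + (a * (x + y) + z) ≡ (c + a) * x + (a * y + z)
    arith = solve-∀

  poly-raises : ∀ A j p → poly A 0 p ≍ poly (j + A) 0 (raises j p)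
  poly-raises A zero    p = poly-cauchy A 0 p
  poly-raises A (suc j) p = ≍-trans (poly-raises A j p) (poly-raise (j + A) 0 0 (raises j p))

  poly-add : ∀ A i p r → poly A i (add p r) ≗ poly A i p ⊕ poly A i r
  poly-add A i []      r       n = refl
  poly-add A i (a ∷ p) []      n = sym (+-identityʳ _)
  poly-add A i (a ∷ p) (b ∷ r) n = trans
    (cong₂ _+_ (*-distribʳ-+ (V A i n) a b) (poly-add A (suc i) p r n))
    (+-exchange (a * V A i n) (b * V A i n) _ _)

  poly-≤ : ∀ A i {p r} → Prefix _≤_ p r → ∀ n → poly A i p n ≤ poly A i r n
  poly-≤ A i []       n = z≤n
  poly-≤ A i (a ∷ as) n = +-mono-≤ (*-monoˡ-≤ (V A i n) a) (poly-≤ A (suc i) as n)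

  -- Over a common denominator (1 + x)^A, an inequality for x ≥ 0 follows once the coefficients of
  -- the numerators compare one by one, which is decidable. Extra factors 1 + x help as in Pólya's
  -- theorem; A = 10 and A = 4 suffice below.
  poly-compare : ∀ A p p′ r r′ {u u′ v v′} →
    u ⪯ poly A 0 p → u′ ⪯ poly A 0 p′ → poly A 0 r ⪯ v → poly A 0 r′ ⪯ v′ →
    True (prefix? _≤?_ (add p p′) (add r r′)) → (u ⊕ u′) ⪯ (v ⊕ v′)
  poly-compare A p p′ r r′ hu hu′ hv hv′ h = ⪯-trans (⪯-⊕ hu hu′)
    (≤-⪯ (λ n → subst₂ _≤_ (poly-add A 0 p p′ n) (poly-add A 0 r r′ n) (poly-≤ A 0 (toWitness h) n)) (⪯-⊕ hv hv′))

  -- x / (1 + x) ≤ x² / (1 + x)³ + x (1 − 7x/6 + 7x²/10) for x ≥ 0, and the integral of the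
  -- last bracket over [0, 1] is 39/60.
  upper-certificate : 60 · V 1 0 ⊕ 70 · V 0 1 ⪯ 60 · V 3 1 ⊕ (60 · V 0 0 ⊕ 42 · V 0 2)
  upper-certificate = ≗-⪯
    (λ n → lhs (V 1 0 n) (V 0 0 n) (V 0 1 n)) (λ n → rhs (V 3 0 n) (V 3 1 n) (V 0 0 n) (V 0 1 n) (V 0 2 n))
    compared
    where
    compared : poly 1 0 (60 ∷ []) ⊕ poly 0 0 (0 ∷ 70 ∷ []) ⪯ poly 3 0 (0 ∷ 60 ∷ []) ⊕ poly 0 0 (60 ∷ 0 ∷ 42 ∷ [])
    compared = poly-compare 10
      (raises 9 (60 ∷ [])) (raises 10 (0 ∷ 70 ∷ [])) (raises 7 (0 ∷ 60 ∷ [])) (raises 10 (60 ∷ 0 ∷ 42 ∷ []))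
      (proj₁ (poly-raises 1 9 (60 ∷ []))) (proj₁ (poly-raises 0 10 (0 ∷ 70 ∷ [])))
      (proj₂ (poly-raises 3 7 (0 ∷ 60 ∷ []))) (proj₂ (poly-raises 0 10 (60 ∷ 0 ∷ 42 ∷ [])))
      tt
    lhs : ∀ x y z → 60 * x + 70 * z ≡ (60 * x + 0) + (0 * y + (70 * z + 0))
    lhs = solve-∀
    rhs : ∀ a b x y z → 60 * b + (60 * x + 42 * z) ≡ (0 * a + (60 * b + 0)) + (60 * x + (0 * y + (42 * z + 0)))
    rhs = solve-∀

  -- x (3 − 2x) ≤ 10 x / (1 + x)² for x ≥ 0.
  lower-certificate : 3 · V 0 0 ⪯ 10 · V 2 0 ⊕ 2 · V 0 1
  lower-certificate = ≗-⪯
    (λ n → lhs (V 0 0 n)) (λ n → rhs (V 2 0 n) (V 0 0 n) (V 0 1 n))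
    (poly-compare 4 (raises 4 (3 ∷ [])) (raises 4 []) (raises 2 (10 ∷ [])) (raises 4 (0 ∷ 2 ∷ []))
      (proj₁ (poly-raises 0 4 (3 ∷ []))) (proj₁ (poly-raises 0 4 []))
      (proj₂ (poly-raises 2 2 (10 ∷ []))) (proj₂ (poly-raises 0 4 (0 ∷ 2 ∷ [])))
      tt)
    where
    lhs : ∀ x → 3 * x ≡ (3 * x + 0) + 0
    lhs = solve-∀
    rhs : ∀ x y z → 10 * x + 2 * z ≡ (10 * x + 0) + (0 * y + (2 * z + 0))
    rhs = solve-∀

  multiple : ∀ j k → (j * suc k) · V 0 k ≍ j · S
  multiple j k = ≗-≍ (λ n → *-assoc j (suc k) (V 0 k n)) (λ _ → refl) (≍-· j (V₀ k))

  V₁-upper : 60 · V 1 0 ⪯ 60 · V 3 1 ⊕ 39 · S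
  -- The limits of the `V 0 k` turn 70, 60 and 42 into 70/2 = 35, 60 and 42/3 = 14, and 60 + 14 - 35
  -- = 39.
  V₁-upper = ⪯-cancel {w = 35 · S} {w′ = 35 · S}
    (⪯-trans (⪯-⊕ (⪯-· 60 (proj₁ (V-cauchy 1 0))) (proj₂ (multiple 35 1)))
      (⪯-trans upper-certificate (≗-⪯ (λ _ → refl) (λ n → arith (V 3 1 n) (S n))
        (⪯-⊕ (⪯-· 60 (proj₁ (V-cauchy 3 1))) (⪯-⊕ (proj₁ (multiple 60 0)) (proj₁ (multiple 14 2)))))))
    (⪯-· 35 S⪯S)
    where
    arith : ∀ x s → (60 * x + 39 * s) + 35 * s ≡ 60 * x + (60 * s + 14 * s)
    arith = solve-∀

  -- Serves to keep b_h/S away from 0, so the crude 1/5 will do for the integral of 1/(1 + x)²,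
  -- which is 1/2.
  V₂-lower : S ⪯ 5 · V 2 0
  V₂-lower = ⪯-unscale 1 (⪯-cancel {w = S} {w′ = S}
    (⪯-trans (≗-⪯ (λ n → arith (S n)) (λ _ → refl) (proj₂ (multiple 3 0)))
      (⪯-trans lower-certificate (≗-⪯ (λ _ → refl) (λ n → arith′ (V 2 0 n) (S n))
        (⪯-⊕ (⪯-· 10 (proj₁ (V-cauchy 2 0))) (proj₁ (multiple 1 1))))))
    S⪯S)
    where
    arith : ∀ s → 2 * s + s ≡ 3 * s
    arith = solve-∀
    arith′ : ∀ x s → 2 * (5 * x) + s ≡ 10 * x + 1 * s
    arith′ = solve-∀

  60e⪯39S : ∀ t → 60 · e (suc t) 1 0 ⪯ 39 · S
  60e⪯39S t = ⪯-cancel {w = 60 · V 3 1} {w′ = 60 · V 3 1}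
    (⪯-trans (≗-⪯ (λ n → sym (distribute 60 (e (suc t) 1 0) (V 3 1) n)) (λ _ → refl) (⪯-· 60 (e-upper t 1 0)))
      (≤⇒⪯ V₁-upper (λ n → ≤-reflexive (+-comm (60 * V 3 1 n) (39 * S n)))))
    (⪯-· 60 (proj₁ (V-cauchy 3 1)))

  S⪯5e : ∀ t → S ⪯ 5 · e (suc t) 1 0
  S⪯5e t = ⪯-trans V₂-lower (⪯-· 5 (V≤e t 1 0))

  hooks : ℕ → Seq
  hooks t n = ∑ᴸ (distinctPatterns t) (λ σ → Distinct.T (widen (Distinct.insert σ)) n)

  hooks≍e : ∀ t → hooks t ≍ e t 1 0
  hooks≍e t = ≗-≍ (λ _ → refl) (λ n → ∑ᴸ-cong (distinctPatterns t) λ σ →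
      cong₂ (λ y z → V y z n) (+-comm (Symbol.missing σ) 1) (+-identityʳ (Symbol.copies σ)))
    (∑ᴸ-≍ (distinctPatterns t) λ { (symbol A k s c) → T≍V (suc A) k _ c (Distinct-valid A k s c) })

module OddBounds where
  open OddLimits

  multiple : ∀ j k → (j * (2 * suc k)) · V 0 k ≍ j · S
  multiple j k = ≗-≍ (λ n → *-assoc j (2 * suc k) (V 0 k n)) (λ _ → refl) (≍-· j (V₀ k))

  4S⪯6e : ∀ t → 4 · S ⪯ 6 · e (suc t) 0 0
  4S⪯6e t = ⪯-trans (≗-⪯ (λ n → arith (S n)) (λ n → distribute 6 (V 0 0) (V 0 2) n)
      (⪯-⊕ (proj₂ (multiple 3 0)) (proj₂ (multiple 1 2))))
    (⪯-· 6 (e-lower t))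
    where
    arith : ∀ s → 4 * s ≡ 3 * s + 1 * s
    arith = solve-∀

  e-upper : ∀ t → e t 0 0 ⪯ S
  e-upper t = ⪯-unscale 3 (⪯-trans (⪯-· 4 (e≤V t 0 0))
    (≗-⪯ (λ n → distribute 4 (V 0 0) (V 0 1) n) (λ _ → refl)
      (≤⇒⪯ (⪯-⊕ (proj₁ (multiple 2 0)) (proj₁ (multiple 1 1))) (λ n → ≤-trans (≤-reflexive (arith (S n))) (*-monoˡ-≤ (S n) (n≤1+n 3))))))
    where
    arith : ∀ s → 2 * s + 1 * s ≡ 3 * s
    arith = solve-∀

  hooks : ℕ → Seq
  hooks t n = ∑ᴸ (oddPatterns t) (λ σ → Odd.T (Odd.insert σ) n)

  hooks≍e : ∀ t → hooks t ≍ e t 0 0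
  hooks≍e t = ≗-≍ (λ _ → refl) (λ n → ∑ᴸ-cong (oddPatterns t) λ σ →
      cong₂ (λ y z → V y z n) (+-identityʳ (Symbol.missing σ)) (+-identityʳ (Symbol.copies σ)))
    (∑ᴸ-≍ (oddPatterns t) λ { (symbol A k s c) → T≍V A k _ c (Odd-valid A k s c) })

-- Hook numbers

count : ∀ {X : Set} {P : X → Set} → Decidable P → List X → ℕ
count P? xs = length (filter P? xs)

module _ {X : Set} {P : X → Set} (P? : Decidable P) where
  count-++ : ∀ xs ys → count P? (xs ++ ys) ≡ count P? xs + count P? ys
  count-++ xs ys = trans (cong length (filter-++ P? xs ys)) (length-++ (filter P? xs))

  count-none : (∀ x → ¬ P x) → ∀ xs → count P? xs ≡ 0
  count-none h []       = refl
  count-none h (x ∷ xs) with P? x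
  ... | yes p = ⊥-elim (h x p)
  ... | no  _ = count-none h xs

  count-map : ∀ {Y : Set} {Q : Y → Set} (Q? : Decidable Q) (f : Y → X) →
    (∀ y → P (f y) → Q y) → (∀ y → Q y → P (f y)) → ∀ ys → count P? (map f ys) ≡ count Q? ys
  count-map Q? f to from []       = refl
  count-map Q? f to from (y ∷ ys) with P? (f y) | Q? y
  ... | yes p | yes r = cong suc (count-map Q? f to from ys)
  ... | no ¬p | no ¬r = count-map Q? f to from ys
  ... | yes p | no ¬r = ⊥-elim (¬r (to y p))
  ... | no ¬p | yes r = ⊥-elim (¬p (from y r))

never? : ∀ {X : Set} → Decidable {A = X} (λ _ → ⊥)
never? _ = no λ ()

same below : ℕ → ℕ → ℕ
same zero    zero    = 1
same zero    (suc h) = 0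
same (suc x) zero    = 0
same (suc x) (suc h) = same x h
below j       zero    = 0
below zero    (suc v) = 1
below (suc j) (suc v) = below j v

upTo-suc : ∀ n → upTo (suc n) ≡ 0 ∷ map suc (upTo n)
upTo-suc n = cong (0 ∷_) (sym (map-upTo suc n))

count-≤-upTo : ∀ j p → count (j ≤?_) (upTo p) ≡ p ∸ j
count-≤-upTo zero    zero    = refl
count-≤-upTo (suc j) zero    = refl
count-≤-upTo zero    (suc p) = trans (cong (count (0 ≤?_)) (upTo-suc p))
  (cong suc (trans (count-map (0 ≤?_) (0 ≤?_) suc (λ _ _ → z≤n) (λ _ _ → z≤n) (upTo p)) (count-≤-upTo zero p)))
count-≤-upTo (suc j) (suc p) = trans (cong (count (suc j ≤?_)) (upTo-suc p))
  (trans (count-map (suc j ≤?_) (j ≤?_) suc (λ _ → s≤s⁻¹) (λ _ → s≤s) (upTo p)) (count-≤-upTo j p))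

count-≡-upTo : ∀ j v → count (_≟ j) (upTo v) ≡ below j v
count-≡-upTo j       zero    = refl
count-≡-upTo zero    (suc v) = trans (cong (count (_≟ 0)) (upTo-suc v))
  (cong suc (trans (count-map (_≟ 0) never? suc (λ _ ()) (λ _ ()) (upTo v))
    (count-none never? (λ _ ()) (upTo v))))
count-≡-upTo (suc j) (suc v) = trans (cong (count (_≟ suc j)) (upTo-suc v))
  (trans (count-map (_≟ suc j) (_≟ j) suc (λ _ → suc-injective) (λ _ → cong suc) (upTo v)) (count-≡-upTo j v))

multiplicity-upTo : ∀ h (F : ℕ → ℕ) p → multiplicity h (map F (upTo p)) ≡ ∑ p (λ j → same (F j) h)
multiplicity-upTo h F zero    = refl
multiplicity-upTo h F (suc p) = begin
  multiplicity h (map F (upTo (suc p)))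
    ≡⟨ cong (multiplicity h ∘ map F) (upTo-suc p) ⟩
  multiplicity h (F 0 ∷ map F (map suc (upTo p)))
    ≡⟨ cong (λ z → multiplicity h (F 0 ∷ z)) (sym (map-∘ (upTo p))) ⟩
  multiplicity h (F 0 ∷ map (F ∘ suc) (upTo p))
    ≡⟨ first (F 0) (map (F ∘ suc) (upTo p)) ⟩
  same (F 0) h + multiplicity h (map (F ∘ suc) (upTo p))
    ≡⟨ cong (same (F 0) h +_) (multiplicity-upTo h (F ∘ suc) p) ⟩
  same (F 0) h + ∑ p (λ j → same (F (suc j)) h)
    ≡⟨ sym (∑-head p (λ j → same (F j) h)) ⟩
  ∑ (suc p) (λ j → same (F j) h) ∎
  where
  open ≡-Reasoning
  same-yes : ∀ x → same x x ≡ 1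
  same-yes zero    = refl
  same-yes (suc x) = same-yes x
  same-no : ∀ x y → x ≢ y → same x y ≡ 0
  same-no zero    zero    n = ⊥-elim (n refl)
  same-no zero    (suc y) n = refl
  same-no (suc x) zero    n = refl
  same-no (suc x) (suc y) n = same-no x y (n ∘ cong suc)
  first : ∀ x xs → multiplicity h (x ∷ xs) ≡ same x h + multiplicity h xs
  first x xs with x ≟ h
  ... | yes refl = trans (cong length (filter-accept (_≟ x) {x} {xs} refl))
                     (cong (_+ multiplicity x xs) (sym (same-yes x)))
  ... | no  x≢h  = trans (cong length (filter-reject (_≟ h) {x} {xs} x≢h))
                     (cong (_+ multiplicity h xs) (sym (same-no x h x≢h)))

leg : ℕ → List ℕ → ℕ
leg j []      = 0
leg j (v ∷ μ) = below j v + leg j μ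

-- The number of columns j < r such that the hook number in column j of a row of length r,
-- placed above the rows of μ, is x.
rowHooks : ℕ → ℕ → List ℕ → ℕ
rowHooks x r μ = ∑ r (λ j → same ((r ∸ j) + leg j μ) x)

hookCount : ℕ → List ℕ → ℕ
hookCount h λs = multiplicity h (ℋ λs)

firstRow : ℕ → List Box
firstRow p = map (λ j → 0 , j) (upTo p)

nextRow : Box → Box
nextRow (i , j) = suc i , j

boxes-∷ : ∀ p μ → boxes (p ∷ μ) ≡ firstRow p ++ map nextRow (boxes μ)
boxes-∷ p μ = cong (firstRow p ++_) (begin
  concatMap row (tabulate Fin.suc)
    ≡⟨ cong (concatMap row) (sym (map-tabulate id Fin.suc)) ⟩
  concatMap row (map Fin.suc (allFin (length μ)))
    ≡⟨ concatMap-map row Fin.suc (allFin (length μ)) ⟩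
  concatMap (row ∘ Fin.suc) (allFin (length μ))
    ≡⟨ concatMap-cong (λ i → map-∘ (upTo (lookup μ i))) (allFin (length μ)) ⟩
  concatMap (map nextRow ∘ row′) (allFin (length μ))
    ≡⟨ sym (map-concatMap nextRow row′ (allFin (length μ))) ⟩
  map nextRow (boxes μ) ∎)
  where
  open ≡-Reasoning
  row = λ i → map (λ j → toℕ i , j) (upTo (lookup (p ∷ μ) i))
  row′ = λ i → map (λ j → toℕ i , j) (upTo (lookup μ i))

column : ∀ j μ → count (λ x → proj₂ x ≟ j) (boxes μ) ≡ leg j μ
column j []      = refl
column j (v ∷ μ) = trans (cong (count (λ x → proj₂ x ≟ j)) (boxes-∷ v μ))
  (trans (count-++ (λ x → proj₂ x ≟ j) (firstRow v) (map nextRow (boxes μ))) (cong₂ _+_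
    (trans (count-map (λ x → proj₂ x ≟ j) (_≟ j) (λ j → 0 , j) (λ _ e → e) (λ _ e → e) (upTo v)) (count-≡-upTo j v))
    (trans (count-map (λ x → proj₂ x ≟ j) (λ x → proj₂ x ≟ j) nextRow (λ _ e → e) (λ _ e → e) (boxes μ)) (column j μ))))

hookNumber-firstRow : ∀ p μ j → hookNumber (p ∷ μ) (0 , j) ≡ (p ∸ j) + leg j μ
hookNumber-firstRow p μ j = trans (cong (count (inHook? (0 , j))) (boxes-∷ p μ))
  (trans (count-++ (inHook? (0 , j)) (firstRow p) (map nextRow (boxes μ))) (cong₂ _+_
    (trans (count-map (inHook? (0 , j)) (j ≤?_) (λ j → 0 , j) (λ { _ (inj₁ (_ , j≤)) → j≤ }) (λ _ j≤ → inj₁ (refl , j≤)) (upTo p))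
      (count-≤-upTo j p))
    (trans (count-map (inHook? (0 , j)) (λ x → proj₂ x ≟ j) nextRow
        (λ { _ (inj₂ (_ , e)) → e }) (λ _ e → inj₂ (z<s , e)) (boxes μ))
      (column j μ))))

hookNumber-nextRow : ∀ p μ x → hookNumber (p ∷ μ) (nextRow x) ≡ hookNumber μ x
hookNumber-nextRow p μ x = trans (cong (count (inHook? (nextRow x))) (boxes-∷ p μ))
  (trans (count-++ (inHook? (nextRow x)) (firstRow p) (map nextRow (boxes μ))) (cong₂ _+_
    (trans (count-map (inHook? (nextRow x)) never? (λ j → 0 , j)
        (λ { _ (inj₁ (() , _)) ; _ (inj₂ (() , _)) }) (λ _ ()) (upTo p))
      (count-none never? (λ _ ()) (upTo p)))
    (count-map (inHook? (nextRow x)) (inHook? x) nextRow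
      (λ { _ (inj₁ (e , q)) → inj₁ (suc-injective e , q) ; _ (inj₂ (l , e)) → inj₂ (s≤s⁻¹ l , e) })
      (λ { _ (inj₁ (e , q)) → inj₁ (cong suc e , q) ; _ (inj₂ (l , e)) → inj₂ (s≤s l , e) }) (boxes μ))))

-- Hooks extend right and down, so a row put on top changes no hook number below it.
hookCount-∷ : ∀ h p μ → hookCount h (p ∷ μ) ≡ rowHooks h p μ + hookCount h μ
hookCount-∷ h p μ = begin
  multiplicity h (map hook (boxes (p ∷ μ)))
    ≡⟨ cong (multiplicity h ∘ map hook) (boxes-∷ p μ) ⟩
  multiplicity h (map hook (firstRow p ++ map nextRow (boxes μ)))
    ≡⟨ cong (multiplicity h) (map-++ hook (firstRow p) _) ⟩
  multiplicity h (map hook (firstRow p) ++ map hook (map nextRow (boxes μ)))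
    ≡⟨ count-++ (_≟ h) (map hook (firstRow p)) _ ⟩
  multiplicity h (map hook (firstRow p)) + multiplicity h (map hook (map nextRow (boxes μ)))
    ≡⟨ cong₂ (λ y z → multiplicity h y + multiplicity h z)
         (trans (sym (map-∘ (upTo p))) (map-cong (hookNumber-firstRow p μ) (upTo p)))
         (trans (sym (map-∘ (boxes μ))) (map-cong (hookNumber-nextRow p μ) (boxes μ))) ⟩
  multiplicity h (map (λ j → (p ∸ j) + leg j μ) (upTo p)) + hookCount h μ
    ≡⟨ cong (_+ hookCount h μ) (multiplicity-upTo h _ p) ⟩
  rowHooks h p μ + hookCount h μ ∎
  where
  open ≡-Reasoning
  hook = hookNumber (p ∷ μ)

∸-suc : ∀ {j r} → j < r → r ∸ j ≡ suc (r ∸ suc j)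
∸-suc p = +-∸-assoc 1 p

rowHooks-0 : ∀ r μ → rowHooks 0 r μ ≡ 0
rowHooks-0 r μ = ∑-zero r (λ j p → cong (λ z → same (z + leg j μ) 0) (∸-suc p))

below-≥ : ∀ {j v} → v ≤ j → below j v ≡ 0
below-≥ {j}     {zero}  p       = refl
below-≥ {suc j} {suc v} (s≤s p) = below-≥ p

below-< : ∀ {j v} → j < v → below j v ≡ 1
below-< {zero}  {suc v} p       = refl
below-< {suc j} {suc v} (s≤s p) = below-< p

leg-bounded : ∀ {j μ} → All (_≤ j) μ → leg j μ ≡ 0
leg-bounded []       = refl
leg-bounded (p ∷ ps) = cong₂ _+_ (below-≥ p) (leg-bounded ps)

-- No row of μ reaches the last column, so its box has hook number 1 and deleting it lowers the
-- other hook numbers of the row by one.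
rowHooks-column : ∀ x r μ → All (_≤ r) μ → rowHooks (suc x) (suc r) μ ≡ rowHooks x r μ + same 0 x
rowHooks-column x r μ b = cong₂ _+_
  (∑-cong r (λ j p → cong (λ z → same (z + leg j μ) (suc x)) (+-∸-assoc 1 (<⇒≤ p))))
  (cong₂ (λ y z → same (y + z) (suc x)) (m+n∸n≡m 1 r) (leg-bounded b))

-- A row at least as long directly below adds one box to the leg of every column.
rowHooks-row : ∀ x r v μ → r ≤ v → rowHooks (suc x) r (v ∷ μ) ≡ rowHooks x r μ
rowHooks-row x r v μ r≤v = ∑-cong r λ j p → cong (λ z → same z (suc x))
  (trans (cong (λ z → (r ∸ j) + (z + leg j μ)) (below-< (<-≤-trans p r≤v))) (+-suc (r ∸ j) (leg j μ)))

-- Sums over partitions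

partitionsUpTo-fuel : ∀ f g m n → n ≤ f → n ≤ g → partitionsUpTo f m n ≡ partitionsUpTo g m n
partitionsUpTo-fuel f       g       m zero    p       r       = refl
partitionsUpTo-fuel (suc f) (suc g) m (suc n) (s≤s p) (s≤s r) = concatMap-cong
  (λ i → cong (map (suc i ∷_)) (partitionsUpTo-fuel f g (suc i) (n ∸ i)
    (≤-trans (m∸n≤m n i) p) (≤-trans (m∸n≤m n i) r)))
  (upTo (m ⊓ suc n))

partitionsBelow : ℕ → ℕ → List (List ℕ)
partitionsBelow m n = partitionsUpTo n m n

partitionsBelow-stable : ∀ {m n} → n ≤ m → partitionsBelow m n ≡ partitions n
partitionsBelow-stable {m} {zero}  p = refl
partitionsBelow-stable {m} {suc n} p = cong
  (λ z → concatMap (λ i → map (suc i ∷_) (partitionsUpTo n (suc i) (n ∸ i))) (upTo z))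
  (trans (m≥n⇒m⊓n≡n p) (sym (⊓-idem (suc n))))

partitionsBelow-≤ : ∀ {m n} → m ≤ n → partitionsBelow (suc m) (suc n) ≡
  partitionsBelow m (suc n) ++ map (suc m ∷_) (partitionsBelow (suc m) (n ∸ m))
partitionsBelow-≤ {m} {n} m≤n = begin
  concatMap F (upTo (suc (m ⊓ n)))
    ≡⟨ cong (concatMap F) (trans (cong (upTo ∘ suc) (m≤n⇒m⊓n≡m m≤n)) (sym (upTo-∷ʳ m))) ⟩
  concatMap F (upTo m ++ [ m ])
    ≡⟨ concatMap-++ F (upTo m) [ m ] ⟩
  concatMap F (upTo m) ++ (F m ++ [])
    ≡⟨ cong₂ _++_ (cong (concatMap F ∘ upTo) (sym (m≤n⇒m⊓n≡m (m≤n⇒m≤1+n m≤n))))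
         (trans (++-identityʳ (F m)) (cong (map (suc m ∷_))
           (partitionsUpTo-fuel n (n ∸ m) (suc m) (n ∸ m) (m∸n≤m n m) ≤-refl))) ⟩
  concatMap F (upTo (m ⊓ suc n)) ++ map (suc m ∷_) (partitionsBelow (suc m) (n ∸ m)) ∎
  where
  open ≡-Reasoning
  F : ℕ → List (List ℕ)
  F i = map (suc i ∷_) (partitionsUpTo n (suc i) (n ∸ i))

partitionsBelow-> : ∀ {m n} → n ≤ m → partitionsBelow (suc m) n ≡ partitionsBelow m n
partitionsBelow-> p = trans (partitionsBelow-stable (m≤n⇒m≤1+n p)) (sym (partitionsBelow-stable p))

bounded-parts : ∀ f m n {λs} → λs ∈ partitionsUpTo f m n → All (_≤ m) λs
bounded-parts f       m zero    (here refl) = []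
bounded-parts (suc f) m (suc n) λs∈
  with i , i∈ , λs∈′ ← find (∈-concatMap⁻ _ {xs = upTo (m ⊓ suc n)} λs∈)
  with μs , μs∈ , refl ← ∈-map⁻ (suc i ∷_) λs∈′
  = i<m ∷ All.map (λ p → ≤-trans p i<m) (bounded-parts f (suc i) (n ∸ i) μs∈)
  where
  i<m = m≤n⊓o⇒m≤n m (suc n) (∈-upTo⁻ i∈)

partitionsBelow-bounded : ∀ m n → All (All (_≤ m)) (partitionsBelow m n)
partitionsBelow-bounded m n = All.tabulate (bounded-parts n m n)

shift-≥ : ∀ x u {n} → x ≤ n → shift x u n ≡ u (n ∸ x)
shift-≥ zero    u         p       = refl
shift-≥ (suc x) u {suc n} (s≤s p) = shift-≥ x u p

Statistic : Set
Statistic = List ℕ → ℕ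

module Sums {P : List ℕ → Set} (P? : Decidable P) where
  sumOver : Statistic → List (List ℕ) → ℕ
  sumOver g xs = sum (map g (filter P? xs))

  sumOver-++ : ∀ g xs ys → sumOver g (xs ++ ys) ≡ sumOver g xs + sumOver g ys
  sumOver-++ g xs ys = trans (cong (sum ∘ map g) (filter-++ P? xs ys))
    (trans (cong sum (map-++ g (filter P? xs) (filter P? ys))) (sum-++ (map g (filter P? xs)) _))

  sumOver-cong : ∀ {g g′ xs} → All (λ x → g x ≡ g′ x) xs → sumOver g xs ≡ sumOver g′ xs
  sumOver-cong []                    = refl
  sumOver-cong {xs = x ∷ xs} (e ∷ es) with P? x
  ... | yes _ = cong₂ _+_ e (sumOver-cong es)
  ... | no  _ = sumOver-cong es

  sumOver-⊕ : ∀ g g′ xs → sumOver (λ x → g x + g′ x) xs ≡ sumOver g xs + sumOver g′ xs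
  sumOver-⊕ g g′ []       = refl
  sumOver-⊕ g g′ (x ∷ xs) with P? x
  ... | yes _ = trans (cong (g x + g′ x +_) (sumOver-⊕ g g′ xs)) (+-exchange (g x) (g′ x) _ _)
  ... | no  _ = sumOver-⊕ g g′ xs

  sumOver-zero : ∀ {g xs} → All (λ x → P x → g x ≡ 0) xs → sumOver g xs ≡ 0
  sumOver-zero []                    = refl
  sumOver-zero {xs = x ∷ xs} (e ∷ es) with P? x
  ... | yes p = cong₂ _+_ (e p) (sumOver-zero es)
  ... | no  _ = sumOver-zero es

  sumOver-none : ∀ g (f : List ℕ → List ℕ) → (∀ x → ¬ P (f x)) → ∀ xs → sumOver g (map f xs) ≡ 0
  sumOver-none g f h []       = refl
  sumOver-none g f h (x ∷ xs) with P? (f x)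
  ... | yes p = ⊥-elim (h x p)
  ... | no  _ = sumOver-none g f h xs

  sumOver-map : ∀ g f {xs} → All (λ x → (P (f x) → P x) × (P x → P (f x))) xs →
    sumOver g (map f xs) ≡ sumOver (g ∘ f) xs
  sumOver-map g f []                         = refl
  sumOver-map g f {x ∷ xs} ((to , from) ∷ es) with P? (f x) | P? x
  ... | yes _  | yes _  = cong (g (f x) +_) (sumOver-map g f es)
  ... | no  _  | no  _  = sumOver-map g f es
  ... | yes p  | no  ¬p = ⊥-elim (¬p (to p))
  ... | no  ¬p | yes p  = ⊥-elim (¬p (from p))

  below-sum : ℕ → Statistic → Seq
  below-sum m g n = sumOver g (partitionsBelow m n)

  with-part : ℕ → Statistic → Seq
  with-part m g n = sumOver g (map (suc m ∷_) (partitionsBelow (suc m) n))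

  below-sum-suc : ∀ m g n → below-sum (suc m) g n ≡ below-sum m g n + shift (suc m) (with-part m g) n
  below-sum-suc m g zero    = sym (+-identityʳ _)
  below-sum-suc m g (suc n) with m ≤? n
  ... | yes m≤n = trans (cong (sumOver g) (partitionsBelow-≤ m≤n))
    (trans (sumOver-++ g (partitionsBelow m (suc n)) _)
      (cong (below-sum m g (suc n) +_) (sym (shift-≥ m (with-part m g) m≤n))))
  ... | no  m≰n = trans (cong (sumOver g) (partitionsBelow-> (≰⇒> m≰n)))
    (trans (sym (+-identityʳ _)) (cong (below-sum m g (suc n) +_) (sym (shift-vanish (with-part m g) (≰⇒> m≰n)))))

  below-sum-cong : ∀ m {g g′} → (∀ x → All (_≤ m) x → g x ≡ g′ x) → ∀ n → below-sum m g n ≡ below-sum m g′ n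
  below-sum-cong m h n = sumOver-cong (All.map (λ {x} → h x) (partitionsBelow-bounded m n))

  below-sum-zero : ∀ m {g} → (∀ x → g x ≡ 0) → ∀ n → below-sum m g n ≡ 0
  below-sum-zero m h n = sumOver-zero (All.universal (λ x _ → h x) (partitionsBelow m n))

module DistinctSum = Sums (unique? _≟_)
module OddSum = Sums oddParts?

-- After the part m + 1 a second one would violate uniqueness, so the bound for the remaining parts
-- drops to m.
distinct-with-part : ∀ m g n → DistinctSum.with-part m g n ≡ DistinctSum.below-sum m (g ∘ (suc m ∷_)) n
distinct-with-part m g n = go n
  where
  open DistinctSum
  prepend : ∀ n → sumOver g (map (suc m ∷_) (partitionsBelow m n)) ≡ below-sum m (g ∘ (suc m ∷_)) n
  prepend n = sumOver-map g (suc m ∷_) (All.map (λ b → (λ { (_ ∷ u) → u }) ,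
      (All.map (λ p e → <-irrefl (sym e) (s≤s p)) b ∷_)) (partitionsBelow-bounded m n))
  go : ∀ n → with-part m g n ≡ below-sum m (g ∘ (suc m ∷_)) n
  go zero    = prepend zero
  go (suc n) with m ≤? n
  ... | yes m≤n = trans (cong (sumOver g ∘ map (suc m ∷_)) (partitionsBelow-≤ m≤n))
    (trans (cong (sumOver g) (map-++ (suc m ∷_) (partitionsBelow m (suc n)) _))
      (trans (sumOver-++ g (map (suc m ∷_) (partitionsBelow m (suc n))) _)
        (trans (cong₂ _+_ (prepend (suc n)) (twice (partitionsBelow (suc m) (n ∸ m)))) (+-identityʳ _))))
    where
    twice : ∀ xs → sumOver g (map (suc m ∷_) (map (suc m ∷_) xs)) ≡ 0
    twice xs = sumOver-zero (All.map⁺ (All.map⁺ (All.universal (λ { x ((c≢c ∷ _) ∷ _) → ⊥-elim (c≢c refl) }) xs)))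
  ... | no m≰n = trans (cong (sumOver g ∘ map (suc m ∷_)) (partitionsBelow-> (≰⇒> m≰n))) (prepend (suc n))

distinct-sum-suc : ∀ m g n → DistinctSum.below-sum (suc m) g n ≡
  DistinctSum.below-sum m g n + shift (suc m) (DistinctSum.below-sum m (g ∘ (suc m ∷_))) n
distinct-sum-suc m g n = trans (DistinctSum.below-sum-suc m g n)
  (cong (DistinctSum.below-sum m g n +_) (shift-cong (suc m) (distinct-with-part m g) n))

odd-sum-suc : ∀ m g n → ¬ (2 ∣ suc m) → OddSum.below-sum (suc m) g n ≡
  OddSum.below-sum m g n + shift (suc m) (OddSum.below-sum (suc m) (g ∘ (suc m ∷_))) n
odd-sum-suc m g n odd = trans (OddSum.below-sum-suc m g n)
  (cong (OddSum.below-sum m g n +_) (shift-cong (suc m) (λ n → OddSum.sumOver-map g (suc m ∷_)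
    (All.universal (λ x → (λ { (_ ∷ o) → o }) , (odd ∷_)) (partitionsBelow (suc m) n))) n))

even-sum-suc : ∀ m g n → 2 ∣ suc m → OddSum.below-sum (suc m) g n ≡ OddSum.below-sum m g n
even-sum-suc m g n even = trans (OddSum.below-sum-suc m g n) (trans
  (cong (OddSum.below-sum m g n +_) (trans
    (shift-cong (suc m) {v = 𝟎} (λ n → OddSum.sumOver-none g (suc m ∷_) (λ { x (o ∷ _) → o even })
      (partitionsBelow (suc m) n)) n)
    (shift-𝟎 (suc m) n)))
  (+-identityʳ _))

distinct-ones : ∀ m n → DistinctSum.below-sum m (λ _ → 1) n ≡ distinct m n
distinct-ones zero    zero    = refl
distinct-ones zero    (suc n) = refl
distinct-ones (suc m) n = trans (distinct-sum-suc m (λ _ → 1) n)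
  (cong₂ _+_ (distinct-ones m n) (shift-cong (suc m) (distinct-ones m) n))

2∣2* : ∀ u → 2 ∣ 2 * u
2∣2* u = m∣m*n u

2∤1+2* : ∀ u → ¬ (2 ∣ suc (2 * u))
2∤1+2* u d with ∣1⇒≡1 (∣m+n∣m⇒∣n (subst (2 ∣_) (+-comm 1 (2 * u)) d) (2∣2* u))
... | ()

even-sum-double : ∀ u g n → OddSum.below-sum (2 * suc u) g n ≡ OddSum.below-sum (suc (2 * u)) g n
even-sum-double u g n = trans (cong (λ z → OddSum.below-sum z g n) (*-suc 2 u))
  (even-sum-suc (suc (2 * u)) g n (subst (2 ∣_) (*-suc 2 u) (2∣2* (suc u))))

odd-ones : ∀ u n → OddSum.below-sum (2 * u) (λ _ → 1) n ≡ Odd.prefix u n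
odd-ones zero    zero    = refl
odd-ones zero    (suc n) = refl
odd-ones (suc u) n = trans (even-sum-double u (λ _ → 1) n)
  (trans (geo-unique (2 * u) _ _ (λ n → odd-sum-suc (2 * u) (λ _ → 1) n (2∤1+2* u)) n)
    (geo-cong (2 * u) (odd-ones u) n))

-- Hooks as sums over windows

additive-∑ᴸ : (Φ : Seq → ℕ) → Φ 𝟎 ≡ 0 → (∀ u v → Φ (u ⊕ v) ≡ Φ u + Φ v) → ∀ L (φ : Symbol → Seq) →
  Φ (λ n → ∑ᴸ L (λ σ → φ σ n)) ≡ ∑ᴸ L (λ σ → Φ (φ σ))
additive-∑ᴸ Φ Φ-𝟎 Φ-⊕ []      φ = Φ-𝟎
additive-∑ᴸ Φ Φ-𝟎 Φ-⊕ (σ ∷ L) φ = trans (Φ-⊕ (φ σ) _) (cong (Φ (φ σ) +_) (additive-∑ᴸ Φ Φ-𝟎 Φ-⊕ L φ))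

∑ᴸ-zero : ∀ L {φ} → (∀ σ → φ σ ≡ 0) → ∑ᴸ L φ ≡ 0
∑ᴸ-zero []      h = refl
∑ᴸ-zero (σ ∷ L) h = cong₂ _+_ (h σ) (∑ᴸ-zero L h)

shift-∑ᴸ : ∀ x L (φ : Symbol → Seq) n → shift x (λ n → ∑ᴸ L (λ σ → φ σ n)) n ≡ ∑ᴸ L (λ σ → shift x (φ σ) n)
shift-∑ᴸ x L φ n = additive-∑ᴸ (λ u → shift x u n) (shift-𝟎 x n) (λ u v → shift-⊕ x u v n) L φ

∑-∑ᴸ : ∀ R L (φ : Symbol → Seq) → ∑ R (λ m → ∑ᴸ L (λ σ → φ σ m)) ≡ ∑ᴸ L (λ σ → ∑ R (φ σ))
∑-∑ᴸ R L φ = additive-∑ᴸ (∑ R) (∑-zero R (λ _ _ → refl)) (∑-⊕ R) L φ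

module DistinctHooks where
  open Distinct
  open DistinctSum

  row : ℕ → ℕ → Seq
  row x m = below-sum m (rowHooks x (suc m))

  row₁ : ∀ m n → row 1 m n ≡ distinct m n
  row₁ m n = trans (below-sum-cong m (λ μ b → trans (rowHooks-column 0 m μ b) (cong (_+ 1) (rowHooks-0 m μ))) n)
    (distinct-ones m n)

  row₂ : ∀ x m n → row (suc (suc x)) m n ≡ below-sum m (rowHooks (suc x) m) n
  row₂ x m n = below-sum-cong m (λ μ b → trans (rowHooks-column (suc x) m μ b) (+-identityʳ _)) n

  row-zero : ∀ x n → row (suc (suc x)) 0 n ≡ 0
  row-zero x n = trans (row₂ x 0 n) (below-sum-zero 0 (λ _ → refl) n)

  -- Delete the last column of the row, which costs one. If the part m + 1 is absent, the shortened
  -- row lies above parts at most m. If it is present, it is a row of the same length, and deleting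
  -- it costs one more.
  row-suc : ∀ x m n → row (suc (suc x)) (suc m) n ≡ row (suc x) m n + shift (suc m) (row x m) n
  row-suc x m n = trans (row₂ x (suc m) n) (trans (distinct-sum-suc m _ n)
    (cong (row (suc x) m n +_) (shift-cong (suc m)
      (below-sum-cong m (λ μ _ → rowHooks-row x (suc m) (suc m) μ ≤-refl)) n)))

  shift-leaf : ∀ σ m n → shift (suc m) (leaf σ m) n ≡ leaf (insert σ) m n
  shift-leaf σ m n = trans (cong (λ z → shift (suc z) (leaf σ m) n) (sym (*-identityˡ m))) (leaf-insert σ m n)

  row-leaf : ∀ t m n → row (suc t) m n ≡ ∑ᴸ (distinctPatterns t) (λ σ → leaf σ m n)
  row-leaf zero m n = trans (row₁ m n) (trans (sym (Distinct-prefix m n))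
    (trans (cong (λ z → prefix z n) (sym (+-identityʳ m))) (sym (+-identityʳ _))))
  row-leaf (suc zero) zero    n = row-zero 0 n
  row-leaf (suc zero) (suc m) n = trans (row-suc 0 m n) (cong₂ _+_ (trans (row-leaf zero m n) (+-identityʳ _))
    (trans (shift-cong (suc m) {v = 𝟎} (below-sum-zero m (rowHooks-0 (suc m))) n) (shift-𝟎 (suc m) n)))
  row-leaf (suc (suc t)) zero    n = trans (row-zero (suc t) n) (sym (trans
    (∑ᴸ-++ (map widen (distinctPatterns (suc t))) _ _) (cong₂ _+_
      (trans (∑ᴸ-map widen (distinctPatterns (suc t)) _) (∑ᴸ-zero (distinctPatterns (suc t)) (λ _ → refl)))
      (trans (∑ᴸ-map (widen ∘ insert) (distinctPatterns t) _) (∑ᴸ-zero (distinctPatterns t) (λ _ → refl))))))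
  row-leaf (suc (suc t)) (suc m) n = trans (row-suc (suc t) m n) (sym (trans
    (∑ᴸ-++ (map widen (distinctPatterns (suc t))) _ _) (cong₂ _+_
      (trans (∑ᴸ-map widen (distinctPatterns (suc t)) _) (sym (row-leaf (suc t) m n)))
      (trans (∑ᴸ-map (widen ∘ insert) (distinctPatterns t) _) (trans
        (∑ᴸ-cong (distinctPatterns t) (λ σ → sym (shift-leaf σ m n)))
        (trans (sym (shift-∑ᴸ (suc m) (distinctPatterns t) (λ σ → leaf σ m) n))
          (shift-cong (suc m) (λ n → sym (row-leaf t m n)) n)))))))

  b-hooks : ∀ t n → b (suc t) n ≡ DistinctBounds.hooks t n
  b-hooks t n = begin
    X n n
      ≡⟨ cong (sumOver (hookCount (suc t))) (sym (partitionsBelow-stable (n≤1+n n))) ⟩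
    X (suc n) n
      ≡⟨ unfold-recurrence X (λ m n → ∑ᴸ L (λ σ → leaf (insert σ) m n)) X₀ X₊ (suc n) n ⟩
    ∑ (suc n) (λ m → up (suc m) (n ∸ m) (λ n → ∑ᴸ L (λ σ → leaf (insert σ) m n)) n)
      ≡⟨ ∑-cong (suc n) (λ m _ → additive-∑ᴸ (λ u → up (suc m) (n ∸ m) u n) (up-𝟎 (suc m) (n ∸ m) n)
           (λ u v → up-⊕ (suc m) (n ∸ m) u v n) L (λ σ → leaf (insert σ) m)) ⟩
    ∑ (suc n) (λ m → ∑ᴸ L (λ σ → up (suc m) (n ∸ m) (leaf (insert σ) m) n))
      ≡⟨ ∑-∑ᴸ (suc n) L (λ σ m → up (suc m) (n ∸ m) (leaf (insert σ) m) n) ⟩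
    ∑ᴸ L (λ σ → ∑ (suc n) (λ m → up (suc m) (n ∸ m) (leaf (insert σ) m) n))
      ≡⟨ ∑ᴸ-cong L (λ σ → sym (T-widen (insert σ) n)) ⟩
    DistinctBounds.hooks t n ∎
    where
    open ≡-Reasoning
    L = distinctPatterns t
    X : ℕ → Seq
    X m = below-sum m (hookCount (suc t))
    X₀ : X 0 ≗ 𝟎
    X₀ zero    = refl
    X₀ (suc n) = refl
    -- A new largest part m + 1 keeps all hooks below it, whence the factor 1 + q^(m+1), and
    -- contributes those of its own row as the source.
    X₊ : ∀ m n → X (suc m) n ≡ mul (1 * m) (X m) n + ∑ᴸ L (λ σ → leaf (insert σ) m n)
    X₊ m n = begin
      X (suc m) n
        ≡⟨ distinct-sum-suc m (hookCount (suc t)) n ⟩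
      X m n + shift (suc m) (below-sum m (hookCount (suc t) ∘ (suc m ∷_))) n
        ≡⟨ cong (X m n +_) (shift-cong (suc m) (λ n → trans
             (below-sum-cong m (λ μ _ → hookCount-∷ (suc t) (suc m) μ) n)
             (trans (sumOver-⊕ _ (hookCount (suc t)) (partitionsBelow m n)) (+-comm (row (suc t) m n) (X m n)))) n) ⟩
      X m n + shift (suc m) (X m ⊕ row (suc t) m) n
        ≡⟨ cong (X m n +_) (shift-⊕ (suc m) (X m) (row (suc t) m) n) ⟩
      X m n + (shift (suc m) (X m) n + shift (suc m) (row (suc t) m) n)
        ≡⟨ sym (+-assoc (X m n) _ _) ⟩
      mul m (X m) n + shift (suc m) (row (suc t) m) n
        ≡⟨ cong₂ _+_ (cong (λ z → mul z (X m) n) (sym (*-identityˡ m)))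
             (trans (shift-cong (suc m) (row-leaf t m) n)
               (trans (shift-∑ᴸ (suc m) L (λ σ → leaf σ m) n) (∑ᴸ-cong L (λ σ → shift-leaf σ m n)))) ⟩
      mul (1 * m) (X m) n + ∑ᴸ L (λ σ → leaf (insert σ) m n) ∎

module OddHooks where
  open Odd
  open OddSum

  -- rowBelow leaves out the last column of a row with 2u + 1 boxes, and the parts 2u + 1 below it.
  row rowBelow : ℕ → ℕ → Seq
  row x u = below-sum (suc (2 * u)) (rowHooks x (suc (2 * u)))
  rowBelow x u = below-sum (2 * u) (rowHooks x (2 * u))

  row-0 : ∀ u n → row 0 u n ≡ 0
  row-0 u = below-sum-zero (suc (2 * u)) (rowHooks-0 (suc (2 * u)))

  row-step : ∀ x u n → row (suc x) u n ≡
    below-sum (2 * u) (rowHooks (suc x) (suc (2 * u))) n + shift (suc (2 * u)) (row x u) n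
  row-step x u n = trans (odd-sum-suc (2 * u) _ n (2∤1+2* u))
    (cong (below-sum (2 * u) (rowHooks (suc x) (suc (2 * u))) n +_) (shift-cong (suc (2 * u))
      (below-sum-cong (suc (2 * u)) (λ μ _ → rowHooks-row x (suc (2 * u)) (suc (2 * u)) μ ≤-refl)) n))

  rowBelow-0 : ∀ x n → rowBelow x 0 n ≡ 0
  rowBelow-0 x = below-sum-zero 0 (λ _ → refl)

  rowBelow-suc : ∀ x u n → rowBelow x (suc u) n ≡ below-sum (suc (2 * u)) (rowHooks x (suc (suc (2 * u)))) n
  rowBelow-suc x u n = trans (even-sum-double u _ n)
    (cong (λ z → below-sum (suc (2 * u)) (rowHooks x z) n) (*-suc 2 u))

  row₁ : ∀ u n → row 1 u n ≡ prefix u n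
  row₁ u n = trans (row-step 0 u n) (trans (cong₂ _+_
    (trans (below-sum-cong (2 * u) (λ μ b → trans (rowHooks-column 0 (2 * u) μ b)
        (cong (_+ 1) (rowHooks-0 (2 * u) μ))) n) (odd-ones u n))
    (trans (shift-cong (suc (2 * u)) {v = 𝟎} (row-0 u) n) (shift-𝟎 (suc (2 * u)) n)))
    (+-identityʳ _))

  -- Either the next row is equally long and deleting it shortens every leg, or the last column is a
  -- single box and is deleted instead. Both cost one; in the second case the row is left with the
  -- even length 2u.
  row₂ : ∀ x u n → row (suc (suc x)) u n ≡ rowBelow (suc x) u n + shift (suc (2 * u)) (row (suc x) u) n
  row₂ x u n = trans (row-step (suc x) u n) (cong (_+ shift (suc (2 * u)) (row (suc x) u) n)
    (below-sum-cong (2 * u) (λ μ b → trans (rowHooks-column (suc x) (2 * u) μ b) (+-identityʳ _)) n))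

  rowBelow₁ : ∀ u n → rowBelow 1 (suc u) n ≡ prefix (suc u) n
  rowBelow₁ u n = trans (rowBelow-suc 1 u n) (trans
    (below-sum-cong (suc (2 * u)) (λ μ b → trans (rowHooks-column 0 (suc (2 * u)) μ b)
      (cong (_+ 1) (rowHooks-0 (suc (2 * u)) μ))) n)
    (trans (sym (even-sum-double u (λ _ → 1) n)) (odd-ones (suc u) n)))

  rowBelow₂ : ∀ x u n → rowBelow (suc (suc x)) (suc u) n ≡ row (suc x) u n
  rowBelow₂ x u n = trans (rowBelow-suc (suc (suc x)) u n) (below-sum-cong (suc (2 * u))
    (λ μ b → trans (rowHooks-column (suc x) (suc (2 * u)) μ b) (+-identityʳ _)) n)

  row-leaf : ∀ t u n → row (suc t) u n ≡ ∑ᴸ (oddPatterns t) (λ σ → leaf σ u n)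
  row-leaf zero u n = trans (row₁ u n)
    (trans (cong (λ z → prefix z n) (sym (+-identityʳ u))) (sym (+-identityʳ _)))
  row-leaf (suc zero) u n = trans (row₂ 0 u n) (cong₂ _+_ (rowBelow-leaf u)
    (trans (trans (shift-cong (suc (2 * u)) (λ n → trans (row-leaf zero u n) (+-identityʳ _)) n)
      (leaf-insert (symbol 0 0 0 0) u n)) (sym (+-identityʳ _))))
    where
    rowBelow-leaf : ∀ u → rowBelow 1 u n ≡ leaf (symbol 0 0 0 1) u n
    rowBelow-leaf zero    = rowBelow-0 1 n
    rowBelow-leaf (suc u) = trans (rowBelow₁ u n) (cong (λ z → prefix z n) (+-comm 1 u))
  row-leaf (suc (suc t)) u n = trans (row₂ (suc t) u n) (trans (+-comm (rowBelow (suc (suc t)) u n) _) (sym (trans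
    (∑ᴸ-++ (map insert (oddPatterns (suc t))) _ _) (cong₂ _+_
      (trans (∑ᴸ-map insert (oddPatterns (suc t)) _) (trans
        (∑ᴸ-cong (oddPatterns (suc t)) (λ σ → sym (leaf-insert σ u n)))
        (trans (sym (shift-∑ᴸ (suc (2 * u)) (oddPatterns (suc t)) (λ σ → leaf σ u) n))
          (shift-cong (suc (2 * u)) (λ n → sym (row-leaf (suc t) u n)) n))))
      (trans (∑ᴸ-map widen (oddPatterns t) _) (rowBelow-leaf u))))))
    where
    rowBelow-leaf : ∀ u → ∑ᴸ (oddPatterns t) (λ σ → leaf (widen σ) u n) ≡ rowBelow (suc (suc t)) u n
    rowBelow-leaf zero    = trans (∑ᴸ-zero (oddPatterns t) (λ _ → refl)) (sym (rowBelow-0 (suc (suc t)) n))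
    rowBelow-leaf (suc u) = trans (sym (row-leaf t u n)) (sym (rowBelow₂ t u n))

  a-hooks : ∀ t n → a (suc t) n ≡ OddBounds.hooks t n
  a-hooks t n = begin
    below-sum n (hookCount (suc t)) n
      ≡⟨ cong (sumOver (hookCount (suc t)))
           (sym (partitionsBelow-stable (≤-trans (n≤1+n n) (m≤m+n (suc n) (suc n + 0))))) ⟩
    X (suc n) n
      ≡⟨ unfold-recurrence X (λ u → op′ u (λ n → ∑ᴸ L (λ σ → leaf (insert σ) u n))) X₀ X₊ (suc n) n ⟩
    ∑ (suc n) (λ m → up (suc m) (n ∸ m) (op′ m (λ n → ∑ᴸ L (λ σ → leaf (insert σ) m n))) n)
      ≡⟨ ∑-cong (suc n) (λ m _ → trans
           (up-cong (suc m) (n ∸ m) (λ n → additive-∑ᴸ (λ u → op′ m u n) (geo-𝟎 (2 * m) n)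
             (λ u v → geo-⊕ (2 * m) u v n) L (λ σ → leaf (insert σ) m)) n)
           (additive-∑ᴸ (λ u → up (suc m) (n ∸ m) u n) (up-𝟎 (suc m) (n ∸ m) n)
             (λ u v → up-⊕ (suc m) (n ∸ m) u v n) L (λ σ → op′ m (leaf (insert σ) m)))) ⟩
    ∑ (suc n) (λ m → ∑ᴸ L (λ σ → up (suc m) (n ∸ m) (op′ m (leaf (insert σ) m)) n))
      ≡⟨ ∑-∑ᴸ (suc n) L (λ σ m → up (suc m) (n ∸ m) (op′ m (leaf (insert σ) m)) n) ⟩
    ∑ᴸ L (λ σ → ∑ (suc n) (λ m → up (suc m) (n ∸ m) (op′ m (leaf (insert σ) m)) n))
      ≡⟨ ∑ᴸ-cong L (λ { σ@(symbol A k s c) → sym (T-op (insert σ) (Odd-valid A k s c) n) }) ⟩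
    OddBounds.hooks t n ∎
    where
    open ≡-Reasoning
    L = oddPatterns t
    op′ : ℕ → Seq → Seq
    op′ u = geo (2 * u)
    X : ℕ → Seq
    X u = below-sum (2 * u) (hookCount (suc t))
    X₀ : X 0 ≗ 𝟎
    X₀ zero    = refl
    X₀ (suc n) = refl
    X-fix : ∀ u n → X (suc u) n ≡ (X u n + shift (suc (2 * u)) (row (suc t) u) n) + shift (suc (2 * u)) (X (suc u)) n
    X-fix u n = begin
      X (suc u) n
        ≡⟨ even-sum-double u (hookCount (suc t)) n ⟩
      below-sum (suc (2 * u)) (hookCount (suc t)) n
        ≡⟨ odd-sum-suc (2 * u) (hookCount (suc t)) n (2∤1+2* u) ⟩
      X u n + shift (suc (2 * u)) (below-sum (suc (2 * u)) (hookCount (suc t) ∘ (suc (2 * u) ∷_))) n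
        ≡⟨ cong (X u n +_) (shift-cong (suc (2 * u)) (λ n → trans
             (below-sum-cong (suc (2 * u)) (λ μ _ → hookCount-∷ (suc t) (suc (2 * u)) μ) n)
             (trans (sumOver-⊕ _ (hookCount (suc t)) (partitionsBelow (suc (2 * u)) n))
               (cong (row (suc t) u n +_) (sym (even-sum-double u (hookCount (suc t)) n))))) n) ⟩
      X u n + shift (suc (2 * u)) (row (suc t) u ⊕ X (suc u)) n
        ≡⟨ cong (X u n +_) (shift-⊕ (suc (2 * u)) (row (suc t) u) (X (suc u)) n) ⟩
      X u n + (shift (suc (2 * u)) (row (suc t) u) n + shift (suc (2 * u)) (X (suc u)) n)
        ≡⟨ sym (+-assoc (X u n) _ _) ⟩
      _ ∎
    X₊ : ∀ u n → X (suc u) n ≡ op′ u (X u) n + op′ u (λ n → ∑ᴸ L (λ σ → leaf (insert σ) u n)) n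
    -- In `X-fix` the unknown stands on both sides, because equal parts may be repeated;
    -- `geo-unique` solves for it.
    X₊ u n = trans (geo-unique (2 * u) (X u ⊕ shift (suc (2 * u)) (row (suc t) u)) (X (suc u)) (X-fix u) n)
      (trans (geo-⊕ (2 * u) (X u) (shift (suc (2 * u)) (row (suc t) u)) n)
        (cong (op′ u (X u) n +_) (geo-cong (2 * u) (λ n →
          trans (shift-cong (suc (2 * u)) (row-leaf t u) n)
            (trans (shift-∑ᴸ (suc (2 * u)) L (λ σ → leaf σ u) n) (∑ᴸ-cong L (λ σ → leaf-insert σ u n)))) n)))

-- The ratio

-- The default 0 makes the quotient total, so that it can serve as an approximating sequence from n
-- = 0 on.
ratio : ℕ → ℕ → ℚ
ratio x zero    = 0ℚ
ratio x (suc y) = ℤ.+ x ℚ./ suc y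

ratio-≡ : ∀ x y {{_ : NonZero y}} → ratio x y ≡ ℤ.+ x ℚ./ y
ratio-≡ x (suc y) = refl

ratio-≤ : ∀ K x y x′ y′ → 0 < y → 0 < y′ → suc K * (x * y′) ≤ suc K * (x′ * y) + y * y′ →
  ratio x y ℚ.≤ ratio x′ y′ ℚ.+ ratio 1 (suc K)
ratio-≤ K x (suc y) x′ (suc y′) _ _ h = ℚ.toℚᵘ-cancel-≤
  (ℚᵘ.≤-respˡ-≃ (ℚᵘ.≃-sym (ℚ.toℚᵘ-fromℚᵘ p)) (ℚᵘ.≤-respʳ-≃
    (ℚᵘ.≃-sym (ℚᵘ.≃-trans (ℚ.toℚᵘ-homo-+ (ratio x′ (suc y′)) (ratio 1 (suc K)))
      (ℚᵘ.+-cong (ℚ.toℚᵘ-fromℚᵘ p′) (ℚ.toℚᵘ-fromℚᵘ k))))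
    (ℚᵘ.*≤* (subst₂ ℤ._≤_ (ℤ.pos-* x (suc y′ * suc K))
      (trans (ℤ.pos-* (x′ * suc K + 1 * suc y′) (suc y))
        (cong (ℤ._* ℤ.+ suc y) (trans (ℤ.pos-+ (x′ * suc K) (1 * suc y′))
          (cong₂ ℤ._+_ (ℤ.pos-* x′ (suc K)) (ℤ.pos-* 1 (suc y′))))))
      (ℤ.+≤+ (subst₂ _≤_ (lhs (suc K) x (suc y′)) (rhs (suc K) x′ (suc y) (suc y′)) h))))))
  where
  p = ℚᵘ.mkℚᵘ (ℤ.+ x) y
  p′ = ℚᵘ.mkℚᵘ (ℤ.+ x′) y′
  k = ℚᵘ.mkℚᵘ (ℤ.+ 1) K
  lhs : ∀ K x y′ → K * (x * y′) ≡ x * (y′ * K)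
  lhs = solve-∀
  rhs : ∀ K x′ y y′ → K * (x′ * y) + y * y′ ≡ (x′ * K + 1 * y′) * y
  rhs = solve-∀

∣-∣-bound : ∀ p r e → p ℚ.≤ r ℚ.+ e → r ℚ.≤ p ℚ.+ e → ℚ.∣ p ℚ.- r ∣ ℚ.≤ e
∣-∣-bound p r e h h′ with ℚ.∣p∣≡p∨∣p∣≡-p (p ℚ.- r)
... | inj₁ eq = subst₂ ℚ._≤_ (sym eq) (cancel r e) (ℚ.+-monoˡ-≤ (ℚ.- r) h)
  where
  open +-*-Solver
  cancel : ∀ r e → (r ℚ.+ e) ℚ.- r ≡ e
  cancel = solve 2 (λ r e → (r :+ e) :- r := e) refl
... | inj₂ eq = subst₂ ℚ._≤_ (sym (trans eq (negate p r))) (cancel p e) (ℚ.+-monoˡ-≤ (ℚ.- p) h′)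
  where
  open +-*-Solver
  cancel : ∀ r e → (r ℚ.+ e) ℚ.- r ≡ e
  cancel = solve 2 (λ r e → (r :+ e) :- r := e) refl
  negate : ∀ p r → ℚ.- (p ℚ.- r) ≡ r ℚ.- p
  negate = solve 2 (λ p r → :- (p :- r) := r :- p) refl

unit-fraction : ∀ ε → 0ℚ ℚ.< ε → ∃[ K ] (ratio 1 (suc K) ℚ.< ε)
unit-fraction ε@(mkℚ (ℤ.+ zero)   d _) 0<ε = ⊥-elim (ℚ.<-irrefl (sym (ℚ.↥p≡0⇒p≡0 ε refl)) 0<ε)
unit-fraction (mkℚ ℤ.-[1+ n ]     d _) (ℚ.*<* ())
unit-fraction (mkℚ (ℤ.+ (suc n)) d _) 0<ε = suc d , ℚ.toℚᵘ-cancel-<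
  (ℚᵘ.<-respˡ-≃ (ℚᵘ.≃-sym (ℚ.toℚᵘ-fromℚᵘ (ℚᵘ.mkℚᵘ (ℤ.+ 1) (suc d))))
    (ℚᵘ.*<* (subst₂ ℤ._<_ (ℤ.pos-* 1 (suc d)) (ℤ.pos-* (suc n) (suc (suc d)))
      (ℤ.+<+ (≤-trans (s≤s (≤-reflexive (+-identityʳ (suc d)))) (m≤m+n (suc (suc d)) _))))))

Eventually : (ℕ → Set) → Set
Eventually P = ∃[ N ] (∀ n → n ≥ N → P n)

module Limit (A B : Seq)
  (B-positive : Eventually (λ n → 0 < B n))
  (gap : Eventually (λ n → 79 * B n ≤ 78 * A n))
  (cauchy-ratio : ∀ K → ∃[ N ] (∀ m n → m ≥ N → n ≥ N →
    suc K * (A m * B n) ≤ suc K * (A n * B m) + B m * B n))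
  where

  r : ℕ → ℚ
  r n = ratio (A n) (B n)

  r-close : ∀ K → ∃[ N ] (∀ m n → m ≥ N → n ≥ N → ℚ.∣ r m ℚ.- r n ∣ ℚ.≤ ratio 1 (suc K))
  r-close K = let M , pos = B-positive ; N , h = cauchy-ratio K in M ⊔ N , λ m n m≥ n≥ →
    let m≥M = m⊔n≤o⇒m≤o M N m≥ ; n≥M = m⊔n≤o⇒m≤o M N n≥
        m≥N = m⊔n≤o⇒n≤o M N m≥ ; n≥N = m⊔n≤o⇒n≤o M N n≥
    in ∣-∣-bound (r m) (r n) (ratio 1 (suc K))
      (ratio-≤ K (A m) (B m) (A n) (B n) (pos m m≥M) (pos n n≥M) (h m n m≥N n≥N))
      (ratio-≤ K (A n) (B n) (A m) (B m) (pos n n≥M) (pos m m≥M) (h n m n≥N m≥N))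

  -- The quotients themselves represent the limit, so convergence to it is the Cauchy property
  -- again.
  γ : ℝ
  γ = mkℝ r λ ε 0<ε → let K , K< = unit-fraction ε 0<ε ; N , h = r-close K in
    N , λ m n m≥ n≥ → ℚ.≤-<-trans (h m n m≥ n≥) K<

  1<γ : 1ᴿ <ᴿ γ
  1<γ = let M , pos = B-positive ; N , h = gap in ratio 1 78 , ℚ.positive⁻¹ (ratio 1 78) , M ⊔ N , λ n n≥ →
    at-least (A n) (B n) (pos n (m⊔n≤o⇒m≤o M N n≥)) (h n (m⊔n≤o⇒n≤o M N n≥))
    where
    at-least : ∀ x y → 0 < y → 79 * y ≤ 78 * x → 1ℚ ℚ.+ ratio 1 78 ℚ.≤ ratio x y
    at-least x (suc y) _ p = ℚ.toℚᵘ-cancel-≤ (ℚᵘ.≤-respʳ-≃ (ℚᵘ.≃-sym (ℚ.toℚᵘ-fromℚᵘ (ℚᵘ.mkℚᵘ (ℤ.+ x) y)))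
      (ℚᵘ.*≤* (subst₂ ℤ._≤_ (ℤ.pos-* 79 (suc y)) (ℤ.pos-* x 78)
        (ℤ.+≤+ (subst (79 * suc y ≤_) (*-comm 78 x) p)))))

  tends : RatioTendsTo A B γ
  tends ε (δ , 0<δ , M , hε) with unit-fraction δ 0<δ
  ... | K , K<δ = let N , h = r-close K ; L , pos = B-positive in N ⊔ L , λ n n≥ →
    let nonzero = >-nonZero (pos n (m⊔n≤o⇒n≤o N L n≥)) in
    -- ε exceeds 0 by δ eventually and the distance is at most e < δ, which leaves the slack δ - e.
    nonzero , δ ℚ.- e , subst (ℚ._< δ ℚ.- e) (ℚ.+-inverseʳ e) (ℚ.+-monoˡ-< (ℚ.- e) K<δ) , M ⊔ N , λ j j≥ → begin
      ℚ.∣ (ℤ.+ A n ℚ./ B n) {{nonzero}} ℚ.- r j ∣ ℚ.+ (δ ℚ.- e)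
        ≡⟨ cong (λ z → ℚ.∣ z ℚ.- r j ∣ ℚ.+ (δ ℚ.- e)) (sym (ratio-≡ (A n) (B n) {{nonzero}})) ⟩
      ℚ.∣ r n ℚ.- r j ∣ ℚ.+ (δ ℚ.- e)
        ≤⟨ ℚ.+-monoˡ-≤ (δ ℚ.- e) (h n j (m⊔n≤o⇒m≤o N L n≥) (m⊔n≤o⇒n≤o M N j≥)) ⟩
      e ℚ.+ (δ ℚ.- e)
        ≡⟨ cancel e δ ⟩
      0ℚ ℚ.+ δ
        ≤⟨ hε j (m⊔n≤o⇒m≤o M N j≥) ⟩
      approx ε j ∎
    where
    open ℚ.≤-Reasoning
    e = ratio 1 (suc K)
    cancel : ∀ e δ → e ℚ.+ (δ ℚ.- e) ≡ 0ℚ ℚ.+ δ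
    cancel e δ = trans (lemma e δ) (sym (ℚ.+-identityˡ δ))
      where
      open +-*-Solver
      lemma : ∀ e δ → e ℚ.+ (δ ℚ.- e) ≡ δ
      lemma = solve 2 (λ e δ → e :+ (δ :- e) := δ) refl

  a≥b : ∃[ N ] (N > 0 × (∀ n → n > N → A n ≥ B n))
  a≥b = let N , h = gap in suc N , z<s , λ n n> → *-cancelˡ-≤ 78
    (≤-trans (*-monoˡ-≤ (B n) (n≤1+n 78)) (h n (≤-trans (n≤1+n N) (<⇒≤ n>))))

-- From comparisons with S to the quotient

⪯-diagonal : ∀ {u v} → u ⪯ v → ∀ K → Eventually (λ n → K * u n ≤ K * v n + S n)
⪯-diagonal {u} {v} p K with _⪯_.bound p K
... | N , h = N , λ n n≥ → *-cancelʳ-≤ _ _ (S n) {{>-nonZero (S-positive n)}}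
  (subst₂ _≤_ (sym (*-assoc K (u n) (S n))) (rhs K (v n) (S n)) (h n n n≥ n≥))
  where
  rhs : ∀ K a s → K * (a * s) + s * s ≡ (K * a + s) * s
  rhs = solve-∀

-- x/s ≤ x′/t + 1/L and y/t ≤ y′/s + 1/L give xy ≤ x′y′ + O(st/L).
product-bound : ∀ c K {x y x′ y′ s t} {{_ : NonZero c}} → 0 < s * t →
  let L = suc K * (5 * (c * c)) in
  L * (x * t) ≤ L * (x′ * s) + s * t → L * (y * s) ≤ L * (y′ * t) + t * s →
  x′ ≤ 2 * t → y′ ≤ 2 * s → s ≤ c * y′ → t ≤ c * y →
  suc K * (x * y) ≤ suc K * (x′ * y′) + y′ * y
product-bound c K {x} {y} {x′} {y′} {s} {t} 0<st h h′ x′≤ y′≤ s≤ t≤ =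
  *-cancelˡ-≤ (5 * (c * c)) {{C≢0}} (*-cancelˡ-≤ L {{L≢0}} (begin
    L * (5 * (c * c) * (suc K * (x * y)))
      ≡⟨ lhs (suc K) c x y ⟩
    L * L * (x * y)
      ≤⟨ *-cancelʳ-≤ _ _ (s * t) {{>-nonZero 0<st}} (begin
          L * L * (x * y) * (s * t)
            ≡⟨ mul-lhs L x y s t ⟩
          (L * (x * t)) * (L * (y * s))
            ≤⟨ *-mono-≤ h h′ ⟩
          (L * (x′ * s) + s * t) * (L * (y′ * t) + t * s)
            ≡⟨ mul-rhs L x′ y′ s t ⟩
          (L * L * (x′ * y′) + (L * (x′ * s + y′ * t) + s * t)) * (s * t) ∎) ⟩
    L * L * (x′ * y′) + (L * (x′ * s + y′ * t) + s * t)
      ≤⟨ +-monoʳ-≤ (L * L * (x′ * y′)) (begin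
          L * (x′ * s + y′ * t) + s * t
            ≤⟨ +-mono-≤ (*-monoʳ-≤ L (+-mono-≤ (*-monoˡ-≤ s x′≤) (*-monoˡ-≤ t y′≤))) (m≤n*m (s * t) L {{L≢0}}) ⟩
          L * (2 * t * s + 2 * s * t) + L * (s * t)
            ≡⟨ collect L s t ⟩
          L * (5 * (s * t))
            ≤⟨ *-monoʳ-≤ L (*-monoʳ-≤ 5 (*-mono-≤ s≤ t≤)) ⟩
          L * (5 * (c * y′ * (c * y)))
            ≡⟨ cong (L *_) (square c y′ y) ⟩
          L * (5 * (c * c) * (y′ * y)) ∎) ⟩
    L * L * (x′ * y′) + L * (5 * (c * c) * (y′ * y))
      ≡⟨ rhs (suc K) c x′ y′ y ⟩
    L * (5 * (c * c) * (suc K * (x′ * y′) + y′ * y)) ∎))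
  where
  open ≤-Reasoning
  L = suc K * (5 * (c * c))
  C≢0 : NonZero (5 * (c * c))
  C≢0 = m*n≢0 5 (c * c) {{_}} {{m*n≢0 c c}}
  L≢0 : NonZero L
  L≢0 = m*n≢0 (suc K) (5 * (c * c)) {{_}} {{C≢0}}
  lhs : ∀ K c x y → K * (5 * (c * c)) * (5 * (c * c) * (K * (x * y))) ≡ K * (5 * (c * c)) * (K * (5 * (c * c))) * (x * y)
  lhs = solve-∀
  rhs : ∀ K c x y z → K * (5 * (c * c)) * (K * (5 * (c * c))) * (x * y) + K * (5 * (c * c)) * (5 * (c * c) * (y * z))
    ≡ K * (5 * (c * c)) * (5 * (c * c) * (K * (x * y) + y * z))
  rhs = solve-∀
  mul-lhs : ∀ L x y s t → L * L * (x * y) * (s * t) ≡ (L * (x * t)) * (L * (y * s))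
  mul-lhs = solve-∀
  mul-rhs : ∀ L x y s t → (L * (x * s) + s * t) * (L * (y * t) + t * s)
    ≡ (L * L * (x * y) + (L * (x * s + y * t) + s * t)) * (s * t)
  mul-rhs = solve-∀
  collect : ∀ L s t → L * (2 * t * s + 2 * s * t) + L * (s * t) ≡ L * (5 * (s * t))
  collect = solve-∀
  square : ∀ c y z → 5 * (c * y * (c * z)) ≡ 5 * (c * c) * (y * z)
  square = solve-∀

-- At precision 2c the error s is at most c y, which costs half a unit of the factor p + 1: the
-- ratio (p + 1)/p weakens to (2p + 1)/2p.
absorb : ∀ c p {x y s} {{_ : NonZero c}} →
  2 * c * (suc p * y) ≤ 2 * c * (p * x) + s → s ≤ c * y → suc (2 * p) * y ≤ 2 * p * x
absorb c p {x} {y} {s} h h′ = +-cancelʳ-≤ y _ _ (*-cancelˡ-≤ c (begin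
  c * (suc (2 * p) * y + y)      ≡⟨ lhs c p y ⟩
  2 * c * (suc p * y)            ≤⟨ h ⟩
  2 * c * (p * x) + s            ≤⟨ +-monoʳ-≤ (2 * c * (p * x)) h′ ⟩
  2 * c * (p * x) + c * y        ≡⟨ rhs c p x y ⟩
  c * (2 * p * x + y)            ∎))
  where
  open ≤-Reasoning
  lhs : ∀ c p y → c * ((1 + 2 * p) * y + y) ≡ 2 * c * ((1 + p) * y)
  lhs = solve-∀
  rhs : ∀ c p x y → 2 * c * (p * x) + c * y ≡ c * (2 * p * x + y)
  rhs = solve-∀

_∧_ : ∀ {P R : ℕ → Set} → Eventually P → Eventually R → Eventually (λ n → P n × R n)
(M , p) ∧ (N , r) = M ⊔ N , λ n n≥ → p n (m⊔n≤o⇒m≤o M N n≥) , r n (m⊔n≤o⇒n≤o M N n≥)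

ratio-cauchy : ∀ c {A B} {{_ : NonZero c}} → A ⪯ A → B ⪯ B →
  Eventually (λ n → A n ≤ 2 * S n × B n ≤ 2 * S n × S n ≤ c * B n) →
  ∀ K → ∃[ N ] (∀ m n → m ≥ N → n ≥ N → suc K * (A m * B n) ≤ suc K * (A n * B m) + B m * B n)
ratio-cauchy c {A} {B} A⪯A B⪯B (N , k) K =
  let L , h  = _⪯_.bound A⪯A (suc K * (5 * (c * c)))
      M , h′ = _⪯_.bound B⪯B (suc K * (5 * (c * c)))
  in L ⊔ (M ⊔ N) , λ m n m≥ n≥ →
    let m≥MN = m⊔n≤o⇒n≤o L (M ⊔ N) m≥ ; n≥MN = m⊔n≤o⇒n≤o L (M ⊔ N) n≥
        _ , Bm≤ , Sm≤ = k m (m⊔n≤o⇒n≤o M N m≥MN)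
        An≤ , _ , Sn≤ = k n (m⊔n≤o⇒n≤o M N n≥MN)
    in product-bound c K {A m} {B n} {A n} {B m} {S m} {S n} (*-mono-≤ (S-positive m) (S-positive n))
      (h m n (m⊔n≤o⇒m≤o L (M ⊔ N) m≥) (m⊔n≤o⇒m≤o L (M ⊔ N) n≥))
      (h′ n m (m⊔n≤o⇒m≤o M N n≥MN) (m⊔n≤o⇒m≤o M N m≥MN)) An≤ Bm≤ Sm≤ Sn≤

module Asymptotics (A B : Seq) (A⪯A : A ⪯ A) (A⪯S : A ⪯ S) (4S⪯6A : 4 · S ⪯ 6 · A)
  (B⪯B : B ⪯ B) (60B⪯39S : 60 · B ⪯ 39 · S) (S⪯5B : S ⪯ 5 · B) where

  A≤2S : Eventually (λ n → A n ≤ 2 * S n)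
  A≤2S = let N , h = ⪯-diagonal A⪯S 1 in N , λ n n≥ → subst₂ _≤_ (*-identityˡ (A n)) (arith (S n)) (h n n≥)
    where
    arith : ∀ s → 1 * s + s ≡ 2 * s
    arith = solve-∀

  S≤10B : Eventually (λ n → S n ≤ 10 * B n)
  S≤10B = let N , h = ⪯-diagonal S⪯5B 2 in N , λ n n≥ → +-cancelʳ-≤ (S n) _ _ (subst₂ _≤_ (lhs (S n)) (rhs (B n) (S n)) (h n n≥))
    where
    lhs : ∀ s → 2 * s ≡ s + s
    lhs = solve-∀
    rhs : ∀ y s → 2 * (5 * y) + s ≡ 10 * y + s
    rhs = solve-∀

  B≤2S : Eventually (λ n → B n ≤ 2 * S n)
  B≤2S = let N , h = ⪯-diagonal 60B⪯39S 1 in N , λ n n≥ → *-cancelˡ-≤ 60 (≤-trans (≤-reflexive (sym (*-identityˡ (60 * B n))))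
    (≤-trans (h n n≥) (≤-trans (m≤m+n _ (80 * S n)) (≤-reflexive (arith (S n))))))
    where
    arith : ∀ s → (1 * (39 * s) + s) + 80 * s ≡ 60 * (2 * s)
    arith = solve-∀

  -- The quotient of the bounds 39/60 and 4/6 is 39/40.
  40B⪯39A : 40 · B ⪯ 39 · A
  40B⪯39A = ⪯-unscale 5 (⪯-trans
    (≗-⪯ (λ n → e₁ (B n)) (λ n → e₂ (S n)) (⪯-· 4 60B⪯39S))
    (≗-⪯ (λ _ → refl) (λ n → e₃ (A n)) (⪯-· 39 4S⪯6A)))
    where
    e₁ : ∀ y → 6 * (40 * y) ≡ 4 * (60 * y)
    e₁ = solve-∀
    e₂ : ∀ s → 39 * (4 * s) ≡ 4 * (39 * s)
    e₂ = solve-∀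
    e₃ : ∀ x → 6 * (39 * x) ≡ 39 * (6 * x)
    e₃ = solve-∀

  B-positive : Eventually (λ n → 0 < B n)
  B-positive = let N , h = S≤10B in N , λ n n≥ →
    >-nonZero⁻¹ (B n) {{m*n≢0⇒n≢0 10 {{>-nonZero (≤-trans (S-positive n) (h n n≥))}}}}

  gap : Eventually (λ n → 79 * B n ≤ 78 * A n)
  -- c = 10 comes from `S≤10B`, p = 39 from `40B⪯39A`, and 20 = 2c; the result 79/78 = 1 + 1/78 is
  -- the margin used for `1<γ`.
  gap = let M , h = ⪯-diagonal 40B⪯39A 20 ; N , k = S≤10B in M ⊔ N , λ n n≥ →
    absorb 10 39 {A n} {B n} {S n} (h n (m⊔n≤o⇒m≤o M N n≥)) (k n (m⊔n≤o⇒n≤o M N n≥))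

  cauchy-ratio : ∀ K → ∃[ N ] (∀ m n → m ≥ N → n ≥ N →
    suc K * (A m * B n) ≤ suc K * (A n * B m) + B m * B n)
  cauchy-ratio = ratio-cauchy 10 A⪯A B⪯B (A≤2S ∧ (B≤2S ∧ S≤10B))

  open Limit A B B-positive gap cauchy-ratio public

theorem1p2 : ∀ (h : ℕ) → 2 ≤ h →
    (∃[ N ] (N > 0 × (∀ (n : ℕ) → n > N → a h n ≥ b h n)))
    × (∃[ γ ] (1ᴿ <ᴿ γ × RatioTendsTo (a h) (b h) γ))
theorem1p2 (suc (suc t)) (s≤s (s≤s _)) = a≥b , γ , 1<γ , tends
  where
  a≍ : a (suc (suc t)) ≍ OddLimits.e (suc t) 0 0
  a≍ = ≗-≍ (OddHooks.a-hooks (suc t)) (λ _ → refl) (OddBounds.hooks≍e (suc t))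
  b≍ : b (suc (suc t)) ≍ DistinctLimits.e (suc t) 1 0
  b≍ = ≗-≍ (DistinctHooks.b-hooks (suc t)) (λ _ → refl) (DistinctBounds.hooks≍e (suc t))
  open Asymptotics (a (suc (suc t))) (b (suc (suc t)))
    (proj₁ (≍-refl a≍)) (⪯-trans (proj₁ a≍) (OddBounds.e-upper (suc t)))
    (⪯-trans (OddBounds.4S⪯6e t) (⪯-· 6 (proj₂ a≍)))
    (proj₁ (≍-refl b≍)) (⪯-trans (⪯-· 60 (proj₁ b≍)) (DistinctBounds.60e⪯39S t))
    (⪯-trans (DistinctBounds.S⪯5e t) (⪯-· 5 (proj₂ b≍)))
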